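{- Let $n \geq 2$ be an integer. If $\varphi$ is an edge precoloring of $n$ edges of $K_{n,n} \square K_2$ using colors from $\{1,\dots,n+1\}$, then $\varphi$ can be extended to a proper $(n+1)$-edge coloring of $K_{n,n} \square K_2$.
   Context: $G \square H$ denotes the cartesian product of graphs $G$ and $H$. An edge precoloring of a graph is a proper edge coloring of some subset of its edges. A precoloring $\varphi$ is extended by a proper $t$-edge coloring $f$ (colors $\{1,\dots,t\}$) if $f(e)=\varphi(e)$ for every edge $e$ colored under $\varphi$. -}

module Defs where

open import Data.Nat using (ℕ; suc)
open import Data.Fin using (Fin)
open import Data.Maybe using (Maybe; just; nothing)
open import Data.Product using (_×_; _,_; Σ)
open import Data.List using (List; length; filter; allFin; concatMap; map; _++_)
open import Relation.Binary.PropositionalEquality using (_≡_; _≢_)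
open import Relation.Nullary using (¬_)
open import Data.Maybe using (is-just)
open import Data.Bool using (T?)

-- Vertices of K_{n,n} □ K_2: (s , i , l) where
--   s : Fin 2 is the side of the bipartition of K_{n,n},
--   i : Fin n is the index of the vertex on that side,
--   l : Fin 2 is the vertex of K_2 (the layer).
Vertex : ℕ → Set
Vertex n = Fin 2 × Fin n × Fin 2

data Edge (n : ℕ) : Set where
  -- edge (0,i,l)–(1,j,l) of the copy of K_{n,n} in layer l
  bip  : Fin n → Fin n → Fin 2 → Edge n
  -- edge (s,i,0)–(s,i,1) of the copy of K_2 at vertex (s,i) of K_{n,n}
  rung : Fin 2 → Fin n → Edge n

data _∈ₑ_ {n : ℕ} : Vertex n → Edge n → Set where
  bip-left  : ∀ {i j l} → (Fin.zero , i , l) ∈ₑ bip i j l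
  bip-right : ∀ {i j l} → (Fin.suc Fin.zero , j , l) ∈ₑ bip i j l
  rung-0    : ∀ {s i} → (s , i , Fin.zero) ∈ₑ rung s i
  rung-1    : ∀ {s i} → (s , i , Fin.suc Fin.zero) ∈ₑ rung s i

Adjacent : {n : ℕ} → Edge n → Edge n → Set
Adjacent {n} e e' = e ≢ e' × Σ (Vertex n) (λ v → v ∈ₑ e × v ∈ₑ e')

ProperColoring : (n t : ℕ) → (Edge n → Fin t) → Set
ProperColoring n t f = ∀ e e' → Adjacent e e' → f e ≢ f e'

Precoloring : (n t : ℕ) → Set
Precoloring n t = Edge n → Maybe (Fin t)

ProperPrecoloring : (n t : ℕ) → Precoloring n t → Set
ProperPrecoloring n t φ =
  ∀ e e' c → Adjacent e e' → φ e ≡ just c → φ e' ≢ just c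

-- explicit list of all edges of K_{n,n} □ K_2 (each exactly once)
allEdges : (n : ℕ) → List (Edge n)
allEdges n =
  concatMap (λ i → concatMap (λ j → map (bip i j) (allFin 2)) (allFin n)) (allFin n)
  ++ concatMap (λ s → map (rung s) (allFin n)) (allFin 2)

numColored : {n t : ℕ} → Precoloring n t → ℕ
numColored {n} φ = length (filter (λ e → T? (is-just (φ e))) (allEdges n))

Extends : {n t : ℕ} → (Edge n → Fin t) → Precoloring n t → Set
Extends {n} {t} f φ = ∀ e (c : Fin t) → φ e ≡ just c → f e ≡ c

-- If precoloured edges of K_{n,n} lie in both layers, take a colour z that is not used and give
-- it to all rungs at first.  Each precoloured rung of colour x selects greedily a cell (i , j),
-- which is to have colour x in both layers; exchanging x and z on the 4-cycle formed by the two
-- copies of this cell and the rungs at i and j then puts x on the rung.  Each layer has to be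
-- completed to a Latin square of order n from at most n - 1 cells, which is Evans' conjecture.
--
-- Otherwise one layer is copied to the other, and it remains to colour one copy of K_{n,n} with
-- n + 1 colours such that given colours are missing at the vertices with precoloured rungs.
-- Without rungs this follows from Evans' conjecture for order n + 1.  If some rung colour z does
-- not occur on a precoloured cell at a vertex with a precoloured rung, the exchange above works
-- with this z, since cells of colour z can be obtained by an exchange too.  If every colour occurs
-- at least twice, it works with a z that is not used, as n cells whose colours are all repeated
-- can be completed.  Otherwise a colour u occurs exactly once, on a cell; there are a vertex on
-- each side without precoloured edges and at least two rungs, so one deletes these vertices and
-- the cell, applies induction and restores them by Smetaniuk's prolongation with new colour u.
-- Evans' conjecture is proved by the same dichotomy between repeated and single colours.

module Submission where

open import Defs
open import Data.Bool using (T?)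
open import Data.Empty using (⊥)
open import Data.Fin using (Fin; zero; suc; toℕ; fromℕ; fromℕ<; inject₁; opposite; punchIn; punchOut)
open import Data.Fin.Permutation.Components using (transpose; transpose-inverse)
import Data.Fin.Properties as F
open import Data.List using (List; []; _∷_; _++_; length; map; concatMap; filter; allFin; tabulate; cartesianProduct)
open import Data.List.Properties using (length-++; length-map; length-tabulate; filter-notAll; concatMap-map)
import Data.List.Membership.DecPropositional as DecMembership
open import Data.List.Membership.Propositional using (_∈_; _∉_; find; lose)
import Data.List.Membership.Propositional.Properties as ∈
open import Data.List.Membership.Setoid.Properties using (index-injective)
open import Data.List.Relation.Unary.Any as Any using (Any; here; there; index)
open import Data.Maybe as Maybe using (Maybe; just; nothing; maybe′; is-just)
open import Data.Maybe.Properties using (just-injective; map-injective; ≡-dec)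
open import Data.Nat using (ℕ; zero; suc; _≥_; _+_; _*_; _≤_; _<_; z≤n; s≤s)
import Data.Nat.Properties as ℕ
open import Data.Product using (Σ; ∃; ∃₂; _×_; _,_; proj₁; proj₂)
open import Data.Sum using (_⊎_; inj₁; inj₂)
open import Data.Unit using (⊤; tt)
open import Function using (flip)
open import Relation.Binary using (Decidable; DecidableEquality)
open import Relation.Binary.PropositionalEquality
open import Relation.Nullary using (¬_; Dec; yes; no; contradiction)
open import Relation.Nullary.Decidable using (¬?; _×-dec_; _⊎-dec_; decidable-stable; map′)

-- Evans' bound is the obstacle: it admits `n - 1` cells in a square of order `n`, whereas `n` edges
-- are precoloured and each may cost a cell. Several cases therefore serve to save one element: a
-- cell of the other layer, or a rung that already has the base colour `z` and needs no exchange.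
-- Where all colours are repeated nothing is saved, but `n` cells are tolerable: a colour spread
-- over all rows and columns blocks at most two rows for later colours, which is paid for by the two
-- or more cells it had.
--
-- When a single colour is deleted, the rungs have to survive the induction, and a Latin square
-- cannot record them. Hence the prolongation is carried out for a `Corona`, an array with one
-- forbidden colour for each row and each column. This works because Smetaniuk's construction draws
-- the entries of an old row or column, apart from the new colour, from the old entries of that same
-- row or column. A Latin square of order `m + 1` is a corona of order `m` whose forbidden colours
-- are its own first row and column, so Evans' conjecture can use the same construction.

module _ {n : ℕ} where
  open DecMembership (F._≟_ {n}) public using () renaming (_∈?_ to _∈F?_)

opaque
  fresh : ∀ {n} (xs : List (Fin n)) → length xs < n → ∃ λ x → x ∉ xs
  fresh {n} xs xs<n = F.¬∀⟶∃¬ n (_∈ xs) (_∈F? xs) λ all∈ →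
    ℕ.<⇒≱ xs<n (F.injective⇒≤ {f = λ x → index (all∈ x)} (λ {x} {y} → index-injective (setoid _) (all∈ x) (all∈ y)))

-- Lengths of lists collected element by element.

module _ {A B : Set} (h : A → List B) where

  length-concatMap≤ : ∀ k → (∀ x → length (h x) ≤ k) → ∀ xs → length (concatMap h xs) ≤ k * length xs
  length-concatMap≤ k h≤ [] = z≤n
  length-concatMap≤ k h≤ (x ∷ xs) rewrite length-++ (h x) {concatMap h xs} | ℕ.*-suc k (length xs) =
    ℕ.+-mono-≤ (h≤ x) (length-concatMap≤ k h≤ xs)

  length-concatMap< : ∀ k → (∀ x → length (h x) ≤ k) → ∀ {x xs} → x ∈ xs → length (h x) < k →
                      length (concatMap h xs) < k * length xs
  length-concatMap< k h≤ {x} {y ∷ xs} (here refl) lt rewrite length-++ (h y) {concatMap h xs} | ℕ.*-suc k (length xs) =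
    ℕ.+-mono-<-≤ lt (length-concatMap≤ k h≤ xs)
  length-concatMap< k h≤ {x} {y ∷ xs} (there p) lt rewrite length-++ (h y) {concatMap h xs} | ℕ.*-suc k (length xs) =
    ℕ.+-mono-≤-< (h≤ y) (length-concatMap< k h≤ p lt)

  module _ (h≤1 : ∀ x → length (h x) ≤ 1) where

    length-select≤ : ∀ xs → length (concatMap h xs) ≤ length xs
    length-select≤ xs = subst (λ t → length (concatMap h xs) ≤ t) (ℕ.*-identityˡ _) (length-concatMap≤ 1 h≤1 xs)

    length-select< : ∀ {x xs} → x ∈ xs → h x ≡ [] → length (concatMap h xs) < length xs
    length-select< {xs = xs} p eq = subst (λ t → length (concatMap h xs) < t) (ℕ.*-identityˡ _) (length-concatMap< 1 h≤1 p (subst (λ l → length l < 1) (sym eq) (s≤s z≤n)))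

    length-select<< : ∀ {x y xs} → x ∈ xs → y ∈ xs → x ≢ y → h x ≡ [] → h y ≡ [] →
                      2 + length (concatMap h xs) ≤ length xs
    length-select<< (here refl) (here refl) x≢y _ _ = contradiction refl x≢y
    length-select<< {x} {y} {z ∷ xs} (here refl) (there q) x≢y hx hy rewrite hx = s≤s (length-select< q hy)
    length-select<< {x} {y} {z ∷ xs} (there p) (here refl) x≢y hx hy rewrite hy = s≤s (length-select< p hx)
    length-select<< {x} {y} {z ∷ xs} (there p) (there q) x≢y hx hy rewrite length-++ (h z) {concatMap h xs} =
      ℕ.≤-trans (ℕ.≤-reflexive (trans (cong suc (sym (ℕ.+-suc (length (h z)) _))) (sym (ℕ.+-suc (length (h z)) _))))
        (ℕ.+-mono-≤ (h≤1 z) (length-select<< p q x≢y hx hy))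

  ∈-select⁺ : ∀ {x y xs} → x ∈ xs → y ∈ h x → y ∈ concatMap h xs
  ∈-select⁺ {xs = z ∷ xs} (here refl) q = ∈.∈-++⁺ˡ q
  ∈-select⁺ {xs = z ∷ xs} (there p) q = ∈.∈-++⁺ʳ (h z) (∈-select⁺ p q)

  ∈-select⁻ : ∀ {y} xs → y ∈ concatMap h xs → ∃ λ x → x ∈ xs × y ∈ h x
  ∈-select⁻ (x ∷ xs) p with ∈.∈-++⁻ (h x) p
  ... | inj₁ q = x , here refl , q
  ... | inj₂ q with ∈-select⁻ xs q
  ...   | z , z∈ , y∈ = z , there z∈ , y∈

-- Maximal paths of injective partial functions.

record Chain {n : ℕ} (S : Fin n → Fin n → Set) (s : Fin n) : Set where
  field
    members : List (Fin n)
    start   : s ∈ members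
    closed  : ∀ {x y} → x ∈ members → S x y → y ∈ members
    pred    : ∀ {y} → y ∈ members → y ≢ s → ∃ λ x → x ∈ members × S x y
    end     : Fin n
    end∈    : end ∈ members
    end-max : ∀ {y} → ¬ S end y
    next    : ∀ {x} → x ∈ members → x ≢ end → ∃ λ y → S x y

module _ {n : ℕ} (S : Fin n → Fin n → Set) (S? : Decidable S)
         (S-fun : ∀ {x y z} → S x y → S x z → y ≡ z)
         (S-inj : ∀ {x y z} → S x z → S y z → x ≡ y)
         (s : Fin n) (s-min : ∀ {x} → ¬ S x s) where

  private
    grow : ∀ fuel (x : Fin n) (V U : List (Fin n)) → length U < fuel → x ∉ V → s ∈ x ∷ V →
           (∀ {v y} → v ∈ V → S v y → y ∈ x ∷ V) →
           (∀ {y} → y ∈ x ∷ V → y ≢ s → ∃ λ p → p ∈ V × S p y) →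
           (∀ {v} → v ∈ V → ∃ λ y → S v y) →
           (∀ y → y ∈ x ∷ V ⊎ y ∈ U) → Chain S s
    grow (suc fuel) x V U U<f x∉V s∈ closed pred next cover with F.any? (S? x)
    ... | no max = record
          { members = x ∷ V ; start = s∈
          ; closed = λ { (here refl) Sxy → contradiction (_ , Sxy) max ; (there v∈) → closed v∈ }
          ; pred = λ y∈ y≢s → let p , p∈ , Spy = pred y∈ y≢s in p , there p∈ , Spy
          ; end = x ; end∈ = here refl ; end-max = λ Sxy → max (_ , Sxy)
          ; next = λ { (here refl) x≢x → contradiction refl x≢x ; (there v∈) _ → next v∈ } }
    ... | yes (y , Sxy) = grow fuel y (x ∷ V) (filter (λ u → ¬? (u F.≟ y)) U)
            (ℕ.≤-trans (filter-notAll (λ u → ¬? (u F.≟ y)) U (Any.map (λ eq ne → ne (sym eq)) y∈U)) (ℕ.≤-pred U<f))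
            y∉ (there s∈) closed′ pred′ (λ { (here refl) → _ , Sxy ; (there v∈) → next v∈ }) cover′
      where
      y≢s : y ≢ s
      y≢s refl = s-min Sxy
      -- A visited `y` would have a predecessor in `V`. By injectivity this predecessor is `x`,
      -- which lies outside `V`.
      y∉ : y ∉ x ∷ V
      y∉ y∈ with pred y∈ y≢s
      ... | p , p∈ , Spy = x∉V (subst (_∈ V) (S-inj Spy Sxy) p∈)
      y∈U : y ∈ U
      y∈U with cover y
      ... | inj₁ y∈ = contradiction y∈ y∉
      ... | inj₂ y∈ = y∈
      closed′ : ∀ {v z} → v ∈ x ∷ V → S v z → z ∈ y ∷ x ∷ V
      closed′ (here refl) Sxz = here (S-fun Sxz Sxy)
      closed′ (there v∈) Svz = there (closed v∈ Svz)
      pred′ : ∀ {z} → z ∈ y ∷ x ∷ V → z ≢ s → ∃ λ p → p ∈ x ∷ V × S p z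
      pred′ (here refl) _ = x , here refl , Sxy
      pred′ (there z∈) z≢s = let p , p∈ , Spz = pred z∈ z≢s in p , there p∈ , Spz
      cover′ : ∀ z → z ∈ y ∷ x ∷ V ⊎ z ∈ filter (λ u → ¬? (u F.≟ y)) U
      cover′ z with z F.≟ y | cover z
      ... | yes refl | _ = inj₁ (here refl)
      ... | no _ | inj₁ z∈ = inj₁ (there z∈)
      ... | no z≢y | inj₂ z∈ = inj₂ (∈.∈-filter⁺ (λ u → ¬? (u F.≟ y)) z∈ z≢y)

  opaque
    -- `S` is an injective partial function and `s` has no predecessor, so the path from `s` never
    -- meets itself and has to stop. It serves twice: for Kempe chains of rows, and for the
    -- successive displacements in Smetaniuk's prolongation.
    chain : Chain S s
    chain = grow (suc (length (allFin n))) s [] (allFin n) ℕ.≤-refl (λ ()) (here refl) (λ ())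
              (λ { (here eq) y≢s → contradiction eq y≢s }) (λ ()) (λ y → inj₂ (∈.∈-allFin y))

-- Partial Latin arrays and Kempe chains

record Proper {n} {C : Set} (L : Fin n → Fin n → C) : Set where
  field
    row : ∀ {i j j′} → L i j ≡ L i j′ → j ≡ j′
    col : ∀ {i i′ j} → L i j ≡ L i′ j → i ≡ i′

Partial : ℕ → Set
Partial n = Fin n → Fin n → Maybe (Fin n)

record PartialProper {n} (f : Partial n) : Set where
  field
    row : ∀ {i j j′ c} → f i j ≡ just c → f i j′ ≡ just c → j ≡ j′
    col : ∀ {i i′ j c} → f i j ≡ just c → f i′ j ≡ just c → i ≡ i′

_≟ᴹ_ : ∀ {n} → Decidable (_≡_ {A = Maybe (Fin n)})
_≟ᴹ_ = ≡-dec F._≟_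

Full : ∀ {n} → Partial n → Fin n → Set
Full f c = (∀ i → ∃ λ j → f i j ≡ just c) × (∀ j → ∃ λ i → f i j ≡ just c)

-- If every colour occurred, one position for each colour and the empty position would be `n + 1`
-- different positions among `n`.
missing-colour : ∀ {n} (line : Fin n → Maybe (Fin n)) {j} → line j ≡ nothing → ∃ λ c → ∀ k → line k ≢ just c
missing-colour {n} line {j} j-empty =
  let c , c∉ = F.¬∀⟶∃¬ n (λ c → ∃ λ k → line k ≡ just c) (λ c → F.any? λ k → line k ≟ᴹ just c) ¬all
  in c , λ k eq → c∉ (k , eq)
  where
  module _ (all : ∀ c → ∃ λ k → line k ≡ just c) where
    place : Fin (suc n) → Fin n
    place zero    = j
    place (suc c) = proj₁ (all c)
    place-injective : ∀ {x y} → place x ≡ place y → x ≡ y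
    place-injective {zero}  {zero}  eq = refl
    place-injective {zero}  {suc c} eq = contradiction (trans (sym j-empty) (trans (cong line eq) (proj₂ (all c)))) λ ()
    place-injective {suc c} {zero}  eq = contradiction (trans (sym j-empty) (trans (cong line (sym eq)) (proj₂ (all c)))) λ ()
    place-injective {suc c} {suc d} eq =
      cong suc (just-injective (trans (sym (proj₂ (all c))) (trans (cong line eq) (proj₂ (all d)))))
  ¬all : ¬ (∀ c → ∃ λ k → line k ≡ just c)
  ¬all all = ℕ.<⇒≱ (ℕ.n<1+n n) (F.injective⇒≤ (place-injective all))

record Extension {n} (f : Partial n) (cells : List (Fin n × Fin n)) : Set where
  field
    g       : Partial n
    proper  : PartialProper g
    grows   : ∀ {i j c} → f i j ≡ just c → ∃ λ d → g i j ≡ just d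
    fills   : ∀ {i j} → (i , j) ∈ cells → ∃ λ d → g i j ≡ just d
    keeps   : ∀ {i j c} → Full f c → f i j ≡ just c → g i j ≡ just c

-- The empty cell receives `α`, and every later row of the chain exchanges `α` and `β` throughout.
-- Properness within such a row is then automatic; the chain determines which rows have to follow so
-- that the columns remain proper as well.
module Kempe {n} (f : Partial n) (f-proper : PartialProper f) {i j : Fin n} (empty : f i j ≡ nothing)
             {α β : Fin n} (α∉row : ∀ q → f i q ≢ just α) (β∉col : ∀ p → f p j ≢ just β) where
  open PartialProper f-proper

  private
    -- Src x q: the chain, if it reaches row x, puts α at (x , q).
    Src : Fin n → Fin n → Set
    Src x q = (x ≡ i × q ≡ j) ⊎ (x ≢ i × f x q ≡ just β)

    S : Fin n → Fin n → Set
    S x y = ∃ λ q → Src x q × f y q ≡ just α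

    Src-fun : ∀ {x q q′} → Src x q → Src x q′ → q ≡ q′
    Src-fun (inj₁ (_ , refl)) (inj₁ (_ , refl)) = refl
    Src-fun (inj₁ (eq , _)) (inj₂ (ne , _)) = contradiction eq ne
    Src-fun (inj₂ (ne , _)) (inj₁ (eq , _)) = contradiction eq ne
    Src-fun (inj₂ (_ , e)) (inj₂ (_ , e′)) = row e e′

    Src-inj : ∀ {x y q} → Src x q → Src y q → x ≡ y
    Src-inj (inj₁ (refl , _)) (inj₁ (refl , _)) = refl
    Src-inj (inj₁ (_ , refl)) (inj₂ (_ , e)) = contradiction e (β∉col _)
    Src-inj (inj₂ (_ , e)) (inj₁ (_ , refl)) = contradiction e (β∉col _)
    Src-inj (inj₂ (_ , e)) (inj₂ (_ , e′)) = col e e′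

    S-inj : ∀ {x y z} → S x z → S y z → x ≡ y
    S-inj (q , sx , e) (q′ , sy , e′) with refl ← row e e′ = Src-inj sx sy

    Z : Chain S i
    Z = chain S
      (λ x y → F.any? λ q → ((x F.≟ i ×-dec q F.≟ j) ⊎-dec (¬? (x F.≟ i) ×-dec (f x q ≟ᴹ just β))) ×-dec (f y q ≟ᴹ just α))
      (λ { (q , sx , e) (q′ , sx′ , e′) → col e (subst (λ r → f _ r ≡ just α) (Src-fun sx′ sx) e′) })
      S-inj i (λ { (q , _ , e) → α∉row q e })

    open Chain Z

    swap : Fin n → Fin n
    swap c with c F.≟ α | c F.≟ β
    ... | yes _ | _     = β
    ... | no _  | yes _ = α
    ... | no _  | no _  = c

    data Swap (c : Fin n) : Fin n → Set where
      α↦β   : c ≡ α → Swap c β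
      β↦α   : c ≡ β → Swap c α
      fixed : c ≢ α → c ≢ β → Swap c c

    swap-view : ∀ c → Swap c (swap c)
    swap-view c with c F.≟ α | c F.≟ β
    ... | yes p | _     = α↦β p
    ... | no _  | yes p = β↦α p
    ... | no p  | no q  = fixed p q

    swapped : Fin n → Fin n → Maybe (Fin n)
    swapped p q with p F.≟ i | q F.≟ j | p ∈F? members
    ... | yes _ | yes _ | _     = just α
    ... | yes _ | no _  | _     = f p q
    ... | no _  | _     | yes _ = Maybe.map swap (f p q)
    ... | no _  | _     | no _  = f p q

    data Origin (p q c : Fin n) : Set where
      new   : p ≡ i → q ≡ j → c ≡ α → Origin p q c
      flipped : p ≢ i → p ∈ members → ∀ d → f p q ≡ just d → Swap d c → Origin p q c
      old   : p ≡ i ⊎ p ∉ members → f p q ≡ just c → Origin p q c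

    origin : ∀ p q {c} → swapped p q ≡ just c → Origin p q c
    origin p q eq with p F.≟ i | q F.≟ j | p ∈F? members
    ... | yes p≡ | yes q≡ | _     = new p≡ q≡ (sym (just-injective eq))
    ... | yes p≡ | no _   | _     = old (inj₁ p≡) eq
    ... | no _   | _      | no p∉ = old (inj₂ p∉) eq
    ... | no p≢  | _      | yes p∈ with f p q in e
    origin p q refl | no p≢ | _ | yes p∈ | just d = flipped p≢ p∈ d e (swap-view d)

    Swap-inj : ∀ {c d e} → Swap c e → Swap d e → c ≡ d
    Swap-inj (α↦β refl) (α↦β refl) = refl
    Swap-inj (α↦β refl) (β↦α refl) = refl
    Swap-inj (α↦β refl) (fixed _ x) = contradiction refl x
    Swap-inj (β↦α refl) (α↦β refl) = refl
    Swap-inj (β↦α refl) (β↦α refl) = refl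
    Swap-inj (β↦α refl) (fixed x _) = contradiction refl x
    Swap-inj (fixed _ x) (α↦β refl) = contradiction refl x
    Swap-inj (fixed x _) (β↦α refl) = contradiction refl x
    Swap-inj (fixed _ _) (fixed _ _) = refl

    row′ : ∀ {p q q′ c} → Origin p q c → Origin p q′ c → q ≡ q′
    row′ (new _ refl _) (new _ refl _) = refl
    row′ (new p≡ _ _) (flipped p≢ _ _ _ _) = contradiction p≡ p≢
    row′ (new refl _ refl) (old _ e) = contradiction e (α∉row _)
    row′ (flipped p≢ _ _ _ _) (new p≡ _ _) = contradiction p≡ p≢
    row′ (flipped _ _ d e s) (flipped _ _ d′ e′ s′) with refl ← Swap-inj s s′ = row e e′
    row′ (flipped p≢ _ _ _ _) (old (inj₁ p≡) _) = contradiction p≡ p≢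
    row′ (flipped _ p∈ _ _ _) (old (inj₂ p∉) _) = contradiction p∈ p∉
    row′ (old _ e) (new refl _ refl) = contradiction e (α∉row _)
    row′ (old (inj₁ p≡) _) (flipped p≢ _ _ _ _) = contradiction p≡ p≢
    row′ (old (inj₂ p∉) _) (flipped _ p∈ _ _ _) = contradiction p∈ p∉
    row′ (old _ e) (old _ e′) = row e e′

    new-old : ∀ {p′ q c} → q ≡ j → c ≡ α → p′ ≡ i ⊎ p′ ∉ members → f p′ q ≡ just c → i ≡ p′
    new-old refl refl (inj₁ eq) e = sym eq
    new-old refl refl (inj₂ p′∉) e = contradiction (closed start (_ , inj₁ (refl , refl) , e)) p′∉

    -- The critical case for columns is a changed row next to an unchanged one. If `p` receives `α`,
    -- an unchanged row with `α` in this column would have been the next of the chain. If `p`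
    -- receives `β`, then its predecessor either held the `β` of this very column, and so was
    -- changed too, or is the start, whose column has no `β`.
    flip-old : ∀ {p p′ q c d} → p ≢ i → p ∈ members → f p q ≡ just d → Swap d c →
               p′ ≡ i ⊎ p′ ∉ members → f p′ q ≡ just c → p ≡ p′
    flip-old p≢ p∈ e (β↦α refl) (inj₁ refl) e′ = contradiction e′ (α∉row _)
    flip-old p≢ p∈ e (β↦α refl) (inj₂ p′∉) e′ = contradiction (closed p∈ (_ , inj₂ (p≢ , e) , e′)) p′∉
    flip-old p≢ p∈ e (fixed _ _) _ e′ = col e e′
    flip-old p≢ p∈ e (α↦β refl) kept e′ with pred p∈ p≢
    ... | x , x∈ , q₀ , src , e₀ with refl ← row e₀ e with src | kept
    ...   | inj₁ (_ , refl) | _ = contradiction e′ (β∉col _)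
    ...   | inj₂ (x≢ , ex)  | inj₁ p′≡ = contradiction (trans (col ex e′) p′≡) x≢
    ...   | inj₂ (x≢ , ex)  | inj₂ p′∉ = contradiction (subst (_∈ members) (col ex e′) x∈) p′∉

    col′ : ∀ {p p′ q c} → Origin p q c → Origin p′ q c → p ≡ p′
    col′ (new refl _ _) (new refl _ _) = refl
    col′ (new _ refl refl) (flipped _ _ d e (β↦α refl)) = contradiction e (β∉col _)
    col′ (new _ refl refl) (flipped _ _ d e (fixed ne _)) = contradiction refl ne
    col′ (new _ refl refl) (flipped _ _ d e (α↦β refl)) = contradiction e (β∉col _)
    col′ (new refl q≡ c≡) (old k e) = new-old q≡ c≡ k e
    col′ (flipped _ _ d e (β↦α refl)) (new _ refl refl) = contradiction e (β∉col _)
    col′ (flipped _ _ d e (fixed ne _)) (new _ refl refl) = contradiction refl ne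
    col′ (flipped _ _ d e (α↦β refl)) (new _ refl refl) = contradiction e (β∉col _)
    col′ (flipped _ _ d e s) (flipped _ _ d′ e′ s′) with refl ← Swap-inj s s′ = col e e′
    col′ (flipped p≢ p∈ d e s) (old k e′) = flip-old p≢ p∈ e s k e′
    col′ (old k e) (new refl q≡ c≡) = sym (new-old q≡ c≡ k e)
    col′ (old k e′) (flipped p≢ p∈ d e s) = sym (flip-old p≢ p∈ e s k e′)
    col′ (old _ e) (old _ e′) = col e e′

    grows : ∀ {p q c} → f p q ≡ just c → ∃ λ d → swapped p q ≡ just d
    grows {p} {q} e with p F.≟ i | q F.≟ j | p ∈F? members
    ... | yes _ | yes _ | _     = _ , refl
    ... | yes _ | no _  | _     = _ , e
    ... | no _  | _     | no _  = _ , e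
    ... | no _  | _     | yes _ rewrite e = _ , refl

    fills : ∀ {p q} → p ≡ i → q ≡ j → ∃ λ d → swapped p q ≡ just d
    fills {p} {q} p≡ q≡ with p F.≟ i | q F.≟ j
    ... | yes _ | yes _ = _ , refl
    ... | yes _ | no ne = contradiction q≡ ne
    ... | no ne | _     = contradiction p≡ ne

    keeps : ∀ {p q c} → Full f c → f p q ≡ just c → swapped p q ≡ just c
    keeps {p} {q} {c} (fr , fc) e with p F.≟ i | q F.≟ j | p ∈F? members
    ... | yes refl | yes refl | _ = contradiction (trans (sym e) empty) λ ()
    ... | yes _ | no _  | _     = e
    ... | no _  | _     | no _  = e
    ... | no _  | _     | yes _ rewrite e with c F.≟ α | c F.≟ β
    ...   | yes refl | _ = contradiction (proj₂ (fr i)) (α∉row _)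
    ...   | no _ | yes refl = contradiction (proj₂ (fc j)) (β∉col _)
    ...   | no _ | no _ = refl

  extension : Extension f ((i , j) ∷ [])
  extension = record
    { g = swapped
    ; proper = record
        { row = λ {p} {q} {q′} e e′ → row′ (origin p q e) (origin p q′ e′)
        ; col = λ {p} {p′} {q} e e′ → col′ (origin p q e) (origin p′ q e′) }
    ; grows = grows
    ; fills = λ { (here refl) → fills refl refl }
    ; keeps = keeps }

fill-cells : ∀ {n} (f : Partial n) → PartialProper f → ∀ cells → Extension f cells
fill-cells f f-proper [] = record
  { g = f ; proper = f-proper ; grows = λ e → _ , e ; fills = λ () ; keeps = λ _ e → e }
fill-cells f f-proper ((i , j) ∷ cells) with fill-cells f f-proper cells
... | E with Extension.g E i j in eq
... | just c = record
  { g = g ; proper = proper ; grows = grows ; keeps = keeps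
  ; fills = λ { (here refl) → _ , eq ; (there p) → fills p } }
  where open Extension E
... | nothing = record
  { g = K.g ; proper = K.proper
  ; grows = λ e → K.grows (proj₂ (E.grows e))
  ; fills = λ { (here refl) → K.fills (here refl) ; (there p) → K.grows (proj₂ (E.fills p)) }
  ; keeps = λ { full@(fr , fc) e → K.keeps
      ((λ p → let q , e′ = fr p in q , E.keeps full e′) , (λ q → let p , e′ = fc q in p , E.keeps full e′))
      (E.keeps full e) } }
  where
  module E = Extension E
  module K = Extension (Kempe.extension E.g E.proper eq
    (proj₂ (missing-colour (E.g i) eq)) (proj₂ (missing-colour (λ p → E.g p j) eq)))

opaque
  -- This is König's edge colouring theorem. Entries may be recoloured on the way, but a full colour
  -- takes no part in any exchange, since one of the two exchanged colours is missing in the row and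
  -- the other in the column of the cell being filled.
  complete : ∀ {n} (f : Partial n) → PartialProper f →
             Σ (Fin n → Fin n → Fin n) λ L → Proper L × (∀ {i j c} → Full f c → f i j ≡ just c → L i j ≡ c)
  complete {n} f f-proper = L , record
    { row = λ {i} {j} {j′} e → PartialProper.row proper (L-spec i j) (trans (L-spec i j′) (cong just (sym e)))
    ; col = λ {i} {i′} {j} e → PartialProper.col proper (L-spec i j) (trans (L-spec i′ j) (cong just (sym e))) }
    , λ {i} {j} full e → just-injective (trans (sym (L-spec i j)) (keeps full e))
    where
    open Extension (fill-cells f f-proper (cartesianProduct (allFin n) (allFin n)))
    filled : ∀ i j → ∃ λ d → g i j ≡ just d
    filled i j = fills (∈.∈-cartesianProduct⁺ (∈.∈-allFin i) (∈.∈-allFin j))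
    L : Fin n → Fin n → Fin n
    L i j = proj₁ (filled i j)
    L-spec : ∀ i j → g i j ≡ just (L i j)
    L-spec i j = proj₂ (filled i j)

-- Completing cells with repeated colours

Cell : ℕ → ℕ → Set
Cell n k = Fin n × Fin n × Fin k

record Consistent {n k} (E : List (Cell n k)) : Set where
  field
    cell : ∀ {i j c d} → (i , j , c) ∈ E → (i , j , d) ∈ E → c ≡ d
    row  : ∀ {i j j′ c} → (i , j , c) ∈ E → (i , j′ , c) ∈ E → j ≡ j′
    col  : ∀ {i i′ j c} → (i , j , c) ∈ E → (i′ , j , c) ∈ E → i ≡ i′

-- In a consistent list a second cell of the same colour lies in another row anyway, so the
-- condition compares rows instead of cells.
Repeated : ∀ {n k} → List (Cell n k) → Set
Repeated E = ∀ {i j c} → (i , j , c) ∈ E → ∃₂ λ i′ j′ → (i′ , j′ , c) ∈ E × i′ ≢ i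

Completion : ∀ {n} → List (Cell n n) → Set
Completion {n} E = Σ (Fin n → Fin n → Fin n) λ L → Proper L × (∀ {i j c} → (i , j , c) ∈ E → L i j ≡ c)

RowHas ColHas : ∀ {n} → Partial n → Fin n → Fin n → Set
RowHas g l i = ∃ λ j → g i j ≡ just l
ColHas g l j = ∃ λ i → g i j ≡ just l

rowHas? : ∀ {n} (g : Partial n) l i → Dec (RowHas g l i)
rowHas? g l i = F.any? λ j → g i j ≟ᴹ just l

-- The cells of colour `l` form a partial map from rows to columns that is undefined at `r`, hence
-- it misses a column: this is `missing-colour` with columns in the place of colours.
lacking-col : ∀ {n} (g : Partial n) → (∀ {i j j′ c} → g i j ≡ just c → g i j′ ≡ just c → j ≡ j′) →
              ∀ {l r} → ¬ RowHas g l r → ∃ λ c → ¬ ColHas g l c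
lacking-col {n} g row {l} {r} lacks =
  let c , c∉ = missing-colour line line-r in c , λ { (i , e) → c∉ i (line-spec e) }
  where
  line : Fin n → Maybe (Fin n)
  line i with rowHas? g l i
  ... | yes (j , _) = just j
  ... | no _        = nothing
  line-r : line r ≡ nothing
  line-r with rowHas? g l r
  ... | yes has = contradiction has lacks
  ... | no _    = refl
  line-spec : ∀ {i j} → g i j ≡ just l → line i ≡ just j
  line-spec {i} e with rowHas? g l i
  ... | yes (j′ , e′) = cong just (row e′ e)
  ... | no lacks′     = contradiction (_ , e) lacks′

opaque
  update : ∀ {n} → Fin n → Fin n → Maybe (Fin n) → Partial n → Partial n
  update i j m g p q with p F.≟ i | q F.≟ j
  ... | yes _ | yes _ = m
  ... | yes _ | no _  = g p q
  ... | no _  | _     = g p q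

  update-≡ : ∀ {n} {i j : Fin n} {m : Maybe (Fin n)} {g : Partial n} {p q} →
             p ≡ i → q ≡ j → update i j m g p q ≡ m
  update-≡ {i = i} {j} {p = p} {q} p≡ q≡ with p F.≟ i | q F.≟ j
  ... | yes _ | yes _ = refl
  ... | yes _ | no q≢ = contradiction q≡ q≢
  ... | no p≢ | _     = contradiction p≡ p≢

  update-there : ∀ {n} {i j : Fin n} {m : Maybe (Fin n)} {g : Partial n} {p q} →
                 ¬ (p ≡ i × q ≡ j) → update i j m g p q ≡ g p q
  update-there {i = i} {j} {p = p} {q} ne with p F.≟ i | q F.≟ j
  ... | yes p≡ | yes q≡ = contradiction (p≡ , q≡) ne
  ... | yes _ | no _    = refl
  ... | no _  | _       = refl

  update⁻ : ∀ {n} {i j : Fin n} {m : Maybe (Fin n)} {g : Partial n} {p q c} →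
            update i j m g p q ≡ just c → (p ≡ i × q ≡ j × m ≡ just c) ⊎ g p q ≡ just c
  update⁻ {i = i} {j} {p = p} {q} e with p F.≟ i | q F.≟ j
  ... | yes p≡ | yes q≡ = inj₁ (p≡ , q≡ , e)
  ... | yes _ | no _    = inj₂ e
  ... | no _  | _       = inj₂ e

update-here : ∀ {n} {i j : Fin n} {m : Maybe (Fin n)} {g : Partial n} → update i j m g i j ≡ m
update-here = update-≡ refl refl

module _ {n : ℕ} (E : List (Cell n n)) where

  -- The colours in done occupy every row and column; every other entry of g is
  -- a cell of rest or has a colour in touched.
  record Stage (done touched : List (Fin n)) (rest : List (Cell n n)) (g : Partial n) : Set where
    field
      proper : PartialProper g
      full   : ∀ {c} → c ∈ done → Full g c
      agrees : ∀ {i j c} → (i , j , c) ∈ E → g i j ≡ just c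
      source : ∀ {i j c} → g i j ≡ just c → c ∈ touched ⊎ (i , j , c) ∈ rest
      rest⊆  : ∀ {e} → e ∈ rest → e ∈ E
    open PartialProper proper public

  module _ {done : List (Fin n)} {rest : List (Cell n n)} {l : Fin n} where

    erase : ∀ {g} → Stage done (l ∷ done) rest g → ∀ {i j} → g i j ≡ just l → (i , j , l) ∉ E → l ∉ done →
            Stage done (l ∷ done) rest (update i j nothing g)
    erase {g} S {i} {j} g≡l ∉E l∉ = record
      { proper = record { row = λ e e′ → row (old e) (old e′) ; col = λ e e′ → col (old e) (old e′) }
      ; full = λ c∈ → let fr , fc = full c∈ in
          (λ p → let q , e = fr p in q , keep c∈ e) , (λ q → let p , e = fc q in p , keep c∈ e)
      ; agrees = λ e∈ → trans (update-there λ { (refl , refl) → ∉E (subst (λ c → (i , j , c) ∈ E) (just-injective (trans (sym (agrees e∈)) g≡l)) e∈) }) (agrees e∈)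
      ; source = λ e → source (old e)
      ; rest⊆ = rest⊆ }
      where
      open Stage S
      old : ∀ {p q c} → update i j nothing g p q ≡ just c → g p q ≡ just c
      old e with update⁻ e
      ... | inj₁ (_ , _ , ())
      ... | inj₂ e′ = e′
      keep : ∀ {p q c} → c ∈ done → g p q ≡ just c → update i j nothing g p q ≡ just c
      keep c∈ e = trans (update-there λ { (refl , refl) → l∉ (subst (_∈ done) (just-injective (trans (sym e) g≡l)) c∈) }) e

    insert : ∀ {g} → Stage done (l ∷ done) rest g → ∀ {i j} → g i j ≡ nothing → ¬ RowHas g l i → ¬ ColHas g l j →
             Stage done (l ∷ done) rest (update i j (just l) g)
    insert {g} S {i} {j} empty ¬row ¬col = record
      { proper = record { row = row′ ; col = col′ }
      ; full = λ c∈ → let fr , fc = full c∈ in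
          (λ p → let q , e = fr p in q , keep e) , (λ q → let p , e = fc q in p , keep e)
      ; agrees = λ e∈ → keep (agrees e∈)
      ; source = source′
      ; rest⊆ = rest⊆ }
      where
      open Stage S
      keep : ∀ {p q c} → g p q ≡ just c → update i j (just l) g p q ≡ just c
      keep e = trans (update-there λ { (refl , refl) → contradiction (trans (sym e) empty) λ () }) e
      row′ : ∀ {p q q′ c} → update i j (just l) g p q ≡ just c → update i j (just l) g p q′ ≡ just c → q ≡ q′
      row′ e e′ with update⁻ e | update⁻ e′
      ... | inj₁ (refl , refl , _) | inj₁ (_ , refl , _) = refl
      ... | inj₁ (refl , refl , refl) | inj₂ o′ = contradiction (_ , o′) ¬row
      ... | inj₂ o | inj₁ (refl , refl , refl) = contradiction (_ , o) ¬row
      ... | inj₂ o | inj₂ o′ = row o o′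
      col′ : ∀ {p p′ q c} → update i j (just l) g p q ≡ just c → update i j (just l) g p′ q ≡ just c → p ≡ p′
      col′ e e′ with update⁻ e | update⁻ e′
      ... | inj₁ (refl , refl , _) | inj₁ (refl , _ , _) = refl
      ... | inj₁ (refl , refl , refl) | inj₂ o′ = contradiction (_ , o′) ¬col
      ... | inj₂ o | inj₁ (refl , refl , refl) = contradiction (_ , o) ¬col
      ... | inj₂ o | inj₂ o′ = col o o′
      source′ : ∀ {p q c} → update i j (just l) g p q ≡ just c → c ∈ l ∷ done ⊎ (p , q , c) ∈ rest
      source′ e with update⁻ e
      ... | inj₁ (_ , _ , refl) = inj₁ (here refl)
      ... | inj₂ o = source o

    -- Only the set of rows containing `l` has to grow; inside a row `l` may change its place.
    record Progress (g : Partial n) : Set where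
      field
        g′     : Partial n
        stage  : Stage done (l ∷ done) rest g′
        keeps  : ∀ {i} → RowHas g l i → RowHas g′ l i
        target : Fin n
        before : ¬ RowHas g l target
        after  : RowHas g′ l target

    module _ (repeated : Repeated rest) (small : 2 * length done + length rest ≤ n)
             {g} (S : Stage done (l ∷ done) rest g) {r} (r-lacks : ¬ RowHas g l r) where
      open Stage S

      private
        l∉done : l ∉ done
        l∉done l∈ = r-lacks (proj₁ (full l∈) r)

        c = proj₁ (lacking-col g row r-lacks)
        c-lacks : ¬ ColHas g l c
        c-lacks = proj₂ (lacking-col g row r-lacks)

        add : ∀ {i j} → g i j ≡ nothing → ¬ RowHas g l i → ¬ ColHas g l j → Progress g
        add {i} {j} empty ¬row ¬col = record
          { g′ = update i j (just l) g ; stage = insert S empty ¬row ¬col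
          ; keeps = λ { (q , e) → q , trans (update-there λ { (refl , refl) → ¬row (_ , e) }) e }
          ; target = i ; before = ¬row ; after = j , update-here {g = g} }

        move : ∀ {i j} → g i j ≡ just l → (i , j , l) ∉ E → g i c ≡ nothing → g r j ≡ nothing → Progress g
        move {i} {j} ij≡l ∉E ic rj = record
          { g′ = g₃ ; stage = S₃ ; keeps = keeps₃ ; target = r ; before = r-lacks
          ; after = j , update-here {g = g₂} }
          where
          i≢r : i ≢ r
          i≢r refl = r-lacks (_ , ij≡l)
          j≢c : j ≢ c
          j≢c refl = c-lacks (_ , ij≡l)
          g₁ = update i j nothing g
          S₁ : Stage done (l ∷ done) rest g₁
          S₁ = erase S ij≡l ∉E l∉done
          old₁ : ∀ {p q} → g₁ p q ≡ just l → g p q ≡ just l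
          old₁ {p} {q} e with update⁻ {p = p} {q} e
          ... | inj₁ (_ , _ , ())
          ... | inj₂ e′ = e′
          gone : ∀ {p q} → g₁ p q ≡ just l → ¬ (p ≡ i × q ≡ j)
          gone e (refl , refl) = contradiction (trans (sym (update-here {g = g})) e) λ ()
          i-lacks₁ : ¬ RowHas g₁ l i
          i-lacks₁ (q , e) = gone e (refl , row (old₁ e) ij≡l)
          g₂ = update i c (just l) g₁
          S₂ : Stage done (l ∷ done) rest g₂
          S₂ = insert S₁ (trans (update-there λ { (_ , c≡j) → j≢c (sym c≡j) }) ic) i-lacks₁ (λ { (p , e) → c-lacks (p , old₁ e) })
          old₂ : ∀ {p q} → ¬ (p ≡ i × q ≡ c) → g₂ p q ≡ just l → g₁ p q ≡ just l
          old₂ ne e = trans (sym (update-there ne)) e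
          g₃ = update r j (just l) g₂
          S₃ : Stage done (l ∷ done) rest g₃
          S₃ = insert S₂
            (trans (update-there λ { (r≡i , _) → i≢r (sym r≡i) }) (trans (update-there λ { (r≡i , _) → i≢r (sym r≡i) }) rj))
            (λ { (q , e) → r-lacks (q , old₁ (old₂ (λ { (r≡i , _) → i≢r (sym r≡i) }) e)) })
            (λ { (p , e) → let e₁ = old₂ {p} (λ { (_ , j≡c) → j≢c j≡c }) e in gone {p} e₁ (col (old₁ {p} e₁) ij≡l , refl) })
          keeps₃ : ∀ {p} → RowHas g l p → RowHas g₃ l p
          keeps₃ {p} (q , e) with p F.≟ i
          ... | yes refl = c , trans (update-there λ { (i≡r , _) → i≢r i≡r }) (update-here {g = g₁})
          ... | no p≢i = q , trans (update-there λ { (refl , _) → r-lacks (q , e) })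
                               (trans (update-there λ { (p≡i , _) → p≢i p≡i }) (trans (update-there λ { (p≡i , _) → p≢i p≡i }) e))

        rowOf : Fin n → Fin n → List (Fin n)
        rowOf d j with F.any? (λ i → g i j ≟ᴹ just d)
        ... | yes (i , _) = i ∷ []
        ... | no _        = []

        ∈-rowOf : ∀ {i j d} → g i j ≡ just d → i ∈ rowOf d j
        ∈-rowOf {i} {j} {d} e with F.any? (λ i → g i j ≟ᴹ just d)
        ... | yes (i′ , e′) = here (col e e′)
        ... | no none       = contradiction (_ , e) none

        rowOf≤1 : ∀ d j → length (rowOf d j) ≤ 1
        rowOf≤1 d j with F.any? (λ i → g i j ≟ᴹ just d)
        ... | yes _ = s≤s z≤n
        ... | no _  = z≤n

        rowOf-none : ∀ {d j} → ¬ ColHas g d j → rowOf d j ≡ []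
        rowOf-none {d} {j} none with F.any? (λ i → g i j ≟ᴹ just d)
        ... | yes has = contradiction has none
        ... | no _    = refl

        -- If `d` occupies `(r , j)`, then the row that has `l` in column `j` is blocked, because
        -- its `l` could not be replaced by one at `(r , j)`. Together with the row that has `d` in
        -- column `c` this gives the factor 2 in the count.
        across : Fin n → List (Fin n)
        across d with rowHas? g d r
        ... | yes (j , _) = rowOf l j
        ... | no _        = []

        across≤1 : ∀ d → length (across d) ≤ 1
        across≤1 d with rowHas? g d r
        ... | yes (j , _) = rowOf≤1 l j
        ... | no _        = z≤n

        across-spec : ∀ {d j} → g r j ≡ just d → across d ≡ rowOf l j
        across-spec {d} e with rowHas? g d r
        ... | yes (j′ , e′) = cong (rowOf l) (row e′ e)
        ... | no none       = contradiction (_ , e) none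

        blockedBy : Fin n → List (Fin n)
        blockedBy d = rowOf d c ++ across d

        blockedBy≤2 : ∀ d → length (blockedBy d) ≤ 2
        blockedBy≤2 d rewrite length-++ (rowOf d c) {across d} = ℕ.+-mono-≤ (rowOf≤1 d c) (across≤1 d)

        -- There are three ways to block a row: the cell occupies `(i , c)`, it occupies `(r , j)`,
        -- or it prescribes `l` in row `i`, so that this `l` must not move. Since `l` is missing in
        -- row `r` and in column `c`, no cell blocks in two ways at once, and one row per cell is
        -- enough.
        blockedAt : Cell n n → List (Fin n)
        blockedAt (i , j , x) with j F.≟ c | i F.≟ r | x F.≟ l
        ... | yes _ | _     | _     = i ∷ []
        ... | no _  | yes _ | _     = rowOf l j
        ... | no _  | no _  | yes _ = i ∷ []
        ... | no _  | no _  | no _  = []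

        blockedAt≤1 : ∀ e → length (blockedAt e) ≤ 1
        blockedAt≤1 (i , j , x) with j F.≟ c | i F.≟ r | x F.≟ l
        ... | yes _ | _     | _     = s≤s z≤n
        ... | no _  | yes _ | _     = rowOf≤1 l j
        ... | no _  | no _  | yes _ = s≤s z≤n
        ... | no _  | no _  | no _  = z≤n

        blockedAt-col : ∀ {i j x} → j ≡ c → i ∈ blockedAt (i , j , x)
        blockedAt-col {i} {j} {x} j≡c with j F.≟ c | i F.≟ r | x F.≟ l
        ... | yes _ | _ | _ = here refl
        ... | no ne | _ | _ = contradiction j≡c ne

        blockedAt-row : ∀ {i j k x} → i ≡ r → g k j ≡ just l → k ∈ blockedAt (i , j , x)
        blockedAt-row {i} {j} {k} {x} i≡r e with j F.≟ c | i F.≟ r | x F.≟ l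
        ... | yes refl | _ | _ = contradiction (_ , e) c-lacks
        ... | no _ | yes _ | _ = ∈-rowOf e
        ... | no _ | no ne | _ = contradiction i≡r ne

        blockedAt-l : ∀ {i j x} → x ≡ l → (i , j , x) ∈ rest → i ∈ blockedAt (i , j , x)
        blockedAt-l {i} {j} {x} x≡l e∈ with j F.≟ c | i F.≟ r | x F.≟ l
        ... | yes _ | _ | _ = here refl
        ... | no _ | yes refl | _ = contradiction (j , trans (agrees (rest⊆ e∈)) (cong just x≡l)) r-lacks
        ... | no _ | no _ | yes _ = here refl
        ... | no _ | no _ | no ne = contradiction x≡l ne

        blockedAt-other : ∀ {i j x} → j ≢ c → i ≢ r → x ≢ l → blockedAt (i , j , x) ≡ []
        blockedAt-other {i} {j} {x} j≢ i≢ x≢ with j F.≟ c | i F.≟ r | x F.≟ l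
        ... | yes j≡ | _ | _ = contradiction j≡ j≢
        ... | no _ | yes i≡ | _ = contradiction i≡ i≢
        ... | no _ | no _ | yes x≡ = contradiction x≡ x≢
        ... | no _ | no _ | no _ = refl

        blocked : List (Fin n)
        blocked = concatMap blockedBy done ++ concatMap blockedAt rest

        -- The occupied cell (r , c) makes the count strict: its colour blocks one row less than
        -- allowed if it is in done, and otherwise a second cell of rest with this colour blocks no row.
        blocked<n : ∀ {x} → g r c ≡ just x → length blocked < n
        blocked<n {x} rc rewrite length-++ (concatMap blockedBy done) {concatMap blockedAt rest} with source rc
        ... | inj₁ (here refl) = contradiction (_ , rc) c-lacks
        ... | inj₁ (there x∈) = ℕ.<-≤-trans (ℕ.+-mono-<-≤
                (length-concatMap< blockedBy 2 blockedBy≤2 x∈ x<2) (length-select≤ blockedAt blockedAt≤1 rest)) small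
          where
          x<2 : length (blockedBy x) < 2
          x<2 rewrite across-spec rc | rowOf-none c-lacks | length-++ (rowOf x c) {[]} | ℕ.+-identityʳ (length (rowOf x c)) = s≤s (rowOf≤1 x c)
        ... | inj₂ e∈ with repeated e∈
        ...   | i′ , j′ , e′∈ , i′≢r = ℕ.<-≤-trans (ℕ.+-mono-≤-<
                (length-concatMap≤ blockedBy 2 blockedBy≤2 done)
                (length-select< blockedAt blockedAt≤1 e′∈ (blockedAt-other {i′} {j′} {x}
                  (λ { refl → i′≢r (col (agrees (rest⊆ e′∈)) rc) }) i′≢r (λ { refl → c-lacks (_ , rc) })))) small

        ∉-by : ∀ {i d} → i ∉ blocked → d ∈ done → i ∉ blockedBy d
        ∉-by i∉ d∈ i∈ = i∉ (∈.∈-++⁺ˡ (∈-select⁺ blockedBy d∈ i∈))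

        ∉-at : ∀ {i e} → i ∉ blocked → e ∈ rest → i ∉ blockedAt e
        ∉-at i∉ e∈ i∈ = i∉ (∈.∈-++⁺ʳ (concatMap blockedBy done) (∈-select⁺ blockedAt e∈ i∈))

        col-empty : ∀ {i} → i ∉ blocked → g i c ≡ nothing
        col-empty {i} i∉ with g i c in eq
        ... | nothing = refl
        ... | just x with source eq
        ...   | inj₁ (here refl) = contradiction (_ , eq) c-lacks
        ...   | inj₁ (there x∈) = contradiction (∈.∈-++⁺ˡ (∈-rowOf eq)) (∉-by i∉ x∈)
        ...   | inj₂ e∈ = contradiction (blockedAt-col refl) (∉-at i∉ e∈)

        row-empty : ∀ {i j} → i ∉ blocked → g i j ≡ just l → g r j ≡ nothing
        row-empty {i} {j} i∉ ij with g r j in eq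
        ... | nothing = refl
        ... | just x with source eq
        ...   | inj₁ (here refl) = contradiction (_ , eq) r-lacks
        ...   | inj₁ (there x∈) = contradiction
                  (∈.∈-++⁺ʳ (rowOf x c) (subst (i ∈_) (sym (across-spec eq)) (∈-rowOf ij))) (∉-by i∉ x∈)
        ...   | inj₂ e∈ = contradiction (blockedAt-row refl ij) (∉-at i∉ e∈)

      -- Some row i is not blocked.  Either l is missing in it and is put at (i , c), or l stands
      -- at (i , j) and moves to (i , c) and (r , j).
      progress : (∀ {i j c} → (i , j , c) ∈ E → c ∈ done ⊎ (i , j , c) ∈ rest) → Progress g
      progress classify with g r c in rc
      ... | nothing = add rc r-lacks c-lacks
      ... | just x with fresh blocked (blocked<n rc)
      ...   | i , i∉ with rowHas? g l i
      ...     | no lacks = add (col-empty i∉) lacks c-lacks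
      ...     | yes (j , ij) = move ij ∉E (col-empty i∉) (row-empty i∉ ij)
        where
        -- A prescribed `l` would have blocked row `i`.
        ∉E : (i , j , l) ∉ E
        ∉E e∈ with classify e∈
        ... | inj₁ l∈ = l∉done l∈
        ... | inj₂ e∈r = ∉-at i∉ e∈r (blockedAt-l refl e∈r)

    spread : Repeated rest → 2 * length done + length rest ≤ n →
             (∀ {i j c} → (i , j , c) ∈ E → c ∈ done ⊎ (i , j , c) ∈ rest) →
             ∀ fuel (U : List (Fin n)) → length U < fuel → ∀ {g} → Stage done (l ∷ done) rest g →
             (∀ i → RowHas g l i ⊎ i ∈ U) → ∃ λ g → Stage done (l ∷ done) rest g × (∀ i → RowHas g l i)
    spread repeated small classify (suc fuel) U U<f {g} S cover with F.any? (λ i → ¬? (rowHas? g l i))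
    ... | no none = g , S , λ i → decidable-stable (rowHas? g l i) λ lacks → none (i , lacks)
    ... | yes (r , r-lacks) = spread repeated small classify fuel (filter keep? U)
            (ℕ.≤-trans (filter-notAll keep? U (Any.map (λ eq ne → ne (sym eq)) t∈U)) (ℕ.≤-pred U<f)) stage cover′
      where
      open Progress (progress repeated small S r-lacks classify)
      keep? = λ u → ¬? (u F.≟ target)
      t∈U : target ∈ U
      t∈U with cover target
      ... | inj₁ has = contradiction has before
      ... | inj₂ t∈ = t∈
      cover′ : ∀ i → RowHas g′ l i ⊎ i ∈ filter keep? U
      cover′ i with i F.≟ target | cover i
      ... | yes refl | _ = inj₁ after
      ... | no _ | inj₁ has = inj₁ (keeps has)
      ... | no i≢ | inj₂ i∈ = inj₂ (∈.∈-filter⁺ keep? i∈ i≢)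

  private
    drop : Fin n → Cell n n → List (Cell n n)
    drop l e with proj₂ (proj₂ e) F.≟ l
    ... | yes _ = []
    ... | no _  = e ∷ []

    drop≤1 : ∀ l e → length (drop l e) ≤ 1
    drop≤1 l e with proj₂ (proj₂ e) F.≟ l
    ... | yes _ = z≤n
    ... | no _  = s≤s z≤n

    drop-≡ : ∀ {l e} → proj₂ (proj₂ e) ≡ l → drop l e ≡ []
    drop-≡ {l} {e} eq with proj₂ (proj₂ e) F.≟ l
    ... | yes _ = refl
    ... | no ne = contradiction eq ne

    drop⁺ : ∀ {l e xs} → e ∈ xs → proj₂ (proj₂ e) ≢ l → e ∈ concatMap (drop l) xs
    drop⁺ {l} {e} {xs} e∈ ne = ∈-select⁺ (drop l) e∈ kept
      where
      kept : e ∈ drop l e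
      kept with proj₂ (proj₂ e) F.≟ l
      ... | yes eq = contradiction eq ne
      ... | no _ = here refl

    drop⁻ : ∀ {l e} xs → e ∈ concatMap (drop l) xs → e ∈ xs × proj₂ (proj₂ e) ≢ l
    drop⁻ {l} xs p with ∈-select⁻ (drop l) xs p
    ... | e′ , e′∈ , q with proj₂ (proj₂ e′) F.≟ l
    drop⁻ xs p | e′ , e′∈ , here refl | no ne = e′∈ , ne

  -- A colour entering done may block two rows; it takes at least two cells out of rest.
  finish : ∀ fuel done rest {g} → length rest < fuel → Stage done done rest g → Repeated rest →
           2 * length done + length rest ≤ n → (∀ {i j c} → (i , j , c) ∈ E → c ∈ done ⊎ (i , j , c) ∈ rest) →
           Completion E
  finish (suc fuel) done [] {g} _ S _ _ classify =
    -- With `rest` empty all prescribed colours are full, and full colours survive the completion.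
    let L , L-proper , keeps = complete g proper in L , L-proper , λ e∈ → keeps (full (done∈ e∈)) (agrees e∈)
    where
    open Stage S
    done∈ : ∀ {i j c} → (i , j , c) ∈ E → c ∈ done
    done∈ e∈ with classify e∈
    ... | inj₁ c∈ = c∈
  finish (suc fuel) done rest@(e₀@(i₀ , j₀ , l) ∷ _) {g} rest<f S repeated small classify =
    finish fuel (l ∷ done) rest′ (ℕ.≤-trans (length-select< (drop l) (drop≤1 l) {e₀} {rest} (here refl) (drop-≡ refl)) (ℕ.≤-pred rest<f))
      stage′ repeated′ small′ classify′
    where
    rest′ = concatMap (drop l) rest
    start : Stage done (l ∷ done) rest g
    start = record { Stage S ; source = λ e → weaken (Stage.source S e) }
      where
      weaken : ∀ {e c} → c ∈ done ⊎ e ∈ rest → c ∈ l ∷ done ⊎ e ∈ rest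
      weaken (inj₁ x) = inj₁ (there x)
      weaken (inj₂ y) = inj₂ y
    result = spread repeated small classify (suc (length (allFin n))) (allFin n) ℕ.≤-refl start (λ i → inj₂ (∈.∈-allFin i))
    g′ = proj₁ result
    open Stage (proj₁ (proj₂ result))
    rows : ∀ i → RowHas g′ l i
    rows = proj₂ (proj₂ result)
    -- A column without `l` would force a row without `l`, by the transposed form of `lacking-col`.
    cols : ∀ j → ColHas g′ l j
    cols j = decidable-stable (rowHas? (flip g′) l j) λ lacks →
      let i , i-lacks = lacking-col (flip g′) col lacks in i-lacks (rows i)
    stage′ : Stage (l ∷ done) (l ∷ done) rest′ g′
    stage′ = record
      { proper = proper
      ; full = λ { (here refl) → rows , cols ; (there c∈) → full c∈ }
      ; agrees = agrees
      ; source = source′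
      ; rest⊆ = λ e∈ → rest⊆ (proj₁ (drop⁻ rest e∈)) }
      where
      source′ : ∀ {i j c} → g′ i j ≡ just c → c ∈ l ∷ done ⊎ (i , j , c) ∈ rest′
      source′ {c = c} e with source e | c F.≟ l
      ... | inj₁ c∈ | _ = inj₁ c∈
      ... | inj₂ _ | yes refl = inj₁ (here refl)
      ... | inj₂ e∈ | no ne = inj₂ (drop⁺ e∈ ne)
    repeated′ : Repeated rest′
    repeated′ e∈ with drop⁻ rest e∈
    ... | e∈r , ne = let i′ , j′ , e′∈ , i′≢ = repeated e∈r in i′ , j′ , drop⁺ e′∈ ne , i′≢
    small′ : 2 * length (l ∷ done) + length rest′ ≤ n
    small′ with repeated {i₀} {j₀} {l} (here refl)
    ... | i′ , j′ , e′∈ , i′≢ = ℕ.≤-trans (ℕ.≤-reflexive shift) (ℕ.≤-trans (ℕ.+-monoʳ-≤ (2 * length done)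
            (length-select<< (drop l) (drop≤1 l) {e₀} {i′ , j′ , l} {rest} (here refl) e′∈ (λ { refl → i′≢ refl }) (drop-≡ refl) (drop-≡ refl))) small)
      where
      shift : 2 * length (l ∷ done) + length rest′ ≡ 2 * length done + (2 + length rest′)
      shift = trans (cong (_+ length rest′) (trans (ℕ.*-suc 2 (length done)) (ℕ.+-comm 2 (2 * length done))))
                    (ℕ.+-assoc (2 * length done) 2 (length rest′))
    classify′ : ∀ {i j c} → (i , j , c) ∈ E → c ∈ l ∷ done ⊎ (i , j , c) ∈ rest′
    classify′ {c = c} e∈ with classify e∈ | c F.≟ l
    ... | inj₁ c∈ | _ = inj₁ (there c∈)
    ... | inj₂ _ | yes refl = inj₁ (here refl)
    ... | inj₂ e∈r | no ne = inj₂ (drop⁺ e∈r ne)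

array : ∀ {n} → List (Cell n n) → Partial n
array [] p q = nothing
array ((i , j , c) ∷ E) = update i j (just c) (array E)

array⁻ : ∀ {n} (E : List (Cell n n)) {i j c} → array E i j ≡ just c → (i , j , c) ∈ E
array⁻ ((i , j , c) ∷ E) {p} {q} e with update⁻ {p = p} {q} e
... | inj₁ (refl , refl , refl) = here refl
... | inj₂ e′ = there (array⁻ E e′)

array⁺ : ∀ {n} (E : List (Cell n n)) {i j c} → (i , j , c) ∈ E → ∃ λ d → array E i j ≡ just d
array⁺ ((i , j , c) ∷ E) (here refl) = c , update-here {g = array E}
array⁺ ((i , j , c) ∷ E) {p} {q} (there e∈) with p F.≟ i ×-dec q F.≟ j
... | yes (refl , refl) = c , update-here {g = array E}
... | no ne = let d , e = array⁺ E e∈ in d , trans (update-there ne) e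

opaque
  -- The bound is `n`, one more than in Evans' conjecture. The main induction relies on this when
  -- all `n` elements cost a cell.
  repeated-completion : ∀ {n} (E : List (Cell n n)) → Consistent E → Repeated E → length E ≤ n → Completion E
  repeated-completion E consistent repeated small = finish E (suc (length E)) [] E ℕ.≤-refl
    (record
      { proper = record { row = λ e e′ → row (array⁻ E e) (array⁻ E e′) ; col = λ e e′ → col (array⁻ E e) (array⁻ E e′) }
      ; full = λ ()
      ; agrees = λ e∈ → let d , e = array⁺ E e∈ in trans e (cong just (cell (array⁻ E e) e∈))
      ; source = λ e → inj₂ (array⁻ E e)
      ; rest⊆ = λ e∈ → e∈ })
    repeated small inj₂
    where open Consistent consistent

-- Smetaniuk's prolongation

-- A is an edge colouring of a complete bipartite graph; R i and C j are colours missing at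
-- its vertices, to be carried by the rungs.
record Corona (I J Q : Set) : Set where
  field
    A   : I → J → Q
    R   : I → Q
    C   : J → Q
    row : ∀ {i j j′} → A i j ≡ A i j′ → j ≡ j′
    col : ∀ {i i′ j} → A i j ≡ A i′ j → i ≡ i′
    A≢R : ∀ {i j} → A i j ≢ R i
    A≢C : ∀ {i j} → A i j ≢ C j

transpose-injective : ∀ {n} (a b : Fin n) {k k′} → transpose a b k ≡ transpose a b k′ → k ≡ k′
transpose-injective a b eq = trans (sym (transpose-inverse b a)) (trans (cong (transpose b a) eq) (transpose-inverse b a))

transpose-left : ∀ {n} {a b k : Fin n} → k ≡ a → transpose a b k ≡ b
transpose-left {a = a} {k = k} k≡ with k F.≟ a
... | yes _ = refl
... | no ne = contradiction k≡ ne

transpose-right : ∀ {n} {a b k : Fin n} → k ≡ b → transpose a b k ≡ a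
transpose-right {a = a} {b} {k} k≡ with k F.≟ a
... | yes refl = sym k≡
... | no _ with k F.≟ b
...   | yes _ = refl
...   | no ne = contradiction k≡ ne

transpose-other : ∀ {n} {a b k : Fin n} → k ≢ a → k ≢ b → transpose a b k ≡ k
transpose-other {a = a} {b} {k} ≢a ≢b with k F.≟ a
... | yes ≡a = contradiction ≡a ≢a
... | no _ with k F.≟ b
...   | yes ≡b = contradiction ≡b ≢b
...   | no _   = refl

module _ {m : ℕ} {Q : Set} (_≟_ : Decidable (_≡_ {A = Q})) (L : Fin m → Fin m → Q)
         (L-row : ∀ {i j j′} → L i j ≡ L i j′ → j ≡ j′) (L-col : ∀ {i i′ j} → L i j ≡ L i′ j → i ≡ i′) where

  -- Columns below j have been extended by the row last.  Entries strictly to the left of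
  -- the antidiagonal are untouched; the antidiagonal entry of row i is to be displaced
  -- by the new colour and moved to the new column.
  record Prolonged (j : ℕ) : Set where
    field
      M        : Fin m → Fin m → Q
      last     : Fin m → Q
      row-inj  : ∀ {i k k′} → M i k ≡ M i k′ → k ≡ k′
      -- `row-val`, `col-val` and `last-val` keep the colours reserved for the rungs out of their
      -- rows and columns.
      row-val  : ∀ i k → ∃ λ q → M i k ≡ L i q
      future   : ∀ {i k} → j ≤ toℕ k → M i k ≡ L i k
      above    : ∀ {i k} → toℕ k < toℕ (opposite i) → M i k ≡ L i k
      col-inj  : ∀ {i i′ k} → k ≢ opposite i → k ≢ opposite i′ → M i k ≡ M i′ k → i ≡ i′
      col-val  : ∀ {i k} → k ≢ opposite i → ∃ λ p → M i k ≡ L p k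
      last-val : ∀ {k} → toℕ k < j → ∃ λ p → last k ≡ L p k
      last-new : ∀ {i k} → toℕ k < j → k ≢ opposite i → last k ≢ M i k
      last-inj : ∀ {k k′} → toℕ k < j → toℕ k′ < j → last k ≡ last k′ → k ≡ k′

    displaced : Fin m → Q
    displaced i = M i (opposite i)

    Active : Fin m → Set
    Active i = toℕ (opposite i) < j

    field
      -- The new column and the new row are kept equal as sets of colours, so that in the end one
      -- colour outside both of them fits the corner.
      displaced-inj  : ∀ {i i′} → Active i → Active i′ → displaced i ≡ displaced i′ → i ≡ i′
      displaced→last : ∀ {i} → Active i → ∃ λ k → toℕ k < j × last k ≡ displaced i
      last→displaced : ∀ {k} → toℕ k < j → ∃ λ i → Active i × displaced i ≡ last k

  -- The values of `any` are placeholders: what is asserted about `last` concerns only columns that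
  -- have been treated.
  prolong-start : (Fin m → Q) → Prolonged 0
  prolong-start any = record
    { M = L ; last = any ; row-inj = L-row ; row-val = λ i k → k , refl ; future = λ _ → refl ; above = λ _ → refl
    ; col-inj = λ _ _ → L-col ; col-val = λ _ → _ , refl ; last-val = λ () ; last-new = λ () ; last-inj = λ ()
    ; displaced-inj = λ () ; displaced→last = λ () ; last→displaced = λ () }

  module _ (J : Fin m) (P : Prolonged (toℕ J)) where
    open Prolonged P

    private
      -- Row i* becomes active; its entry in column J would go to last, but if it was displaced
      -- before, from row i, then it goes to row i instead and displaces L i J, and so on.
      i* = opposite J

      opp-i* : opposite i* ≡ J
      opp-i* = F.opposite-involutive J

      opp≡J : ∀ {i} → opposite i ≡ J → i ≡ i*
      opp≡J {i} eq = trans (sym (F.opposite-involutive i)) (cong opposite eq)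

      S : Fin m → Fin m → Set
      S x y = Active y × displaced y ≡ L x J

      ¬active-i* : ¬ Active i*
      ¬active-i* lt = ℕ.<-irrefl (cong toℕ opp-i*) lt

      Z : Chain S i*
      Z = chain S (λ x y → (toℕ (opposite y) ℕ.<? toℕ J) ×-dec (displaced y ≟ L x J))
        (λ { (ay , e) (az , e′) → displaced-inj ay az (trans e (sym e′)) })
        (λ { (_ , e) (_ , e′) → L-col (trans (sym e) e′) }) i* (λ { (a , _) → ¬active-i* a })

      open Chain Z renaming (start to i*∈)

      M-J : ∀ i → M i J ≡ L i J
      M-J i = future ℕ.≤-refl

      member-active : ∀ {i} → i ∈ members → i ≢ i* → Active i
      member-active i∈ i≢ = proj₁ (proj₂ (proj₂ (pred i∈ i≢)))

      data Kind (i : Fin m) : Set where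
        moved : i ∈ members → i ≢ i* → Active i → Kind i
        start : i ≡ i* → Kind i
        fixed : i ∉ members → i ≢ i* → Kind i

      kind : ∀ i → Kind i
      kind i with i F.≟ i* | i ∈F? members
      ... | yes eq | _      = start eq
      ... | no ne  | yes i∈ = moved i∈ ne (member-active i∈ ne)
      ... | no ne  | no i∉  = fixed i∉ ne

      -- In a row of the chain other than the first, the displaced entry and the entry in column `J`
      -- trade places. Both positions are on or to the right of the antidiagonal, so the entries
      -- protected by `above` stay.
      σ : ∀ {i} → Kind i → Fin m → Fin m
      σ {i} (moved _ _ _) k = transpose (opposite i) J k
      σ     (start _)     k = k
      σ     (fixed _ _)   k = k

      σ-inj : ∀ {i} (κ : Kind i) {k k′} → σ κ k ≡ σ κ k′ → k ≡ k′
      σ-inj (moved _ _ _) = transpose-injective _ _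
      σ-inj (start _) eq = eq
      σ-inj (fixed _ _) eq = eq

      M′ : Fin m → Fin m → Q
      M′ i k = M i (σ (kind i) k)

      σ-other : ∀ {i k} (κ : Kind i) → k ≢ J → k ≢ opposite i → σ κ k ≡ k
      σ-other (moved _ _ _) k≢J k≢ = transpose-other k≢ k≢J
      σ-other (start _) _ _ = refl
      σ-other (fixed _ _) _ _ = refl

      σ-left : ∀ {i k} (κ : Kind i) → toℕ k < toℕ (opposite i) → σ κ k ≡ k
      σ-left (moved _ _ a) lt = transpose-other (λ { refl → ℕ.<-irrefl refl lt }) (λ { refl → ℕ.<-asym lt a })
      σ-left (start _) _ = refl
      σ-left (fixed _ _) _ = refl

      σ-right : ∀ {i k} (κ : Kind i) → toℕ J < toℕ k → σ κ k ≡ k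
      σ-right (moved _ _ a) lt = transpose-other (λ { refl → ℕ.<-asym lt a }) (λ { refl → ℕ.<-irrefl refl lt })
      σ-right (start _) _ = refl
      σ-right (fixed _ _) _ = refl

      M′-other : ∀ {i k} → k ≢ J → k ≢ opposite i → M′ i k ≡ M i k
      M′-other {i} k≢J k≢ = cong (M i) (σ-other (kind i) k≢J k≢)

      -- Along the chain the entries of column `J` shift by one: each row receives the old entry of
      -- its predecessor `p`. The old entry of the end is left over, and it becomes the entry of the
      -- new row.
      data Entry (i : Fin m) (q : Q) : Set where
        moved : ∀ p → p ∈ members → Active i → i ∈ members → displaced i ≡ q → q ≡ L p J → Entry i q
        fixed : i ∉ members → q ≡ L i J → Entry i q

      entry : ∀ {i} → J ≢ opposite i → Entry i (M′ i J)
      entry {i} J≢ with kind i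
      ... | start refl = contradiction (sym opp-i*) J≢
      ... | fixed i∉ _ = fixed i∉ (M-J i)
      ... | moved i∈ i≢ a with pred i∈ i≢
      ...   | p , p∈ , _ , e = moved p p∈ a i∈ (cong (M i) (sym (transpose-right {a = opposite i} {J} refl)))
                (trans (cong (M i) (transpose-right {a = opposite i} {J} refl)) e)

      displaced′ : Fin m → Q
      displaced′ i = M′ i (opposite i)

      displaced′-in : ∀ {i} → i ∈ members → displaced′ i ≡ L i J
      displaced′-in {i} i∈ with kind i
      ... | start refl = trans (cong (M i*) opp-i*) (M-J i*)
      ... | fixed i∉ _ = contradiction i∈ i∉
      ... | moved _ _ _ = trans (cong (M i) (transpose-left {a = opposite i} {J} refl)) (M-J i)

      displaced′-out : ∀ {i} → i ∉ members → displaced′ i ≡ displaced i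
      displaced′-out {i} i∉ with kind i
      ... | start refl = contradiction i*∈ i∉
      ... | fixed _ _ = refl
      ... | moved i∈ _ _ = contradiction i∈ i∉

      active-out : ∀ {i} → i ∉ members → toℕ (opposite i) < suc (toℕ J) → Active i
      active-out {i} i∉ a = ℕ.≤∧≢⇒< (ℕ.≤-pred a) λ eq →
        i∉ (subst (_∈ members) (sym (opp≡J (F.toℕ-injective eq))) i*∈)

      active-in : ∀ {i} → i ∈ members → toℕ (opposite i) < suc (toℕ J)
      active-in {i} i∈ with i F.≟ i*
      ... | yes refl = s≤s (ℕ.≤-reflexive (cong toℕ opp-i*))
      ... | no ne = ℕ.m<n⇒m<1+n (member-active i∈ ne)

      member-or-not : ∀ i → i ∈ members ⊎ i ∉ members
      member-or-not i with i ∈F? members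
      ... | yes i∈ = inj₁ i∈
      ... | no i∉  = inj₂ i∉

      last′ : Fin m → Q
      last′ k with k F.≟ J
      ... | yes _ = L end J
      ... | no _  = last k

      past : ∀ {k} → toℕ k < suc (toℕ J) → k ≢ J → toℕ k < toℕ J
      past k<  k≢ = ℕ.≤∧≢⇒< (ℕ.≤-pred k<) λ eq → k≢ (F.toℕ-injective eq)

      end-free : ∀ {k} → toℕ k < toℕ J → L end J ≢ last k
      end-free k< eq with last→displaced k<
      ... | i , a , e = end-max (a , trans e (sym eq))

    prolong-step : Prolonged (suc (toℕ J))
    prolong-step = record
      { M = M′ ; last = last′
      ; row-inj = λ {i} e → σ-inj (kind i) (row-inj e)
      ; row-val = λ i k → row-val i (σ (kind i) k)
      ; future = λ {i} lt → trans (cong (M i) (σ-right (kind i) lt)) (future (ℕ.<⇒≤ lt))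
      ; above = λ {i} lt → trans (cong (M i) (σ-left (kind i) lt)) (above lt)
      ; col-inj = col-inj′ ; col-val = col-val′ ; last-val = last-val′ ; last-new = last-new′ ; last-inj = last-inj′
      ; displaced-inj = displaced-inj′ ; displaced→last = displaced→last′ ; last→displaced = last→displaced′ }
      where
      col-inj′ : ∀ {i i′ k} → k ≢ opposite i → k ≢ opposite i′ → M′ i k ≡ M′ i′ k → i ≡ i′
      col-inj′ {i} {i′} {k} k≢ k≢′ eq with k F.≟ J
      ... | no k≢J = col-inj k≢ k≢′ (trans (sym (M′-other k≢J k≢)) (trans eq (M′-other k≢J k≢′)))
      ... | yes refl with entry k≢ | entry k≢′
      ...   | moved _ _ a _ d _ | moved _ _ a′ _ d′ _ = displaced-inj a a′ (trans d (trans eq (sym d′)))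
      ...   | moved p p∈ _ _ _ e | fixed i′∉ e′ = contradiction (subst (_∈ members) (L-col (trans (sym e) (trans eq e′))) p∈) i′∉
      ...   | fixed i∉ e | moved p p∈ _ _ _ e′ = contradiction (subst (_∈ members) (L-col (trans (sym e′) (trans (sym eq) e))) p∈) i∉
      ...   | fixed _ e | fixed _ e′ = L-col (trans (sym e) (trans eq e′))

      col-val′ : ∀ {i k} → k ≢ opposite i → ∃ λ p → M′ i k ≡ L p k
      col-val′ {i} {k} k≢ with k F.≟ J
      ... | no k≢J = let p , e = col-val k≢ in p , trans (M′-other k≢J k≢) e
      ... | yes refl with entry k≢
      ...   | moved p _ _ _ _ e = p , e
      ...   | fixed _ e = i , e

      last-val′ : ∀ {k} → toℕ k < suc (toℕ J) → ∃ λ p → last′ k ≡ L p k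
      last-val′ {k} k< with k F.≟ J
      ... | yes refl = end , refl
      ... | no k≢ = last-val (past k< k≢)

      last-new′ : ∀ {i k} → toℕ k < suc (toℕ J) → k ≢ opposite i → last′ k ≢ M′ i k
      last-new′ {i} {k} k< k≢ eq with k F.≟ J
      ... | no k≢J = last-new (past k< k≢J) k≢ (trans eq (M′-other k≢J k≢))
      ... | yes refl with entry k≢
      ...   | moved _ _ a _ d _ = end-max (a , trans d (sym eq))
      ...   | fixed i∉ e = i∉ (subst (_∈ members) (L-col (trans eq e)) end∈)

      last-inj′ : ∀ {k k′} → toℕ k < suc (toℕ J) → toℕ k′ < suc (toℕ J) → last′ k ≡ last′ k′ → k ≡ k′
      last-inj′ {k} {k′} k< k′< eq with k F.≟ J | k′ F.≟ J
      ... | yes refl | yes refl = refl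
      ... | yes refl | no k′≢ = contradiction eq (end-free (past k′< k′≢))
      ... | no k≢ | yes refl = contradiction (sym eq) (end-free (past k< k≢))
      ... | no k≢ | no k′≢ = last-inj (past k< k≢) (past k′< k′≢) eq

      displaced-inj′ : ∀ {i i′} → toℕ (opposite i) < suc (toℕ J) → toℕ (opposite i′) < suc (toℕ J) →
                       displaced′ i ≡ displaced′ i′ → i ≡ i′
      displaced-inj′ {i} {i′} a a′ eq with member-or-not i | member-or-not i′
      ... | inj₁ i∈ | inj₁ i′∈ = L-col (trans (sym (displaced′-in i∈)) (trans eq (displaced′-in i′∈)))
      ... | inj₁ i∈ | inj₂ i′∉ = contradiction
              (closed i∈ (active-out i′∉ a′ , trans (sym (displaced′-out i′∉)) (trans (sym eq) (displaced′-in i∈)))) i′∉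
      ... | inj₂ i∉ | inj₁ i′∈ = contradiction
              (closed i′∈ (active-out i∉ a , trans (sym (displaced′-out i∉)) (trans eq (displaced′-in i′∈)))) i∉
      ... | inj₂ i∉ | inj₂ i′∉ = displaced-inj (active-out i∉ a) (active-out i′∉ a′)
              (trans (sym (displaced′-out i∉)) (trans eq (displaced′-out i′∉)))

      last′-J : last′ J ≡ L end J
      last′-J with J F.≟ J
      ... | yes _ = refl
      ... | no ne = contradiction refl ne

      last′-past : ∀ {k} → toℕ k < toℕ J → last′ k ≡ last k
      last′-past {k} k< with k F.≟ J
      ... | yes refl = contradiction k< (ℕ.<-irrefl refl)
      ... | no _ = refl

      displaced→last′ : ∀ {i} → toℕ (opposite i) < suc (toℕ J) → ∃ λ k → toℕ k < suc (toℕ J) × last′ k ≡ displaced′ i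
      displaced→last′ {i} a with member-or-not i
      ... | inj₂ i∉ with displaced→last (active-out i∉ a)
      ...   | k , k< , e = k , ℕ.m<n⇒m<1+n k< , trans (last′-past k<) (trans e (sym (displaced′-out i∉)))
      displaced→last′ {i} a | inj₁ i∈ with i F.≟ end
      ... | yes refl = J , ℕ.≤-refl , trans last′-J (sym (displaced′-in i∈))
      ... | no i≢ with next i∈ i≢
      ...   | z , az , ez with displaced→last az
      ...     | k , k< , e = k , ℕ.m<n⇒m<1+n k< , trans (last′-past k<) (trans e (trans ez (sym (displaced′-in i∈))))

      last→displaced′ : ∀ {k} → toℕ k < suc (toℕ J) → ∃ λ i → toℕ (opposite i) < suc (toℕ J) × displaced′ i ≡ last′ k
      last→displaced′ {k} k< with k F.≟ J
      ... | yes refl = end , active-in end∈ , displaced′-in end∈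
      ... | no k≢ with last→displaced (past k< k≢)
      ...   | i , a , e with member-or-not i
      ...     | inj₂ i∉ = i , ℕ.m<n⇒m<1+n a , trans (displaced′-out i∉) e
      -- Row `i` no longer displaces this colour; it has passed to the predecessor of `i` on the
      -- chain.
      ...     | inj₁ i∈ with pred i∈ (λ { refl → ¬active-i* a })
      ...       | p , p∈ , _ , ep = p , active-in p∈ , trans (displaced′-in p∈) (trans (sym ep) e)

  prolong : (Fin m → Q) → ∀ j → j ≤ m → Prolonged j
  prolong any zero    _   = prolong-start any
  prolong any (suc j) j<m = subst (λ t → Prolonged (suc t)) (F.toℕ-fromℕ< j<m)
    (prolong-step (fromℕ< j<m) (subst Prolonged (sym (F.toℕ-fromℕ< j<m)) (prolong any j (ℕ.<⇒≤ j<m))))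

-- `nothing` stands for the new row and the new column. The antidiagonal carries `u` once in each
-- old row and column, so `u` is missing precisely at the two new vertices and becomes their
-- forbidden colour.
record Smetaniuk {m} (K : Corona (Fin m) (Fin m) (Fin (suc m))) (u : Fin (2 + m)) : Set where
  private module K = Corona K
  field
    corona : Corona (Maybe (Fin m)) (Maybe (Fin m)) (Fin (2 + m))
  open Corona corona public
  field
    A-left : ∀ {i k} → suc (toℕ i + toℕ k) < m → A (just i) (just k) ≡ punchIn u (K.A i k)
    A-diag : ∀ {i k} → suc (toℕ i + toℕ k) ≡ m → A (just i) (just k) ≡ u
    R-old  : ∀ i → R (just i) ≡ punchIn u (K.R i)
    R-new  : R nothing ≡ u
    C-old  : ∀ k → C (just k) ≡ punchIn u (K.C k)
    C-new  : C nothing ≡ u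

module _ {m} (K : Corona (Fin m) (Fin m) (Fin (suc m))) (u : Fin (2 + m)) where
  private
    module K = Corona K

    P : Prolonged F._≟_ K.A K.row K.col m
    P = prolong F._≟_ K.A K.row K.col (λ _ → zero) m ℕ.≤-refl
    open Prolonged P

    lasts : List (Fin (suc m))
    lasts = tabulate last

    -- The new row has `m` entries and there are `m + 1` old colours. A colour avoiding the new row
    -- also avoids the new column, which consists of the same colours.
    corner : Fin (suc m)
    corner = proj₁ (fresh lasts (s≤s (ℕ.≤-reflexive (length-tabulate last))))

    corner≢last : ∀ k → corner ≢ last k
    corner≢last k eq = proj₂ (fresh lasts (s≤s (ℕ.≤-reflexive (length-tabulate last))))
      (subst (_∈ lasts) (sym eq) (∈.∈-tabulate⁺ k))

    corner≢displaced : ∀ i → corner ≢ displaced i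
    corner≢displaced i eq with displaced→last {i} (F.toℕ<n _)
    ... | k , _ , e = corner≢last k (trans eq (sym e))

    new : Fin (suc m) → Fin (2 + m)
    new = punchIn u

    new-inj : ∀ {x y} → new x ≡ new y → x ≡ y
    new-inj = F.punchIn-injective u _ _

    new≢u : ∀ {x} → new x ≢ u
    new≢u = F.punchInᵢ≢i u _

    body : Fin m → Fin m → Fin (2 + m)
    body i k with k F.≟ opposite i
    ... | yes _ = u
    ... | no _  = new (M i k)

    data Body (i k : Fin m) : Fin (2 + m) → Set where
      diag : k ≡ opposite i → Body i k u
      off  : k ≢ opposite i → Body i k (new (M i k))

    view : ∀ i k → Body i k (body i k)
    view i k with k F.≟ opposite i
    ... | yes eq = diag eq
    ... | no ne  = off ne

    B : Maybe (Fin m) → Maybe (Fin m) → Fin (2 + m)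
    B (just i) (just k) = body i k
    B (just i) nothing  = new (displaced i)
    B nothing  (just k) = new (last k)
    B nothing  nothing  = new corner

    R′ C′ : Maybe (Fin m) → Fin (2 + m)
    R′ (just i) = new (K.R i)
    R′ nothing  = u
    C′ (just k) = new (K.C k)
    C′ nothing  = u

    body≢displaced : ∀ i k → body i k ≢ new (displaced i)
    body≢displaced i k eq with k F.≟ opposite i
    ... | yes _ = new≢u (sym eq)
    ... | no ne = ne (row-inj (new-inj eq))

    body≢last : ∀ i k → body i k ≢ new (last k)
    body≢last i k eq with k F.≟ opposite i
    ... | yes _ = new≢u (sym eq)
    ... | no ne = last-new (F.toℕ<n k) ne (sym (new-inj eq))

    row′ : ∀ {i j j′} → B i j ≡ B i j′ → j ≡ j′
    row′ {just i} {just k} {just k′} eq with k F.≟ opposite i | k′ F.≟ opposite i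
    ... | yes p | yes q = cong just (trans p (sym q))
    ... | yes _ | no _  = contradiction (sym eq) new≢u
    ... | no _  | yes _ = contradiction eq new≢u
    ... | no _  | no _  = cong just (row-inj (new-inj eq))
    row′ {just i} {just k} {nothing} eq = contradiction eq (body≢displaced i k)
    row′ {just i} {nothing} {just k} eq = contradiction (sym eq) (body≢displaced i k)
    row′ {just i} {nothing} {nothing} eq = refl
    row′ {nothing} {just k} {just k′} eq = cong just (last-inj (F.toℕ<n k) (F.toℕ<n k′) (new-inj eq))
    row′ {nothing} {just k} {nothing} eq = contradiction (sym (new-inj eq)) (corner≢last k)
    row′ {nothing} {nothing} {just k} eq = contradiction (new-inj eq) (corner≢last k)
    row′ {nothing} {nothing} {nothing} eq = refl

    col′ : ∀ {i i′ j} → B i j ≡ B i′ j → i ≡ i′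
    col′ {just i} {just i′} {just k} eq with k F.≟ opposite i | k F.≟ opposite i′
    ... | yes p | yes q = cong just (trans (sym (F.opposite-involutive i)) (trans (cong opposite (trans (sym p) q)) (F.opposite-involutive i′)))
    ... | yes _ | no _  = contradiction (sym eq) new≢u
    ... | no _  | yes _ = contradiction eq new≢u
    ... | no p  | no q  = cong just (col-inj p q (new-inj eq))
    col′ {just i} {nothing} {just k} eq = contradiction eq (body≢last i k)
    col′ {nothing} {just i} {just k} eq = contradiction (sym eq) (body≢last i k)
    col′ {nothing} {nothing} {just k} eq = refl
    col′ {just i} {just i′} {nothing} eq = cong just (displaced-inj (F.toℕ<n _) (F.toℕ<n _) (new-inj eq))
    col′ {just i} {nothing} {nothing} eq = contradiction (sym (new-inj eq)) (corner≢displaced i)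
    col′ {nothing} {just i} {nothing} eq = contradiction (new-inj eq) (corner≢displaced i)
    col′ {nothing} {nothing} {nothing} eq = refl

    B≢R : ∀ {i j} → B i j ≢ R′ i
    B≢R {just i} {just k} eq with k F.≟ opposite i
    ... | yes _ = new≢u (sym eq)
    ... | no _ = let q , e = row-val i k in K.A≢R (trans (sym e) (new-inj eq))
    B≢R {just i} {nothing} eq = let q , e = row-val i (opposite i) in K.A≢R (trans (sym e) (new-inj eq))
    B≢R {nothing} {just k} = new≢u
    B≢R {nothing} {nothing} = new≢u

    B≢C : ∀ {i j} → B i j ≢ C′ j
    B≢C {just i} {just k} eq with k F.≟ opposite i
    ... | yes _ = new≢u (sym eq)
    ... | no ne = let p , e = col-val ne in K.A≢C (trans (sym e) (new-inj eq))
    B≢C {nothing} {just k} eq = let p , e = last-val (F.toℕ<n k) in K.A≢C (trans (sym e) (new-inj eq))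
    B≢C {just i} {nothing} = new≢u
    B≢C {nothing} {nothing} = new≢u

    toℕ-opposite : ∀ (i : Fin m) → suc (toℕ i + toℕ (opposite i)) ≡ m
    toℕ-opposite i rewrite F.opposite-prop i = ℕ.m+[n∸m]≡n (F.toℕ<n i)

    A-left′ : ∀ {i k} → suc (toℕ i + toℕ k) < m → body i k ≡ new (K.A i k)
    A-left′ {i} {k} lt with k F.≟ opposite i
    ... | yes refl = contradiction lt (ℕ.<-irrefl (toℕ-opposite i))
    ... | no _ = cong new (above (ℕ.+-cancelˡ-< (suc (toℕ i)) _ _ (subst (suc (toℕ i + toℕ k) <_) (sym (toℕ-opposite i)) lt)))

    A-diag′ : ∀ {i k} → suc (toℕ i + toℕ k) ≡ m → body i k ≡ u
    A-diag′ {i} {k} eq with k F.≟ opposite i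
    ... | yes _ = refl
    ... | no ne = contradiction (F.toℕ-injective (ℕ.+-cancelˡ-≡ (suc (toℕ i)) _ _ (trans eq (sym (toℕ-opposite i))))) ne

  opaque
    smetaniuk : Smetaniuk K u
    smetaniuk = record
      { corona = record { A = B ; R = R′ ; C = C′ ; row = λ {i} → row′ {i} ; col = col′ ; A≢R = λ {i} {j} → B≢R {i} {j} ; A≢C = λ {i} {j} → B≢C {i} {j} }
      ; A-left = λ {i} {k} → A-left′ {i} {k} ; A-diag = λ {i} {k} → A-diag′ {i} {k} ; R-old = λ _ → refl ; R-new = refl ; C-old = λ _ → refl ; C-new = refl }

-- Evans' conjecture

opaque
  -- The partial inverse of `punchIn k`. It deletes a row, a column or a colour, which is sent to
  -- `nothing`.
  shrink : ∀ {m} → Fin (suc m) → Fin (suc m) → Maybe (Fin m)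
  shrink k x with k F.≟ x
  ... | yes _ = nothing
  ... | no ne = just (punchOut ne)

  shrink-self : ∀ {m} (k : Fin (suc m)) → shrink k k ≡ nothing
  shrink-self k with k F.≟ k
  ... | yes _ = refl
  ... | no ne = contradiction refl ne

  shrink-just⁻ : ∀ {m} {k x : Fin (suc m)} {y} → shrink k x ≡ just y → x ≡ punchIn k y
  shrink-just⁻ {k = k} {x} eq with k F.≟ x
  shrink-just⁻ refl | no ne = sym (F.punchIn-punchOut ne)

  shrink-nothing⁻ : ∀ {m} {k x : Fin (suc m)} → shrink k x ≡ nothing → x ≡ k
  shrink-nothing⁻ {k = k} {x} eq with k F.≟ x
  ... | yes k≡x = sym k≡x

  shrink-just⁺ : ∀ {m} {k x : Fin (suc m)} → x ≢ k → ∃ λ y → shrink k x ≡ just y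
  shrink-just⁺ {k = k} {x} ne with k F.≟ x
  ... | yes k≡x = contradiction (sym k≡x) ne
  ... | no _    = _ , refl

shrink-cases : ∀ {m} (k x : Fin (suc m)) → shrink k x ≡ nothing ⊎ ∃ λ y → shrink k x ≡ just y
shrink-cases k x with x F.≟ k
... | yes refl = inj₁ (shrink-self k)
... | no ne    = inj₂ (shrink-just⁺ ne)

shrink-punchIn : ∀ {m} (k : Fin (suc m)) y → shrink k (punchIn k y) ≡ just y
shrink-punchIn k y with shrink-just⁺ {k = k} (F.punchInᵢ≢i k y)
... | y′ , eq = trans eq (cong just (F.punchIn-injective k _ _ (sym (shrink-just⁻ eq))))

shrink-injective : ∀ {m} {k x x′ : Fin (suc m)} → shrink k x ≡ shrink k x′ → x ≡ x′
shrink-injective {k = k} {x} {x′} eq with shrink k x in e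
... | just y  = trans (shrink-just⁻ e) (sym (shrink-just⁻ (sym eq)))
... | nothing = trans (shrink-nothing⁻ e) (sym (shrink-nothing⁻ (sym eq)))

toℕ-punchIn-fromℕ : ∀ {m} (y : Fin m) → toℕ (punchIn (fromℕ m) y) ≡ toℕ y
toℕ-punchIn-fromℕ zero    = refl
toℕ-punchIn-fromℕ (suc y) = cong suc (toℕ-punchIn-fromℕ y)

pair : ∀ {A B : Set} → Maybe A → Maybe B → List (A × B)
pair (just a) (just b) = (a , b) ∷ []
pair _        _        = []

pair≤1 : ∀ {A B : Set} (a : Maybe A) (b : Maybe B) → length (pair a b) ≤ 1
pair≤1 (just _) (just _) = ℕ.≤-refl
pair≤1 (just _) nothing  = z≤n
pair≤1 nothing  _        = z≤n

pair-nothing : ∀ {A B : Set} {a : Maybe A} {b : Maybe B} → b ≡ nothing → pair a b ≡ []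
pair-nothing {a = just _}  refl = refl
pair-nothing {a = nothing} _    = refl

pair⁻ : ∀ {A B : Set} {a : Maybe A} {b : Maybe B} {x y} → (x , y) ∈ pair a b → a ≡ just x × b ≡ just y
pair⁻ {a = just _} {just _} (here refl) = refl , refl

pair⁺ : ∀ {A B : Set} {a : Maybe A} {b : Maybe B} {x y} → a ≡ just x → b ≡ just y → (x , y) ∈ pair a b
pair⁺ refl refl = here refl

triple : ∀ {A B C : Set} → Maybe A → Maybe B → Maybe C → List (A × B × C)
triple a b (just c) = map (λ { (x , y) → x , y , c }) (pair a b)
triple a b nothing  = []

triple≤1 : ∀ {A B C : Set} (a : Maybe A) (b : Maybe B) (c : Maybe C) → length (triple a b c) ≤ 1
triple≤1 a b (just c) = ℕ.≤-trans (ℕ.≤-reflexive (length-map _ (pair a b))) (pair≤1 a b)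
triple≤1 a b nothing  = z≤n

triple-nothing : ∀ {A B C : Set} {a : Maybe A} {b : Maybe B} {c : Maybe C} → c ≡ nothing → triple a b c ≡ []
triple-nothing refl = refl

triple⁻ : ∀ {A B C : Set} {a : Maybe A} {b : Maybe B} {c : Maybe C} {x y z} → (x , y , z) ∈ triple a b c →
          a ≡ just x × b ≡ just y × c ≡ just z
triple⁻ {a = just _} {just _} {just _} (here refl) = refl , refl , refl

triple⁺ : ∀ {A B C : Set} {a : Maybe A} {b : Maybe B} {c : Maybe C} {x y z} →
          a ≡ just x → b ≡ just y → c ≡ just z → (x , y , z) ∈ triple a b c
triple⁺ refl refl refl = here refl

record Arrangement {m} (E : List (Fin m × Fin m)) (r c : Fin m) : Set where
  field
    ρ κ   : Fin m → Fin m
    ρ-inj : ∀ {i i′} → ρ i ≡ ρ i′ → i ≡ i′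
    κ-inj : ∀ {j j′} → κ j ≡ κ j′ → j ≡ j′
    diag  : suc (toℕ (ρ r) + toℕ (κ c)) ≡ m
    left  : ∀ {i j} → (i , j) ∈ E → suc (toℕ (ρ i) + toℕ (κ j)) < m

maybe′-injective : ∀ {A B : Set} {f : A → B} {b} → (∀ {x y} → f x ≡ f y → x ≡ y) → (∀ {x} → f x ≢ b) →
                   ∀ {x y} → maybe′ f b x ≡ maybe′ f b y → x ≡ y
maybe′-injective inj new {just _}  {just _}  eq = cong just (inj eq)
maybe′-injective inj new {just _}  {nothing} eq = contradiction eq new
maybe′-injective inj new {nothing} {just _}  eq = contradiction (sym eq) new
maybe′-injective inj new {nothing} {nothing} eq = refl

opaque
  -- If all cells of `E` lie in column `c`, this column is put first and row `r` last. Otherwise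
  -- some other column `c₁` contains a cell; it is put first, and a row `r₁` that is different from
  -- `r` and meets no cell is put last. The cells of `c₁` are then left of the antidiagonal, and the
  -- remaining array has order one less and at least one cell less.
  arrange : ∀ m (E : List (Fin m × Fin m)) r c → (r , c) ∉ E → 2 + length E ≤ m → Arrangement E r c
  arrange (suc m) E r c rc∉ small with Any.any? (λ e → ¬? (proj₂ e F.≟ c)) E
  ... | no one-col = record
    { ρ = ρ ; κ = κ ; ρ-inj = transpose-injective r (fromℕ m) ; κ-inj = transpose-injective c zero
    ; diag = cong suc (trans (cong₂ (λ a b → toℕ a + toℕ b) ρr κc) (trans (ℕ.+-identityʳ _) (F.toℕ-fromℕ m)))
    ; left = left }
    where
    ρ κ : Fin (suc m) → Fin (suc m)
    ρ = transpose r (fromℕ m)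
    κ = transpose c zero
    ρr : ρ r ≡ fromℕ m
    ρr = transpose-left {a = r} {fromℕ m} refl
    κc : κ c ≡ zero
    κc = transpose-left {a = c} {zero} refl
    left : ∀ {i j} → (i , j) ∈ E → suc (toℕ (ρ i) + toℕ (κ j)) < suc m
    left {i} {j} ij∈ with decidable-stable (j F.≟ c) (λ j≢c → one-col (lose ij∈ j≢c))
    ... | refl rewrite κc | ℕ.+-identityʳ (toℕ (ρ i)) = s≤s (ℕ.≤∧≢⇒< (ℕ.≤-pred (F.toℕ<n (ρ i))) λ eq →
      rc∉ (subst (λ t → (t , j) ∈ E)
        (transpose-injective r (fromℕ m) (F.toℕ-injective (trans eq (trans (sym (F.toℕ-fromℕ m)) (cong toℕ (sym ρr)))))) ij∈))
  ... | yes other with find other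
  ...   | (i₁ , c₁) , e₁∈ , c₁≢c = record
    { ρ = ρ ; κ = κ
    ; ρ-inj = λ eq → shrink-injective (maybe′-injective
        (λ e → IH.ρ-inj (F.inject₁-injective e)) (λ e → F.fromℕ≢inject₁ (sym e)) eq)
    ; κ-inj = λ eq → shrink-injective (maybe′-injective (λ e → IH.κ-inj (F.suc-injective e)) (λ ()) eq)
    ; diag = diag ; left = left }
    where
    rows : List (Fin (suc m))
    rows = r ∷ map proj₁ E
    r₁-fresh : ∃ λ x → x ∉ rows
    r₁-fresh = fresh rows (subst (λ t → suc t < suc m) (sym (length-map proj₁ E)) small)
    r₁ : Fin (suc m)
    r₁ = proj₁ r₁-fresh
    r′-spec : ∃ λ y → shrink r₁ r ≡ just y
    r′-spec = shrink-just⁺ {k = r₁} {r} (λ eq → proj₂ r₁-fresh (here (sym eq)))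
    c′-spec : ∃ λ y → shrink c₁ c ≡ just y
    c′-spec = shrink-just⁺ {k = c₁} {c} (λ eq → c₁≢c (sym eq))
    h : Fin (suc m) × Fin (suc m) → List (Fin m × Fin m)
    h (i , j) = pair (shrink r₁ i) (shrink c₁ j)
    h≤1 : ∀ e → length (h e) ≤ 1
    h≤1 (i , j) = pair≤1 (shrink r₁ i) (shrink c₁ j)
    h-c₁ : h (i₁ , c₁) ≡ []
    h-c₁ = pair-nothing (shrink-self c₁)
    E′ : List (Fin m × Fin m)
    E′ = concatMap h E
    rc∉′ : (proj₁ r′-spec , proj₁ c′-spec) ∉ E′
    rc∉′ p with ∈-select⁻ h E p
    ... | (i , j) , ij∈ , q with pair⁻ {a = shrink r₁ i} q
    ...   | ei , ej = rc∉ (subst₂ (λ a b → (a , b) ∈ E)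
                        (shrink-injective (trans ei (sym (proj₂ r′-spec)))) (shrink-injective (trans ej (sym (proj₂ c′-spec)))) ij∈)
    module IH = Arrangement (arrange m E′ _ _ rc∉′ (ℕ.≤-trans (s≤s (length-select< h h≤1 e₁∈ h-c₁)) (ℕ.≤-pred small)))
    ρ κ : Fin (suc m) → Fin (suc m)
    ρ i = maybe′ (λ x → inject₁ (IH.ρ x)) (fromℕ m) (shrink r₁ i)
    κ j = maybe′ (λ x → suc (IH.κ x)) zero (shrink c₁ j)
    toℕ-ρ : ∀ {i x} → shrink r₁ i ≡ just x → toℕ (ρ i) ≡ toℕ (IH.ρ x)
    toℕ-ρ e = trans (cong (λ t → toℕ (maybe′ (λ x → inject₁ (IH.ρ x)) (fromℕ m) t)) e) (F.toℕ-inject₁ _)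
    toℕ-κ : ∀ {j x} → shrink c₁ j ≡ just x → toℕ (κ j) ≡ suc (toℕ (IH.κ x))
    toℕ-κ e = cong (λ t → toℕ (maybe′ (λ x → suc (IH.κ x)) zero t)) e
    diag : suc (toℕ (ρ r) + toℕ (κ c)) ≡ suc m
    diag = cong suc (trans (cong₂ _+_ (toℕ-ρ (proj₂ r′-spec)) (toℕ-κ (proj₂ c′-spec))) (trans (ℕ.+-suc _ _) IH.diag))
    left : ∀ {i j} → (i , j) ∈ E → suc (toℕ (ρ i) + toℕ (κ j)) < suc m
    left {i} {j} ij∈ with shrink-cases r₁ i | shrink-cases c₁ j
    ... | inj₁ ei | _ = contradiction (there (subst (_∈ map proj₁ E) (shrink-nothing⁻ ei) (∈.∈-map⁺ proj₁ ij∈))) (proj₂ r₁-fresh)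
    ... | inj₂ (i′ , ei) | inj₁ ej = s≤s (subst (_< m)
            (sym (trans (cong₂ _+_ (toℕ-ρ ei) (cong (λ t → toℕ (maybe′ (λ x → suc (IH.κ x)) zero t)) ej)) (ℕ.+-identityʳ _)))
            (F.toℕ<n (IH.ρ i′)))
    ... | inj₂ (i′ , ei) | inj₂ (j′ , ej) = s≤s (subst (_< m)
            (sym (trans (cong₂ _+_ (toℕ-ρ ei) (toℕ-κ ej)) (ℕ.+-suc _ _)))
            (IH.left (∈-select⁺ h ij∈ (pair⁺ ei ej))))

-- In a consistent list a colour confined to one row stands on one cell only. Comparing rows makes
-- this the exact alternative to `Repeated`.
Single : ∀ {n k} → List (Cell n k) → Fin n → Fin k → Set
Single E r u = ∀ {i j} → (i , j , u) ∈ E → i ≡ r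

repeated-or-single : ∀ {n k} (E : List (Cell n k)) →
                     Repeated E ⊎ ∃ λ r → ∃ λ c → ∃ λ u → (r , c , u) ∈ E × Single E r u
repeated-or-single {n} {k} E with Any.any? (λ e → ¬? (again? e)) E
  where
  again? : (e : Cell n k) → Dec (Any (λ e′ → proj₂ (proj₂ e′) ≡ proj₂ (proj₂ e) × proj₁ e′ ≢ proj₁ e) E)
  again? (i , j , c) = Any.any? (λ e′ → (proj₂ (proj₂ e′) F.≟ c) ×-dec ¬? (proj₁ e′ F.≟ i)) E
... | yes some = inj₂ single
  where
  single : ∃ λ r → ∃ λ c → ∃ λ u → (r , c , u) ∈ E × Single E r u
  single with find some
  ... | (r , c , u) , e∈ , once = r , c , u , e∈ , λ {i} i∈ →
          decidable-stable (i F.≟ r) λ i≢r → once (lose i∈ (refl , i≢r))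
... | no none = inj₁ repeated
  where
  repeated : Repeated E
  repeated {i} {j} {c} e∈ with find (decidable-stable
    (Any.any? (λ e′ → (proj₂ (proj₂ e′) F.≟ c) ×-dec ¬? (proj₁ e′ F.≟ i)) E) (λ once → none (lose e∈ once)))
  ... | (i′ , j′ , _) , e′∈ , refl , i′≢i = i′ , j′ , e′∈ , i′≢i

-- Old and new cells are compared in a common range, since the relabelling consists of permutations
-- followed by partial inverses of `punchIn`.
consistent-image : ∀ {n k n′ k′ n″ k″} {E : List (Cell n k)} {E′ : List (Cell n′ k′)}
  (ρ κ : Fin n → Fin n″) (γ : Fin k → Fin k″) (π π′ : Fin n′ → Fin n″) (δ : Fin k′ → Fin k″) →
  (∀ {x y} → ρ x ≡ ρ y → x ≡ y) → (∀ {x y} → κ x ≡ κ y → x ≡ y) → (∀ {x y} → γ x ≡ γ y → x ≡ y) →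
  (∀ {x y} → π x ≡ π y → x ≡ y) → (∀ {x y} → π′ x ≡ π′ y → x ≡ y) → (∀ {x y} → δ x ≡ δ y → x ≡ y) →
  (∀ {i j c} → (i , j , c) ∈ E′ → ∃ λ i₀ → ∃ λ j₀ → ∃ λ c₀ → (i₀ , j₀ , c₀) ∈ E × ρ i₀ ≡ π i × κ j₀ ≡ π′ j × γ c₀ ≡ δ c) →
  Consistent E → Consistent E′
consistent-image {E = E} {E′} ρ κ γ π π′ δ ρ-inj κ-inj γ-inj π-inj π′-inj δ-inj source consistent =
  record { cell = cell′ ; row = row′ ; col = col′ }
  where
  open Consistent consistent
  cell′ : ∀ {i j c d} → (i , j , c) ∈ E′ → (i , j , d) ∈ E′ → c ≡ d
  cell′ p q with source p | source q
  ... | i , j , c , e∈ , ei , ej , ec | i′ , j′ , c′ , e′∈ , ei′ , ej′ , ec′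
    with refl ← ρ-inj (trans ei (sym ei′)) with refl ← κ-inj (trans ej (sym ej′)) with refl ← cell e∈ e′∈ =
    δ-inj (trans (sym ec) ec′)
  row′ : ∀ {i j j′ c} → (i , j , c) ∈ E′ → (i , j′ , c) ∈ E′ → j ≡ j′
  row′ p q with source p | source q
  ... | i , j , c , e∈ , ei , ej , ec | i′ , j′ , c′ , e′∈ , ei′ , ej′ , ec′
    with refl ← ρ-inj (trans ei (sym ei′)) with refl ← γ-inj (trans ec (sym ec′)) with refl ← row e∈ e′∈ =
    π′-inj (trans (sym ej) ej′)
  col′ : ∀ {i i′ j c} → (i , j , c) ∈ E′ → (i′ , j , c) ∈ E′ → i ≡ i′
  col′ p q with source p | source q
  ... | i , j , c , e∈ , ei , ej , ec | i′ , j′ , c′ , e′∈ , ei′ , ej′ , ec′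
    with refl ← κ-inj (trans ej (sym ej′)) with refl ← γ-inj (trans ec (sym ec′)) with refl ← col e∈ e′∈ =
    π-inj (trans (sym ei) ei′)

-- The first row and column of L are treated as the missing colours of the remaining array.
module Prolongation {m} (L : Fin (suc m) → Fin (suc m) → Fin (suc m)) (L-proper : Proper L) (u : Fin (2 + m)) where
  private
    module L = Proper L-proper

    inner : Corona (Fin m) (Fin m) (Fin (suc m))
    inner = record
      { A = λ i j → L (suc i) (suc j) ; R = λ i → L (suc i) zero ; C = λ j → L zero (suc j)
      ; row = λ e → F.suc-injective (L.row e) ; col = λ e → F.suc-injective (L.col e)
      ; A≢R = λ e → contradiction (L.row e) λ () ; A≢C = λ e → contradiction (L.col e) λ () }

    module S = Smetaniuk (smetaniuk inner u)

    new = punchIn u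

    low : Fin (suc m) → Maybe (Fin m)
    low = shrink (fromℕ m)

  -- For a Latin square the forbidden colours of different rows differ, and so do those of different
  -- columns. The prolongation preserves this, so they can be put back as first column and first
  -- row.
  G : Fin (2 + m) → Fin (2 + m) → Fin (2 + m)
  G zero    zero    = new (L zero zero)
  G zero    (suc x) = S.C (low x)
  G (suc y) zero    = S.R (low y)
  G (suc y) (suc x) = S.A (low y) (low x)

  private
    corner≢C : ∀ x → new (L zero zero) ≢ S.C x
    corner≢C (just x) eq = contradiction (L.row (F.punchIn-injective u _ _ (trans eq (S.C-old x)))) λ ()
    corner≢C nothing  eq = F.punchInᵢ≢i u _ (trans eq S.C-new)

    corner≢R : ∀ x → new (L zero zero) ≢ S.R x
    corner≢R (just x) eq = contradiction (L.col (F.punchIn-injective u _ _ (trans eq (S.R-old x)))) λ ()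
    corner≢R nothing  eq = F.punchInᵢ≢i u _ (trans eq S.R-new)

    C-inj : ∀ {x y} → S.C x ≡ S.C y → x ≡ y
    C-inj {just x} {just y} eq = cong just (F.suc-injective (L.row (F.punchIn-injective u _ _ (trans (sym (S.C-old x)) (trans eq (S.C-old y))))))
    C-inj {just x} {nothing} eq = contradiction (trans (sym (S.C-old x)) (trans eq S.C-new)) (F.punchInᵢ≢i u _)
    C-inj {nothing} {just y} eq = contradiction (trans (sym (S.C-old y)) (trans (sym eq) S.C-new)) (F.punchInᵢ≢i u _)
    C-inj {nothing} {nothing} eq = refl

    R-inj : ∀ {x y} → S.R x ≡ S.R y → x ≡ y
    R-inj {just x} {just y} eq = cong just (F.suc-injective (L.col (F.punchIn-injective u _ _ (trans (sym (S.R-old x)) (trans eq (S.R-old y))))))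
    R-inj {just x} {nothing} eq = contradiction (trans (sym (S.R-old x)) (trans eq S.R-new)) (F.punchInᵢ≢i u _)
    R-inj {nothing} {just y} eq = contradiction (trans (sym (S.R-old y)) (trans (sym eq) S.R-new)) (F.punchInᵢ≢i u _)
    R-inj {nothing} {nothing} eq = refl

    G-row : ∀ {y x x′} → G y x ≡ G y x′ → x ≡ x′
    G-row {zero}  {zero}  {zero}   eq = refl
    G-row {zero}  {zero}  {suc x}  eq = contradiction eq (corner≢C _)
    G-row {zero}  {suc x} {zero}   eq = contradiction (sym eq) (corner≢C _)
    G-row {zero}  {suc x} {suc x′} eq = cong suc (shrink-injective (C-inj eq))
    G-row {suc y} {zero}  {zero}   eq = refl
    G-row {suc y} {zero}  {suc x}  eq = contradiction (sym eq) (S.A≢R {low y} {low x})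
    G-row {suc y} {suc x} {zero}   eq = contradiction eq (S.A≢R {low y} {low x})
    G-row {suc y} {suc x} {suc x′} eq = cong suc (shrink-injective (S.row eq))

    G-col : ∀ {y y′ x} → G y x ≡ G y′ x → y ≡ y′
    G-col {zero}  {zero}   {zero}  eq = refl
    G-col {zero}  {suc y}  {zero}  eq = contradiction eq (corner≢R _)
    G-col {suc y} {zero}   {zero}  eq = contradiction (sym eq) (corner≢R _)
    G-col {suc y} {suc y′} {zero}  eq = cong suc (shrink-injective (R-inj eq))
    G-col {zero}  {zero}   {suc x} eq = refl
    G-col {zero}  {suc y}  {suc x} eq = contradiction (sym eq) (S.A≢C {low y} {low x})
    G-col {suc y} {zero}   {suc x} eq = contradiction eq (S.A≢C {low y} {low x})
    G-col {suc y} {suc y′} {suc x} eq = cong suc (shrink-injective (S.col eq))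

  G-proper : Proper G
  G-proper = record { row = λ {y} → G-row {y} ; col = G-col }

  private
    low-last : ∀ {x} → toℕ x ≡ m → low x ≡ nothing
    low-last {x} eq = trans (cong low (F.toℕ-injective (trans eq (sym (F.toℕ-fromℕ m))))) (shrink-self (fromℕ m))

    low-just : ∀ {x} → toℕ x < m → ∃ λ x′ → low x ≡ just x′ × toℕ x′ ≡ toℕ x
    low-just {x} lt with shrink-just⁺ {k = fromℕ m} {x} (λ { refl → ℕ.<-irrefl (F.toℕ-fromℕ m) lt })
    ... | x′ , e = x′ , e , trans (sym (toℕ-punchIn-fromℕ x′)) (cong toℕ (sym (shrink-just⁻ e)))

  G-diag : ∀ y x → suc (toℕ y + toℕ x) ≡ 2 + m → G y x ≡ u
  G-diag zero    (suc x) eq rewrite low-last {x} (ℕ.suc-injective (ℕ.suc-injective eq)) = S.C-new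
  G-diag (suc y) zero    eq rewrite low-last {y} (trans (sym (ℕ.+-identityʳ _)) (ℕ.suc-injective (ℕ.suc-injective eq))) = S.R-new
  G-diag (suc y) (suc x) eq
    with y+x ← trans (sym (ℕ.+-suc (toℕ y) (toℕ x))) (ℕ.suc-injective (ℕ.suc-injective eq))
    with y′ , ey , ny ← low-just {y} (ℕ.≤-trans (s≤s (ℕ.m≤m+n _ _)) (ℕ.≤-reflexive y+x))
       | x′ , ex , nx ← low-just {x} (ℕ.≤-trans (s≤s (ℕ.m≤n+m _ _)) (ℕ.≤-reflexive y+x)) =
    trans (cong₂ S.A ey ex) (S.A-diag (trans (cong suc (cong₂ _+_ ny nx)) y+x))

  G-left : ∀ y x → suc (toℕ y + toℕ x) < 2 + m → G (punchIn (fromℕ (suc m)) y) (punchIn (fromℕ (suc m)) x) ≡ new (L y x)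
  G-left zero    zero    lt = refl
  G-left zero    (suc x) lt rewrite shrink-punchIn (fromℕ m) x = S.C-old x
  G-left (suc y) zero    lt rewrite shrink-punchIn (fromℕ m) y = S.R-old y
  G-left (suc y) (suc x) lt rewrite shrink-punchIn (fromℕ m) x | shrink-punchIn (fromℕ m) y =
    S.A-left (subst (_< m) (ℕ.+-suc (toℕ y) (toℕ x)) (ℕ.≤-pred (ℕ.≤-pred lt)))

record LatinStep {m} (L : Fin (suc m) → Fin (suc m) → Fin (suc m)) (u : Fin (2 + m)) : Set where
  field
    G        : Fin (2 + m) → Fin (2 + m) → Fin (2 + m)
    G-proper : Proper G
    G-diag   : ∀ y x → suc (toℕ y + toℕ x) ≡ 2 + m → G y x ≡ u
    G-left   : ∀ y x → suc (toℕ y + toℕ x) < 2 + m →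
               G (punchIn (fromℕ (suc m)) y) (punchIn (fromℕ (suc m)) x) ≡ punchIn u (L y x)

  G-shrunk : ∀ {y x y′ x′} → suc (toℕ y + toℕ x) < 2 + m →
             shrink (fromℕ (suc m)) y ≡ just y′ → shrink (fromℕ (suc m)) x ≡ just x′ → G y x ≡ punchIn u (L y′ x′)
  G-shrunk {y′ = y′} {x′} lt ey ex with refl ← shrink-just⁻ ey with refl ← shrink-just⁻ ex =
    G-left y′ x′ (subst₂ (λ a b → suc (a + b) < 2 + m) (toℕ-punchIn-fromℕ y′) (toℕ-punchIn-fromℕ x′) lt)

opaque
  latin-step : ∀ {m} (L : Fin (suc m) → Fin (suc m) → Fin (suc m)) → Proper L → ∀ u → LatinStep L u
  latin-step L L-proper u = record { Prolongation L L-proper u }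

-- After the arrangement the cells of other colours are strictly left of the antidiagonal, hence not
-- in the last row or column. They fit into a square of order one less that lacks `u`, and its
-- prolongation puts `u` on the antidiagonal, where `(r , c)` has been moved.
evans-single : ∀ {m} → (∀ (E : List (Cell (suc m) (suc m))) → Consistent E → length E < suc m → Completion E) →
               ∀ (E : List (Cell (2 + m) (2 + m))) → Consistent E → length E < 2 + m →
               ∀ {r c u} → (r , c , u) ∈ E → Single E r u → Completion E
evans-single {m} smaller E consistent small {r} {c} {u} e₀∈ single =
  (λ i j → G (ρ i) (κ j)) ,
  record { row = λ {i} e → κ-inj (Proper.row G-proper {ρ i} e) ; col = λ e → ρ-inj (Proper.col G-proper e) } , spec
  where
  open Consistent consistent
  top = fromℕ (suc m)
  others : Cell (2 + m) (2 + m) → List (Fin (2 + m) × Fin (2 + m))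
  others (i , j , d) = maybe′ (λ _ → (i , j) ∷ []) [] (shrink u d)
  others≤1 : ∀ e → length (others e) ≤ 1
  others≤1 (i , j , d) with shrink u d
  ... | just _  = ℕ.≤-refl
  ... | nothing = z≤n
  rc∉ : (r , c) ∉ concatMap others E
  rc∉ p with ∈-select⁻ others E p
  ... | (i , j , d) , e∈ , q with shrink u d in eq
  rc∉ p | (i , j , d) , e∈ , here refl | just d′ = F.punchInᵢ≢i u d′ (trans (sym (shrink-just⁻ eq)) (cell e∈ e₀∈))
  open Arrangement (arrange (2 + m) (concatMap others E) r c rc∉
    (ℕ.≤-trans (s≤s (length-select< others others≤1 e₀∈ (cong (maybe′ _ _) (shrink-self u)))) small))
  h : Cell (2 + m) (2 + m) → List (Cell (suc m) (suc m))
  h (i , j , d) = triple (shrink top (ρ i)) (shrink top (κ j)) (shrink u d)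
  h≤1 : ∀ e → length (h e) ≤ 1
  h≤1 (i , j , d) = triple≤1 (shrink top (ρ i)) (shrink top (κ j)) (shrink u d)
  E′ = concatMap h E
  consistent′ : Consistent E′
  consistent′ = consistent-image ρ κ (λ x → x) (punchIn top) (punchIn top) (punchIn u) ρ-inj κ-inj (λ e → e)
    (λ {x} {y} → F.punchIn-injective top x y) (λ {x} {y} → F.punchIn-injective top x y) (λ {x} {y} → F.punchIn-injective u x y)
    (λ p → let (i , j , d) , e∈ , q = ∈-select⁻ h E p ; ei , ej , ed = triple⁻ {a = shrink top (ρ i)} q in
      i , j , d , e∈ , shrink-just⁻ ei , shrink-just⁻ ej , shrink-just⁻ ed)
    consistent
  IH = smaller E′ consistent′ (ℕ.≤-trans (length-select< h h≤1 e₀∈ (triple-nothing (shrink-self u))) (ℕ.≤-pred small))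
  open LatinStep (latin-step (proj₁ IH) (proj₁ (proj₂ IH)) u)
  low : ∀ {x n} → suc (toℕ x + n) < 2 + m → ∃ λ y → shrink top x ≡ just y
  low {x} lt = shrink-just⁺ λ { refl → ℕ.<⇒≱ lt (s≤s (ℕ.≤-trans (ℕ.≤-reflexive (sym (F.toℕ-fromℕ (suc m)))) (ℕ.m≤m+n _ _))) }
  u-placed : ∀ {i j} → (i , j , u) ∈ E → G (ρ i) (κ j) ≡ u
  u-placed e∈ = trans (cong₂ (λ a b → G (ρ a) (κ b)) (single e∈) (row (subst (λ t → (t , _ , u) ∈ E) (single e∈) e∈) e₀∈))
    (G-diag (ρ r) (κ c) diag)
  other-placed : ∀ {i j d d′} → (i , j , d) ∈ E → shrink u d ≡ just d′ → G (ρ i) (κ j) ≡ d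
  other-placed {i} {j} {d} {d′} e∈ ed = trans (G-shrunk lt (proj₂ i′-spec) (proj₂ j′-spec))
    (trans (cong (punchIn u) (proj₂ (proj₂ IH) (∈-select⁺ h e∈ (triple⁺ (proj₂ i′-spec) (proj₂ j′-spec) ed)))) (sym (shrink-just⁻ ed)))
    where
    lt : suc (toℕ (ρ i) + toℕ (κ j)) < 2 + m
    lt = left (∈-select⁺ others e∈ (subst (λ t → (i , j) ∈ maybe′ (λ _ → (i , j) ∷ []) [] t) (sym ed) (here refl)))
    i′-spec = low {ρ i} lt
    j′-spec = low {κ j} (subst (λ t → suc t < 2 + m) (ℕ.+-comm (toℕ (ρ i)) _) lt)
  spec : ∀ {i j d} → (i , j , d) ∈ E → G (ρ i) (κ j) ≡ d
  spec {i} {j} {d} e∈ = cases (shrink-cases u d)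
    where
    cases : shrink u d ≡ nothing ⊎ (∃ λ d′ → shrink u d ≡ just d′) → G (ρ i) (κ j) ≡ d
    cases (inj₁ ed) = trans (u-placed (subst (λ t → (i , j , t) ∈ E) (shrink-nothing⁻ ed) e∈)) (sym (shrink-nothing⁻ ed))
    cases (inj₂ (_ , ed)) = other-placed e∈ ed

opaque
  evans : ∀ N (E : List (Cell N N)) → Consistent E → length E < N → Completion E
  evans (suc zero) [] _ _ = (λ _ _ → zero) , record { row = λ { {j = zero} {zero} _ → refl } ; col = λ { {zero} {zero} _ → refl } } , λ ()
  evans (suc zero) (_ ∷ _) _ (s≤s ())
  evans (suc (suc m)) E consistent small = step (evans (suc m)) (repeated-or-single E)
    where
    step : (∀ (E : List (Cell (suc m) (suc m))) → Consistent E → length E < suc m → Completion E) →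
           Repeated E ⊎ (∃ λ r → ∃ λ c → ∃ λ u → (r , c , u) ∈ E × Single E r u) → Completion E
    step smaller (inj₁ repeated) = repeated-completion E consistent repeated (ℕ.<⇒≤ small)
    step smaller (inj₂ (_ , _ , _ , e₀∈ , single)) = evans-single smaller E consistent small e₀∈ single

-- Exchange cells for precoloured rungs

-- Precoloured edges with the layer forgotten; row i and col j are the rungs at the two sides.
data Element (n : ℕ) : Set where
  cell : Fin n → Fin n → Fin (suc n) → Element n
  row  : Fin n → Fin (suc n) → Element n
  col  : Fin n → Fin (suc n) → Element n

colour : ∀ {n} → Element n → Fin (suc n)
colour (cell _ _ c) = c
colour (row _ c)    = c
colour (col _ c)    = c

columns : ∀ {n} → Element n → List (Fin n)
columns (cell _ j _) = j ∷ []
columns (row _ _)    = []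
columns (col j _)    = j ∷ []

rows : ∀ {n} → Element n → List (Fin n)
rows (cell i _ _) = i ∷ []
rows (row i _)    = i ∷ []
rows (col _ _)    = []

columns≤1 : ∀ {n} (e : Element n) → length (columns e) ≤ 1
columns≤1 (cell _ _ _) = ℕ.≤-refl
columns≤1 (row _ _)    = z≤n
columns≤1 (col _ _)    = ℕ.≤-refl

rows≤1 : ∀ {n} (e : Element n) → length (rows e) ≤ 1
rows≤1 (cell _ _ _) = ℕ.≤-refl
rows≤1 (row _ _)    = ℕ.≤-refl
rows≤1 (col _ _)    = z≤n

_≟ᴱ_ : ∀ {n} → DecidableEquality (Element n)
cell i j c ≟ᴱ cell i′ j′ c′ = map′ (λ { (refl , refl , refl) → refl }) (λ { refl → refl , refl , refl })
  (i F.≟ i′ ×-dec j F.≟ j′ ×-dec c F.≟ c′)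
cell _ _ _ ≟ᴱ row _ _ = no λ ()
cell _ _ _ ≟ᴱ col _ _ = no λ ()
row _ _ ≟ᴱ cell _ _ _ = no λ ()
row i c ≟ᴱ row i′ c′ = map′ (λ { (refl , refl) → refl }) (λ { refl → refl , refl }) (i F.≟ i′ ×-dec c F.≟ c′)
row _ _ ≟ᴱ col _ _ = no λ ()
col _ _ ≟ᴱ cell _ _ _ = no λ ()
col _ _ ≟ᴱ row _ _ = no λ ()
col i c ≟ᴱ col i′ c′ = map′ (λ { (refl , refl) → refl }) (λ { refl → refl , refl }) (i F.≟ i′ ×-dec c F.≟ c′)

module _ {n : ℕ} where
  open import Data.List.Membership.DecPropositional (_≟ᴱ_ {n}) public using () renaming (_∈?_ to _∈E?_)

module _ {n : ℕ} (z : Fin (suc n)) where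

  -- With the layers forgotten, a cell may carry two colours and a colour may occur twice in a row.
  -- Thus cells of colours other than `z` are compared with rungs and with cells of colour `z`, but
  -- not with each other.
  record Admissible (Es : List (Element n)) : Set where
    field
      row-unique : ∀ {i c d} → row i c ∈ Es → row i d ∈ Es → c ≡ d
      col-unique : ∀ {j c d} → col j c ∈ Es → col j d ∈ Es → c ≡ d
      row-cell   : ∀ {i j c} → row i c ∈ Es → cell i j c ∈ Es → ⊥
      col-cell   : ∀ {i j c} → col j c ∈ Es → cell i j c ∈ Es → ⊥
      z-row      : ∀ {i j c} → cell i j z ∈ Es → row i c ∈ Es → ⊥
      z-col      : ∀ {i j c} → cell i j z ∈ Es → col j c ∈ Es → ⊥
      z-inrow    : ∀ {i j j′} → cell i j z ∈ Es → cell i j′ z ∈ Es → j ≡ j′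
      z-incol    : ∀ {i i′ j} → cell i j z ∈ Es → cell i′ j z ∈ Es → i ≡ i′
      z-only     : ∀ {i j c} → cell i j z ∈ Es → cell i j c ∈ Es → c ≡ z

  -- The elements that force a cell to exchange its colour with the base colour z.
  Demand : Element n → Set
  Demand (cell _ _ c) = c ≡ z
  Demand (row _ c)    = c ≢ z
  Demand (col _ c)    = c ≢ z

  demand? : ∀ e → Dec (Demand e)
  demand? (cell _ _ c) = c F.≟ z
  demand? (row _ c)    = ¬? (c F.≟ z)
  demand? (col _ c)    = ¬? (c F.≟ z)

  demand : Element n → List (Element n)
  demand e with demand? e
  ... | yes _ = e ∷ []
  ... | no _  = []

  -- A chosen cell keeps off the rows and columns of cells that are to receive `z`, off precoloured
  -- cells, and off rungs whose colour it would change. The last two clauses for cells make it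
  -- compatible with the cells of either layer.
  Apart : Cell n (suc n) → Element n → Set
  Apart (i , j , x) (cell i′ j′ c) =
    (c ≡ z → i ≢ i′ × j ≢ j′) × (i ≡ i′ → j ≢ j′) × (i ≡ i′ → x ≢ c) × (j ≡ j′ → x ≢ c)
  Apart (i , j , x) (row i′ c) = i ≢ i′
  Apart (i , j , x) (col j′ c) = j ≢ j′

  -- An exchange recolours the rungs at both ends of its cell. The clause on `col j d` prevents a
  -- row rung and a column rung of equal colour from sharing one cell, which would destroy a
  -- repetition.
  Served : List (Element n) → List (Cell n (suc n)) → Element n → Set
  Served Es T (cell i j c) = c ≡ z × ∃ λ x → (i , j , x) ∈ T
  Served Es T (row i c)    = ∃ λ j → (i , j , c) ∈ T × ∀ d → col j d ∉ Es
  Served Es T (col j c)    = ∃ λ i → (i , j , c) ∈ T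

  record Transversal (Es : List (Element n)) : Set where
    field
      T      : List (Cell n (suc n))
      T-row  : ∀ {i j j′ x x′} → (i , j , x) ∈ T → (i , j′ , x′) ∈ T → j ≡ j′ × x ≡ x′
      T-col  : ∀ {i i′ j x x′} → (i , j , x) ∈ T → (i′ , j , x′) ∈ T → i ≡ i′ × x ≡ x′
      T≢z    : ∀ {i j x} → (i , j , x) ∈ T → x ≢ z
      T-source : ∀ {i j x} → (i , j , x) ∈ T → ∃ λ e → e ∈ Es × (colour e ≡ x ⊎ colour e ≡ z)
      apart  : ∀ {t e} → t ∈ T → e ∈ Es → ¬ Demand e → Apart t e
      served : ∀ {e} → e ∈ Es → Demand e → Served Es T e
      count  : length T ≤ length (concatMap demand Es)

  module Greedy (Es : List (Element n)) (adm : Admissible Es) where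
    open Admissible adm

    record State (todo : List (Element n)) : Set where
      field
        T          : List (Cell n (suc n))
        done       : List (Element n)
        T-row      : ∀ {i j j′ x x′} → (i , j , x) ∈ T → (i , j′ , x′) ∈ T → j ≡ j′ × x ≡ x′
        T-col      : ∀ {i i′ j x x′} → (i , j , x) ∈ T → (i′ , j , x′) ∈ T → i ≡ i′ × x ≡ x′
        T≢z        : ∀ {i j x} → (i , j , x) ∈ T → x ≢ z
        T-source   : ∀ {i j x} → (i , j , x) ∈ T → ∃ λ e → e ∈ Es × (colour e ≡ x ⊎ colour e ≡ z)
        apart-done : ∀ {t e} → t ∈ T → e ∈ done → Apart t e
        apart-todo : ∀ {t e} → t ∈ T → e ∈ todo → Apart t e
        idle       : ∀ {e} → e ∈ done → ¬ Demand e
        done⊆      : ∀ {e} → e ∈ done → e ∈ Es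
        todo⊆      : ∀ {e} → e ∈ todo → e ∈ Es
        cover      : ∀ {e} → e ∈ Es → e ∈ todo ⊎ e ∈ done ⊎ Served Es T e
        size       : length T + (length done + length todo) ≤ n
        count      : length T + length (concatMap demand todo) ≤ length (concatMap demand Es)

    module _ {B : Set} (t : Cell n (suc n) → B) (h : Element n → List B) (T : List (Cell n (suc n))) (done todo : List (Element n)) where

      used : List B
      used = map t T ++ (concatMap h done ++ concatMap h todo)

      length-used : (∀ e → length (h e) ≤ 1) → length used ≤ length T + (length done + length todo)
      length-used h≤1 rewrite length-++ (map t T) {concatMap h done ++ concatMap h todo} | length-map t T
                            | length-++ (concatMap h done) {concatMap h todo} =
        ℕ.+-monoʳ-≤ (length T) (ℕ.+-mono-≤ (length-select≤ h h≤1 done) (length-select≤ h h≤1 todo))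

      used-T : ∀ {c} → c ∈ T → t c ∈ used
      used-T c∈ = ∈.∈-++⁺ˡ (∈.∈-map⁺ t c∈)

      used-done : ∀ {e b} → e ∈ done → b ∈ h e → b ∈ used
      used-done e∈ b∈ = ∈.∈-++⁺ʳ (map t T) (∈.∈-++⁺ˡ (∈-select⁺ h e∈ b∈))

      used-todo : ∀ {e b} → e ∈ todo → b ∈ h e → b ∈ used
      used-todo e∈ b∈ = ∈.∈-++⁺ʳ (map t T) (∈.∈-++⁺ʳ (concatMap h done) (∈-select⁺ h e∈ b∈))

    served-mono : ∀ {t T e} → Served Es T e → Served Es (t ∷ T) e
    served-mono {e = cell _ _ _} (c≡z , x , p) = c≡z , x , there p
    served-mono {e = row _ _} (j , p , q) = j , there p , q
    served-mono {e = col _ _} (i , p) = i , there p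

    module Step {e : Element n} {todo : List (Element n)} (S : State (e ∷ todo)) where
      open State S

      room : length T + (length done + length todo) < n
      room = ℕ.≤-trans (ℕ.≤-reflexive (trans (sym (ℕ.+-suc (length T) _)) (cong (length T +_) (sym (ℕ.+-suc (length done) _))))) size

      -- An edge and its copy in the other layer can yield the same element twice. Only the last
      -- occurrence is treated; a demand served twice would choose two cells in one line.
      skip : e ∈ todo → State todo
      skip e∈ = record
        { State S
        ; apart-todo = λ t∈ e′∈ → apart-todo t∈ (there e′∈)
        ; todo⊆ = λ e′∈ → todo⊆ (there e′∈)
        ; cover = λ e′∈ → cover′ (cover e′∈)
        ; size = ℕ.<⇒≤ room
        ; count = ℕ.≤-trans (ℕ.+-monoʳ-≤ (length T) (ℕ.≤-trans (ℕ.m≤n+m _ (length (demand e)))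
                    (ℕ.≤-reflexive (sym (length-++ (demand e)))))) count }
        where
        cover′ : ∀ {e′} → e′ ∈ e ∷ todo ⊎ e′ ∈ done ⊎ Served Es T e′ → e′ ∈ todo ⊎ e′ ∈ done ⊎ Served Es T e′
        cover′ (inj₁ (here refl)) = inj₁ e∈
        cover′ (inj₁ (there e′∈)) = inj₁ e′∈
        cover′ (inj₂ x) = inj₂ x

      pass : ¬ Demand e → State todo
      pass ¬d = record
        { State S
        ; done = e ∷ done
        ; apart-done = λ { t∈ (here refl) → apart-todo t∈ (here refl) ; t∈ (there e′∈) → apart-done t∈ e′∈ }
        ; apart-todo = λ t∈ e′∈ → apart-todo t∈ (there e′∈)
        ; idle = λ { (here refl) → ¬d ; (there e′∈) → idle e′∈ }
        ; done⊆ = λ { (here refl) → todo⊆ (here refl) ; (there e′∈) → done⊆ e′∈ }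
        ; todo⊆ = λ e′∈ → todo⊆ (there e′∈)
        ; cover = λ e′∈ → cover′ (cover e′∈)
        ; size = subst (λ k → length T + k ≤ n) (ℕ.+-suc (length done) (length todo)) size
        ; count = ℕ.≤-trans (ℕ.+-monoʳ-≤ (length T) (ℕ.≤-trans (ℕ.m≤n+m _ (length (demand e)))
                    (ℕ.≤-reflexive (sym (length-++ (demand e)))))) count }
        where
        cover′ : ∀ {e′} → e′ ∈ e ∷ todo ⊎ e′ ∈ done ⊎ Served Es T e′ → e′ ∈ todo ⊎ e′ ∈ e ∷ done ⊎ Served Es T e′
        cover′ (inj₁ (here refl)) = inj₂ (inj₁ (here refl))
        cover′ (inj₁ (there e′∈)) = inj₁ e′∈
        cover′ (inj₂ (inj₁ e′∈)) = inj₂ (inj₁ (there e′∈))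
        cover′ (inj₂ (inj₂ s)) = inj₂ (inj₂ s)

      serve : Demand e → ∀ i j x → x ≢ z → colour e ≡ x ⊎ colour e ≡ z →
              (∀ {j′ x′} → (i , j′ , x′) ∉ T) → (∀ {i′ x′} → (i′ , j , x′) ∉ T) →
              (∀ {e′} → e′ ∈ done → Apart (i , j , x) e′) → (∀ {e′} → e′ ∈ todo → Apart (i , j , x) e′) →
              Served Es ((i , j , x) ∷ T) e → State todo
      serve d i j x x≢z hue i∉ j∉ ap-done ap-todo s = record
        { T = (i , j , x) ∷ T ; done = done
        ; T-row = λ { (here refl) (here refl) → refl , refl ; (here refl) (there q) → contradiction q i∉
                    ; (there p) (here refl) → contradiction p i∉ ; (there p) (there q) → T-row p q }
        ; T-col = λ { (here refl) (here refl) → refl , refl ; (here refl) (there q) → contradiction q j∉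
                    ; (there p) (here refl) → contradiction p j∉ ; (there p) (there q) → T-col p q }
        ; T≢z = λ { (here refl) → x≢z ; (there p) → T≢z p }
        ; T-source = λ { (here refl) → e , todo⊆ (here refl) , hue ; (there p) → T-source p }
        ; apart-done = λ { (here refl) → ap-done ; (there p) → apart-done p }
        ; apart-todo = λ { (here refl) → ap-todo ; (there p) e′∈ → apart-todo p (there e′∈) }
        ; idle = idle ; done⊆ = done⊆
        ; todo⊆ = λ e′∈ → todo⊆ (there e′∈)
        ; cover = λ e′∈ → cover′ (cover e′∈)
        ; size = room
        ; count = ℕ.≤-trans (ℕ.≤-reflexive (sym (trans (cong (length T +_) (length-demands (demand? e) d)) (ℕ.+-suc _ _)))) count }
        where
        cover′ : ∀ {e′} → e′ ∈ e ∷ todo ⊎ e′ ∈ done ⊎ Served Es T e′ →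
                 e′ ∈ todo ⊎ e′ ∈ done ⊎ Served Es ((i , j , x) ∷ T) e′
        cover′ (inj₁ (here refl)) = inj₂ (inj₂ s)
        cover′ (inj₁ (there e′∈)) = inj₁ e′∈
        cover′ (inj₂ (inj₁ e′∈)) = inj₂ (inj₁ e′∈)
        cover′ {e′} (inj₂ (inj₂ s)) = inj₂ (inj₂ (served-mono {e = e′} s))
        length-demands : Dec (Demand e) → Demand e → length (concatMap demand (e ∷ todo)) ≡ suc (length (concatMap demand todo))
        length-demands _ d with demand? e
        ... | yes _ = refl
        ... | no ¬d = contradiction d ¬d

    different : ∀ {e e′ todo} {done : List (Element n)} → e ∉ todo → Demand e → (∀ {e} → e ∈ done → ¬ Demand e) →
                e′ ∈ done ⊎ e′ ∈ todo → e′ ≢ e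
    different e∉ d idle (inj₁ p) refl = idle p d
    different e∉ d idle (inj₂ p) refl = e∉ p

    -- A demand has one free coordinate, and every other element excludes at most one value of it.
    step : ∀ {e todo} → State (e ∷ todo) → State todo
    step {e} {todo} S with e ∈E? todo | demand? e
    ... | yes e∈ | _ = Step.skip S e∈
    ... | no _ | no ¬d = Step.pass S ¬d
    step {row i x} {todo} S | no e∉ | yes d =
      Step.serve S d i j x d (inj₁ refl)
        (λ p → apart-todo p (here refl) refl)
        (λ p → j∉ (used-T _ _ T done todo p))
        (λ p → apart (inj₁ p)) (λ p → apart (inj₂ p)) (j , here refl , alone)
      where
      open State S
      j-fresh = fresh (used (λ t → proj₁ (proj₂ t)) columns T done todo)
                  (ℕ.≤-<-trans (length-used _ columns T done todo columns≤1) (Step.room S))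
      j = proj₁ j-fresh
      j∉ = proj₂ j-fresh
      e∈ = todo⊆ (here refl)
      both⊆ : ∀ {e′} → e′ ∈ done ⊎ e′ ∈ todo → e′ ∈ Es
      both⊆ (inj₁ p) = done⊆ p
      both⊆ (inj₂ p) = todo⊆ (there p)
      unused : ∀ {e′} → e′ ∈ done ⊎ e′ ∈ todo → ∀ {j′} → j′ ∈ columns e′ → j ≢ j′
      unused (inj₁ p) q refl = j∉ (used-done _ columns T done todo p q)
      unused (inj₂ p) q refl = j∉ (used-todo _ columns T done todo p q)
      apart : ∀ {e′} → e′ ∈ done ⊎ e′ ∈ todo → Apart (i , j , x) e′
      apart {cell i′ j′ c} p =
        (λ { refl → (λ { refl → z-row (both⊆ p) e∈ }) , unused p (here refl) }) ,
        (λ _ → unused p (here refl)) ,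
        (λ { refl refl → row-cell e∈ (both⊆ p) }) ,
        (λ eq → contradiction eq (unused p (here refl)))
      apart {row i′ c} p refl = different e∉ d idle p (cong (row i) (row-unique (both⊆ p) e∈))
      apart {col j′ c} p = unused p (here refl)
      alone : ∀ c → col j c ∉ Es
      alone c p with cover p
      ... | inj₁ (there q) = unused (inj₂ q) (here refl) refl
      ... | inj₂ (inj₁ q) = unused (inj₁ q) (here refl) refl
      ... | inj₂ (inj₂ (_ , q)) = j∉ (used-T _ _ T done todo q)
    step {col j x} {todo} S | no e∉ | yes d =
      Step.serve S d i j x d (inj₁ refl)
        (λ p → i∉ (used-T _ _ T done todo p))
        (λ p → apart-todo p (here refl) refl)
        (λ p → apart (inj₁ p)) (λ p → apart (inj₂ p)) (i , here refl)
      where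
      open State S
      i-fresh = fresh (used proj₁ rows T done todo)
                  (ℕ.≤-<-trans (length-used _ rows T done todo rows≤1) (Step.room S))
      i = proj₁ i-fresh
      i∉ = proj₂ i-fresh
      e∈ = todo⊆ (here refl)
      both⊆ : ∀ {e′} → e′ ∈ done ⊎ e′ ∈ todo → e′ ∈ Es
      both⊆ (inj₁ p) = done⊆ p
      both⊆ (inj₂ p) = todo⊆ (there p)
      unused : ∀ {e′} → e′ ∈ done ⊎ e′ ∈ todo → ∀ {i′} → i′ ∈ rows e′ → i ≢ i′
      unused (inj₁ p) q refl = i∉ (used-done _ rows T done todo p q)
      unused (inj₂ p) q refl = i∉ (used-todo _ rows T done todo p q)
      apart : ∀ {e′} → e′ ∈ done ⊎ e′ ∈ todo → Apart (i , j , x) e′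
      apart {cell i′ j′ c} p =
        (λ { refl → unused p (here refl) , (λ { refl → z-col (both⊆ p) e∈ }) }) ,
        (λ eq → contradiction eq (unused p (here refl))) ,
        (λ eq → contradiction eq (unused p (here refl))) ,
        (λ { refl refl → col-cell e∈ (both⊆ p) })
      apart {row i′ c} p = unused p (here refl)
      apart {col j′ c} p refl = different e∉ d idle p (cong (col j) (col-unique (both⊆ p) e∈))
    step {cell i j .z} {todo} S | no e∉ | yes refl =
      Step.serve S refl i j x (λ eq → x∉ (here eq)) (inj₂ refl)
        (λ p → proj₁ (proj₁ (apart-todo p (here refl)) refl) refl)
        (λ p → proj₂ (proj₁ (apart-todo p (here refl)) refl) refl)
        (λ p → apart (inj₁ p)) (λ p → apart (inj₂ p)) (refl , x , here refl)
      where
      open State S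
      hue : Element n → List (Fin (suc n))
      hue e = colour e ∷ []
      -- Here the free coordinate is the colour. There are `n + 1` colours, which leaves room for
      -- excluding `z` too.
      x-fresh = fresh (z ∷ used (λ t → proj₂ (proj₂ t)) hue T done todo)
                  (s≤s (ℕ.≤-<-trans (length-used _ hue T done todo (λ _ → ℕ.≤-refl)) (Step.room S)))
      x = proj₁ x-fresh
      x∉ = proj₂ x-fresh
      e∈ = todo⊆ (here refl)
      both⊆ : ∀ {e′} → e′ ∈ done ⊎ e′ ∈ todo → e′ ∈ Es
      both⊆ (inj₁ p) = done⊆ p
      both⊆ (inj₂ p) = todo⊆ (there p)
      unused : ∀ {e′} → e′ ∈ done ⊎ e′ ∈ todo → x ≢ colour e′
      unused (inj₁ p) eq = x∉ (there (used-done _ hue T done todo p (here eq)))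
      unused (inj₂ p) eq = x∉ (there (used-todo _ hue T done todo p (here eq)))
      new : ∀ {e′} → e′ ∈ done ⊎ e′ ∈ todo → e′ ≢ cell i j z
      new = different e∉ refl idle
      apart : ∀ {e′} → e′ ∈ done ⊎ e′ ∈ todo → Apart (i , j , x) e′
      apart {cell i′ j′ c} p =
        (λ { refl → (λ { refl → new p (cong (λ t → cell i t z) (z-inrow (both⊆ p) e∈)) })
                  , (λ { refl → new p (cong (λ t → cell t j z) (z-incol (both⊆ p) e∈)) }) }) ,
        (λ { refl refl → new p (cong (cell i j) (z-only e∈ (both⊆ p))) }) ,
        (λ _ → unused p) , (λ _ → unused p)
      apart {row i′ c} p refl = z-row e∈ (both⊆ p)
      apart {col j′ c} p refl = z-col e∈ (both⊆ p)

    run : ∀ todo → State todo → State []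
    run [] S = S
    run (e ∷ todo) S = run todo (step S)

  opaque
    transversal : ∀ Es → Admissible Es → length Es ≤ n → Transversal Es
    transversal Es adm small = record
      { T = T ; T-row = T-row ; T-col = T-col ; T≢z = T≢z ; T-source = T-source
      ; apart = apart ; served = served
      ; count = ℕ.≤-trans (ℕ.m≤m+n _ _) count }
      where
      open Greedy Es adm
      initial : State Es
      initial = record
        { T = [] ; done = [] ; T-row = λ () ; T-col = λ () ; T≢z = λ () ; T-source = λ () ; apart-done = λ () ; apart-todo = λ ()
        ; idle = λ () ; done⊆ = λ () ; todo⊆ = λ p → p ; cover = inj₁ ; size = small ; count = ℕ.≤-refl }
      open State (run Es initial)
      apart : ∀ {t e} → t ∈ T → e ∈ Es → ¬ Demand e → Apart t e
      apart {t} {e} t∈ e∈ ¬d with cover e∈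
      ... | inj₂ (inj₁ p) = apart-done t∈ p
      apart {t} {cell i j c} t∈ e∈ ¬d | inj₂ (inj₂ (c≡z , _)) = contradiction c≡z ¬d
      apart {t} {row i c} t∈ e∈ ¬d | inj₂ (inj₂ (j , p , _)) = contradiction (T≢z p) ¬d
      apart {t} {col j c} t∈ e∈ ¬d | inj₂ (inj₂ (i , p)) = contradiction (T≢z p) ¬d
      served : ∀ {e} → e ∈ Es → Demand e → Served Es T e
      served e∈ d with cover e∈
      ... | inj₂ (inj₁ p) = contradiction d (idle p)
      ... | inj₂ (inj₂ s) = s

module _ {A B C : Set} (f : A → List B) (g : A → List C) (fg≤1 : ∀ x → length (f x) + length (g x) ≤ 1) where

  private
    shuffle : ∀ a b c d → (a + b) + (c + d) ≡ (a + c) + (b + d)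
    shuffle a b c d = trans (ℕ.+-assoc a b _) (trans (cong (a +_) (trans (sym (ℕ.+-assoc b c d))
      (trans (cong (_+ d) (ℕ.+-comm b c)) (ℕ.+-assoc c b d)))) (sym (ℕ.+-assoc a c _)))

    unfold : ∀ x xs → length (concatMap f (x ∷ xs)) + length (concatMap g (x ∷ xs)) ≡
                      (length (f x) + length (g x)) + (length (concatMap f xs) + length (concatMap g xs))
    unfold x xs rewrite length-++ (f x) {concatMap f xs} | length-++ (g x) {concatMap g xs} =
      shuffle (length (f x)) _ (length (g x)) _

  length-split≤ : ∀ xs → length (concatMap f xs) + length (concatMap g xs) ≤ length xs
  length-split≤ [] = z≤n
  length-split≤ (x ∷ xs) = ℕ.≤-trans (ℕ.≤-reflexive (unfold x xs)) (ℕ.+-mono-≤ (fg≤1 x) (length-split≤ xs))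

  length-split< : ∀ {x xs} → x ∈ xs → length (f x) + length (g x) ≡ 0 →
                  length (concatMap f xs) + length (concatMap g xs) < length xs
  length-split< {x} {_ ∷ xs} (here refl) eq rewrite unfold x xs | eq = s≤s (length-split≤ xs)
  length-split< {x} {y ∷ xs} (there p) eq rewrite unfold y xs =
    ℕ.+-mono-≤-< (fg≤1 y) (length-split< p eq)

Satisfies : ∀ {n} → Corona (Fin n) (Fin n) (Fin (suc n)) → Element n → Set
Satisfies K (cell i j c) = Corona.A K i j ≡ c
Satisfies K (row i c)    = Corona.R K i ≡ c
Satisfies K (col j c)    = Corona.C K j ≡ c

-- From exchange cells to a colouring.

module FromTransversal {n : ℕ} (z : Fin (suc n)) {Es : List (Element n)} (tr : Transversal z Es) where
  open Transversal tr

  lower : Cell n (suc n) → List (Cell n n)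
  lower (i , j , x) = triple (just i) (just j) (shrink z x)

  lower⁻ : ∀ {e i j x} → (i , j , x) ∈ lower e → e ≡ (i , j , punchIn z x)
  lower⁻ {i′ , j′ , x′} p with triple⁻ {a = just i′} {just j′} p
  ... | refl , refl , e = cong (λ t → i′ , j′ , t) (shrink-just⁻ e)

  with-T : List (Cell n n) → List (Cell n n)
  with-T base = base ++ concatMap lower T

  length-with-T : ∀ base → length (with-T base) ≤ length base + length (concatMap (demand z) Es)
  length-with-T base rewrite length-++ base {concatMap lower T} = ℕ.+-monoʳ-≤ (length base)
    (ℕ.≤-trans (length-select≤ lower (λ { (i , j , x) → triple≤1 (just i) (just j) (shrink z x) }) T) count)

  with-T⁻ : ∀ {base i j x} → (i , j , x) ∈ with-T base → (i , j , x) ∈ base ⊎ (i , j , punchIn z x) ∈ T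
  with-T⁻ {base} p with ∈.∈-++⁻ base p
  ... | inj₁ q = inj₁ q
  ... | inj₂ q with ∈-select⁻ lower T q
  ...   | e , e∈ , r = inj₂ (subst (_∈ T) (lower⁻ r) e∈)

  with-T⁺ : ∀ {base i j x x′} → (i , j , x) ∈ T → x ≡ punchIn z x′ → (i , j , x′) ∈ with-T base
  with-T⁺ {base} {x′ = x′} p refl = ∈.∈-++⁺ʳ base (∈-select⁺ lower p (triple⁺ refl refl (shrink-punchIn z x′)))

  module _ {base : List (Cell n n)} (consistent : Consistent base)
           (source : ∀ {i j x} → (i , j , x) ∈ base → cell i j (punchIn z x) ∈ Es) where
    private
      module B = Consistent consistent

      apart-base : ∀ {i j x i′ j′ x′} → (i , j , x) ∈ T → (i′ , j′ , x′) ∈ base → Apart z (i , j , x) (cell i′ j′ (punchIn z x′))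
      apart-base p q = apart p (source q) (F.punchInᵢ≢i z _)

    consistent-with-T : Consistent (with-T base)
    consistent-with-T = record { cell = cell′ ; row = row′ ; col = col′ }
      where
      cell′ : ∀ {i j c d} → (i , j , c) ∈ with-T base → (i , j , d) ∈ with-T base → c ≡ d
      cell′ p q with with-T⁻ {base} p | with-T⁻ {base} q
      ... | inj₁ p | inj₁ q = B.cell p q
      ... | inj₁ p | inj₂ q = contradiction refl (proj₁ (proj₂ (apart-base q p)) refl)
      ... | inj₂ p | inj₁ q = contradiction refl (proj₁ (proj₂ (apart-base p q)) refl)
      ... | inj₂ p | inj₂ q = F.punchIn-injective z _ _ (proj₂ (T-row p q))
      row′ : ∀ {i j j′ c} → (i , j , c) ∈ with-T base → (i , j′ , c) ∈ with-T base → j ≡ j′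
      row′ p q with with-T⁻ {base} p | with-T⁻ {base} q
      ... | inj₁ p | inj₁ q = B.row p q
      ... | inj₁ p | inj₂ q = contradiction refl (proj₁ (proj₂ (proj₂ (apart-base q p))) refl)
      ... | inj₂ p | inj₁ q = contradiction refl (proj₁ (proj₂ (proj₂ (apart-base p q))) refl)
      ... | inj₂ p | inj₂ q = proj₁ (T-row p q)
      col′ : ∀ {i i′ j c} → (i , j , c) ∈ with-T base → (i′ , j , c) ∈ with-T base → i ≡ i′
      col′ p q with with-T⁻ {base} p | with-T⁻ {base} q
      ... | inj₁ p | inj₁ q = B.col p q
      ... | inj₁ p | inj₂ q = contradiction refl (proj₂ (proj₂ (proj₂ (apart-base q p))) refl)
      ... | inj₂ p | inj₁ q = contradiction refl (proj₂ (proj₂ (proj₂ (apart-base p q))) refl)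
      ... | inj₂ p | inj₂ q = proj₁ (T-col p q)

  inRow? : ∀ i → Dec (Any (λ t → proj₁ t ≡ i) T)
  inRow? i = Any.any? (λ t → proj₁ t F.≟ i) T

  inCol? : ∀ j → Dec (Any (λ t → proj₁ (proj₂ t) ≡ j) T)
  inCol? j = Any.any? (λ t → proj₁ (proj₂ t) F.≟ j) T

  atCell? : ∀ i j → Dec (Any (λ t → proj₁ t ≡ i × proj₁ (proj₂ t) ≡ j) T)
  atCell? i j = Any.any? (λ t → (proj₁ t F.≟ i) ×-dec (proj₁ (proj₂ t) F.≟ j)) T

  -- These depend on `T` alone. Hence two layers completed by different Latin squares still agree on
  -- the rungs.
  R C : Fin n → Fin (suc n)
  R i with inRow? i
  ... | yes p = proj₂ (proj₂ (proj₁ (find p)))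
  ... | no _  = z
  C j with inCol? j
  ... | yes p = proj₂ (proj₂ (proj₁ (find p)))
  ... | no _  = z

  R-T : ∀ {i j x} → (i , j , x) ∈ T → R i ≡ x
  R-T {i} p with inRow? i
  ... | no none = contradiction (lose p refl) none
  ... | yes q with find q
  ...   | _ , t∈ , refl = proj₂ (T-row t∈ p)

  R-none : ∀ {i} → (∀ {j x} → (i , j , x) ∉ T) → R i ≡ z
  R-none {i} none with inRow? i
  ... | no _ = refl
  ... | yes q with find q
  ...   | _ , t∈ , refl = contradiction t∈ none

  C-T : ∀ {i j x} → (i , j , x) ∈ T → C j ≡ x
  C-T {i} {j} p with inCol? j
  ... | no none = contradiction (lose p refl) none
  ... | yes q with find q
  ...   | _ , t∈ , refl = proj₂ (T-col t∈ p)

  C-none : ∀ {j} → (∀ {i x} → (i , j , x) ∉ T) → C j ≡ z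
  C-none {j} none with inCol? j
  ... | no _ = refl
  ... | yes q with find q
  ...   | _ , t∈ , refl = contradiction t∈ none

  inRow-cases : ∀ i → (∃₂ λ j x → (i , j , x) ∈ T) ⊎ (∀ {j x} → (i , j , x) ∉ T)
  inRow-cases i with inRow? i
  ... | no none = inj₂ λ p → none (lose p refl)
  ... | yes p with find p
  ...   | (_ , j , x) , t∈ , refl = inj₁ (j , x , t∈)

  inCol-cases : ∀ j → (∃₂ λ i x → (i , j , x) ∈ T) ⊎ (∀ {i x} → (i , j , x) ∉ T)
  inCol-cases j with inCol? j
  ... | no none = inj₂ λ p → none (lose p refl)
  ... | yes p with find p
  ...   | (i , _ , x) , t∈ , refl = inj₁ (i , x , t∈)

  R-Es : ∀ {i c} → row i c ∈ Es → R i ≡ c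
  R-Es {i} {c} p with c F.≟ z
  -- A rung of colour `z` keeps its initial colour, because no exchange cell was chosen in its row.
  ... | yes refl = R-none (λ t∈ → apart t∈ p (λ ne → ne refl) refl)
  ... | no ne    = R-T (proj₁ (proj₂ (served p ne)))

  C-Es : ∀ {j c} → col j c ∈ Es → C j ≡ c
  C-Es {j} {c} p with c F.≟ z
  ... | yes refl = C-none (λ t∈ → apart t∈ p (λ ne → ne refl) refl)
  ... | no ne    = C-T (proj₂ (served p ne))

  -- All rungs have colour z at first; each cell of T then exchanges its colour with the rungs
  -- of its row and column.
  module Exchange {base : List (Cell n n)} (source : ∀ {i j x} → (i , j , x) ∈ base → cell i j (punchIn z x) ∈ Es)
                  (completion : Completion (with-T base)) where
    private
      L = proj₁ completion
      module L = Proper (proj₁ (proj₂ completion))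

      L-T : ∀ {i j x} → (i , j , x) ∈ T → punchIn z (L i j) ≡ x
      L-T p with shrink-just⁺ (T≢z p)
      ... | x′ , e = trans (cong (punchIn z) (proj₂ (proj₂ completion) (with-T⁺ {base} p (shrink-just⁻ e)))) (sym (shrink-just⁻ e))

      new-inj : ∀ {x y} → punchIn z x ≡ punchIn z y → x ≡ y
      new-inj = F.punchIn-injective z _ _

      new≢z : ∀ {x} → punchIn z x ≢ z
      new≢z = F.punchInᵢ≢i z _

    A : Fin n → Fin n → Fin (suc n)
    A i j with atCell? i j
    ... | yes _ = z
    ... | no _  = punchIn z (L i j)

    private
      data View (i j : Fin n) : Fin (suc n) → Set where
        on  : ∀ x → (i , j , x) ∈ T → View i j z
        off : (∀ {x} → (i , j , x) ∉ T) → View i j (punchIn z (L i j))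

      view : ∀ i j → View i j (A i j)
      view i j with atCell? i j
      ... | no none = off (λ p → none (lose p (refl , refl)))
      ... | yes p with find p
      ...   | (_ , _ , x) , t∈ , refl , refl = on x t∈

    A-T : ∀ {i j x} → (i , j , x) ∈ T → A i j ≡ z
    A-T {i} {j} p with A i j | view i j
    ... | _ | on _ _ = refl
    ... | _ | off none = contradiction p none

    A-base : ∀ {i j x} → (i , j , x) ∈ base → A i j ≡ punchIn z x
    A-base {i} {j} p with A i j | view i j
    ... | _ | on x t∈ = contradiction refl (proj₁ (proj₂ (apart t∈ (source p) (F.punchInᵢ≢i z _))) refl)
    ... | _ | off _ = cong (punchIn z) (proj₂ (proj₂ completion) (∈.∈-++⁺ˡ p))

    private
      A-row : ∀ {i j j′} → A i j ≡ A i j′ → j ≡ j′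
      A-row {i} {j} {j′} eq with A i j | view i j | A i j′ | view i j′
      ... | _ | on _ p | _ | on _ q = proj₁ (T-row p q)
      ... | _ | on _ _ | _ | off _ = contradiction (sym eq) new≢z
      ... | _ | off _ | _ | on _ _ = contradiction eq new≢z
      ... | _ | off _ | _ | off _ = L.row (new-inj eq)

      A-col : ∀ {i i′ j} → A i j ≡ A i′ j → i ≡ i′
      A-col {i} {i′} {j} eq with A i j | view i j | A i′ j | view i′ j
      ... | _ | on _ p | _ | on _ q = proj₁ (T-col p q)
      ... | _ | on _ _ | _ | off _ = contradiction (sym eq) new≢z
      ... | _ | off _ | _ | on _ _ = contradiction eq new≢z
      ... | _ | off _ | _ | off _ = L.col (new-inj eq)

      A≢R : ∀ {i j} → A i j ≢ R i
      A≢R {i} {j} eq with A i j | view i j | inRow-cases i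
      ... | _ | on x p | _ = T≢z p (trans (sym (R-T p)) (sym eq))
      ... | _ | off none | inj₂ ¬row = new≢z (trans eq (R-none ¬row))
      -- The square has `x` only once in row `i`, on the exchange cell, where `z` has replaced it.
      ... | _ | off none | inj₁ (j′ , x , t∈) with L.row (new-inj (trans (L-T t∈) (trans (sym (R-T t∈)) (sym eq))))
      ...   | refl = none t∈

      A≢C : ∀ {i j} → A i j ≢ C j
      A≢C {i} {j} eq with A i j | view i j | inCol-cases j
      ... | _ | on x p | _ = T≢z p (trans (sym (C-T p)) (sym eq))
      ... | _ | off none | inj₂ ¬col = new≢z (trans eq (C-none ¬col))
      ... | _ | off none | inj₁ (i′ , x , t∈) with L.col (new-inj (trans (L-T t∈) (trans (sym (C-T t∈)) (sym eq))))
      ...   | refl = none t∈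

    corona : Corona (Fin n) (Fin n) (Fin (suc n))
    corona = record { A = A ; R = R ; C = C ; row = λ {i} → A-row {i} ; col = A-col ; A≢R = A≢R ; A≢C = A≢C }

-- Colourings of one layer

record Coherent {n} (Es : List (Element n)) : Set where
  field
    row-unique  : ∀ {i c d} → row i c ∈ Es → row i d ∈ Es → c ≡ d
    col-unique  : ∀ {j c d} → col j c ∈ Es → col j d ∈ Es → c ≡ d
    row-cell    : ∀ {i j c} → row i c ∈ Es → cell i j c ∈ Es → ⊥
    col-cell    : ∀ {i j c} → col j c ∈ Es → cell i j c ∈ Es → ⊥
    cell-unique : ∀ {i j c d} → cell i j c ∈ Es → cell i j d ∈ Es → c ≡ d
    cell-row    : ∀ {i j j′ c} → cell i j c ∈ Es → cell i j′ c ∈ Es → j ≡ j′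
    cell-col    : ∀ {i i′ j c} → cell i j c ∈ Es → cell i′ j c ∈ Es → i ≡ i′

Solution : ∀ {n} → List (Element n) → Set
Solution {n} Es = Σ (Corona (Fin n) (Fin n) (Fin (suc n))) λ K → ∀ {e} → e ∈ Es → Satisfies K e

Rung : ∀ {n} → Element n → Set
Rung (cell _ _ _) = ⊥
Rung (row _ _)    = ⊤
Rung (col _ _)    = ⊤

rung? : ∀ {n} (e : Element n) → Dec (Rung e)
rung? (cell _ _ _) = no λ ()
rung? (row _ _)    = yes tt
rung? (col _ _)    = yes tt

Touches : ∀ {n} → Element n → Element n → Set
Touches (cell i j _) (row i′ _) = i ≡ i′
Touches (cell i j _) (col j′ _) = j ≡ j′
Touches _            _          = ⊥

touches? : ∀ {n} (e e′ : Element n) → Dec (Touches e e′)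
touches? (cell i j _) (row i′ _)   = i F.≟ i′
touches? (cell i j _) (col j′ _)   = j F.≟ j′
touches? (cell _ _ _) (cell _ _ _) = no λ ()
touches? (row _ _)    _            = no λ ()
touches? (col _ _)    _            = no λ ()

-- A prescribed cell obtains colour `z` through an exchange, which recolours both of its rungs. It
-- must therefore not meet a precoloured rung.
Clash : ∀ {n} → Fin (suc n) → List (Element n) → Set
Clash z Es = Any (λ e → colour e ≡ z × Any (Touches e) Es) Es

clash? : ∀ {n} z (Es : List (Element n)) → Dec (Clash z Es)
clash? z Es = Any.any? (λ e → (colour e F.≟ z) ×-dec Any.any? (touches? e) Es) Es

lower-cell : ∀ {n} → Fin (suc n) → Element n → List (Cell n n)
lower-cell z (cell i j c) = triple (just i) (just j) (shrink z c)
lower-cell z (row _ _)    = []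
lower-cell z (col _ _)    = []

lower-cell⁻ : ∀ {n} {z : Fin (suc n)} {Es i j x} → (i , j , x) ∈ concatMap (lower-cell z) Es → cell i j (punchIn z x) ∈ Es
lower-cell⁻ {z = z} {Es} p with ∈-select⁻ (lower-cell z) Es p
... | cell i′ j′ c′ , e∈ , q with triple⁻ {a = just i′} {just j′} q
...   | refl , refl , e = subst (λ t → cell i′ j′ t ∈ Es) (shrink-just⁻ e) e∈

lower-cell⁺ : ∀ {n} {z : Fin (suc n)} {Es i j c x} → cell i j c ∈ Es → c ≡ punchIn z x → (i , j , x) ∈ concatMap (lower-cell z) Es
lower-cell⁺ {z = z} {x = x} p refl = ∈-select⁺ (lower-cell z) p (triple⁺ refl refl (shrink-punchIn z x))

-- A cell of colour `z` counts as a demand only, since `shrink z` deletes it from the prescribed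
-- cells. So no element is charged twice.
lower-demand≤1 : ∀ {n} z (e : Element n) → length (lower-cell z e) + length (demand z e) ≤ 1
lower-demand≤1 z e@(cell i j c) with demand? z e
... | yes refl = ℕ.≤-reflexive (cong (λ l → length l + 1) (triple-nothing (shrink-self z)))
... | no _     = ℕ.≤-trans (ℕ.≤-reflexive (ℕ.+-identityʳ _)) (triple≤1 (just i) (just j) (shrink z c))
lower-demand≤1 z e@(row _ _) with demand? z e
... | yes _ = ℕ.≤-refl
... | no _  = z≤n
lower-demand≤1 z e@(col _ _) with demand? z e
... | yes _ = ℕ.≤-refl
... | no _  = z≤n

module _ {n} {Es : List (Element n)} (coherent : Coherent Es) where
  open Coherent coherent

  consistent-lower : ∀ z → Consistent (concatMap (lower-cell z) Es)
  consistent-lower z = record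
    { cell = λ p q → F.punchIn-injective z _ _ (cell-unique (lower-cell⁻ p) (lower-cell⁻ q))
    ; row = λ p q → cell-row (lower-cell⁻ p) (lower-cell⁻ q)
    ; col = λ p q → cell-col (lower-cell⁻ p) (lower-cell⁻ q) }

  admissible : ∀ {z} → ¬ Clash z Es → Admissible z Es
  admissible ¬clash = record
    { row-unique = row-unique ; col-unique = col-unique ; row-cell = row-cell ; col-cell = col-cell
    ; z-row = λ p q → ¬clash (lose p (refl , lose q refl))
    ; z-col = λ p q → ¬clash (lose p (refl , lose q refl))
    ; z-inrow = cell-row ; z-incol = cell-col ; z-only = λ p q → cell-unique q p }

  exchange-solution : ∀ {z} (tr : Transversal z Es) →
                      Completion (FromTransversal.with-T z tr (concatMap (lower-cell z) Es)) → Solution Es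
  exchange-solution {z} tr completion = X.corona , satisfies
    where
    open FromTransversal z tr
    open Transversal tr
    module X = Exchange (lower-cell⁻ {z = z} {Es}) completion
    satisfies : ∀ {e} → e ∈ Es → Satisfies X.corona e
    satisfies {row i c} p = R-Es p
    satisfies {col j c} p = C-Es p
    satisfies {cell i j c} p with c F.≟ z
    ... | yes refl = X.A-T (proj₂ (proj₂ (served p refl)))
    ... | no ne with shrink-just⁺ ne
    ...   | x , e = trans (X.A-base (lower-cell⁺ p (shrink-just⁻ e))) (sym (shrink-just⁻ e))

  -- With the colour of `e` as base colour, `e` itself needs neither a prescribed cell nor an
  -- exchange. At most `n - 1` cells remain, which is what Evans' conjecture admits.
  harmless-rung : length Es ≤ n → ∀ {e} → e ∈ Es → Rung e → ¬ Clash (colour e) Es → Solution Es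
  harmless-rung small {e} e∈ isRung ¬clash = exchange-solution tr (evans n _
    (consistent-with-T (consistent-lower z) lower-cell⁻)
    (ℕ.≤-<-trans (length-with-T (concatMap (lower-cell z) Es)) (ℕ.<-≤-trans (length-split< (lower-cell z) (demand z) (lower-demand≤1 z) e∈ (zero-weight e isRung refl)) small)))
    where
    z = colour e
    tr = transversal z Es (admissible ¬clash) small
    open FromTransversal z tr
    zero-weight : ∀ e → Rung e → colour e ≡ z → length (lower-cell z e) + length (demand z e) ≡ 0
    zero-weight e@(row _ _) _ eq with demand? z e
    ... | yes d = contradiction eq d
    ... | no _ = refl
    zero-weight e@(col _ _) _ eq with demand? z e
    ... | yes d = contradiction eq d
    ... | no _ = refl

  module _ (small : length Es ≤ n) {z : Fin (suc n)} (unused : ∀ {e} → e ∈ Es → colour e ≢ z)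
           (repeated : ∀ {e} → e ∈ Es → ∃ λ e′ → e′ ∈ Es × colour e′ ≡ colour e × e′ ≢ e) where
    private
      ¬clash : ¬ Clash z Es
      ¬clash clash with find clash
      ... | _ , e∈ , eq , _ = unused e∈ eq

      tr = transversal z Es (admissible ¬clash) small
      open Transversal tr
      open FromTransversal z tr
      base = concatMap (lower-cell z) Es

      data Placed : Element n → Fin n → Fin n → Set where
        cell : ∀ {i j c} → Placed (cell i j c) i j
        row  : ∀ {i j c} → (i , j , c) ∈ T → (∀ d → col j d ∉ Es) → Placed (row i c) i j
        col  : ∀ {i j c} → (i , j , c) ∈ T → Placed (col j c) i j

      placed : ∀ {e} → e ∈ Es → ∃₂ (Placed e)
      placed {cell i j c} p = i , j , cell
      placed {row i c} p = let j , q , alone = served p (unused p) in i , j , row q alone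
      placed {col j c} p = let i , q = served p (unused p) in i , j , col q

      placed∈ : ∀ {e i j x} → e ∈ Es → Placed e i j → colour e ≡ punchIn z x → (i , j , x) ∈ with-T base
      placed∈ p cell ec = ∈.∈-++⁺ˡ (lower-cell⁺ p ec)
      placed∈ p (row q _) ec = with-T⁺ {base} q ec
      placed∈ p (col q) ec = with-T⁺ {base} q ec

      off-colour : ∀ {i j c} → cell i j c ∈ Es → ∀ {j′} → (i , j′ , c) ∉ T
      off-colour p q = proj₁ (proj₂ (proj₂ (apart q p (unused p)))) refl refl

      -- Two elements of one colour must not be represented by one cell. The danger is a row rung
      -- and a column rung at the two ends of the same exchange cell, and `alone` excludes it.
      rows-differ : ∀ {e e′ i i′ j j′} → e ∈ Es → e′ ∈ Es → Placed e i j → Placed e′ i′ j′ → colour e ≡ colour e′ → e ≢ e′ → i ≢ i′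
      rows-differ p q cell cell refl ne refl = ne (cong (λ t → cell _ t _) (cell-row p q))
      rows-differ p q cell (row r _) refl ne refl = off-colour p r
      rows-differ p q cell (col r) refl ne refl = off-colour p r
      rows-differ p q (row r _) cell refl ne refl = off-colour q r
      rows-differ p q (row r _) (row s _) refl ne refl = ne refl
      rows-differ p q (row r alone) (col s) refl ne refl with refl , _ ← T-row r s = alone _ q
      rows-differ p q (col r) cell refl ne refl = off-colour q r
      rows-differ p q (col r) (row s alone) refl ne refl with refl , _ ← T-row r s = alone _ p
      rows-differ p q (col r) (col s) refl ne refl with refl , _ ← T-row r s = ne refl

      coloured : ∀ {i j x} → (i , j , x) ∈ with-T base → ∃ λ e → e ∈ Es × colour e ≡ punchIn z x
      coloured p with with-T⁻ {base} p
      ... | inj₁ q = _ , lower-cell⁻ q , refl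
      ... | inj₂ q with T-source q
      ...   | e , e∈ , inj₁ eq = e , e∈ , eq
      -- Only cells of colour `z` are served by a colour foreign to the precoloring, and there are
      -- none.
      ...   | e , e∈ , inj₂ eq = contradiction eq (unused e∈)

      repeated-with-T : Repeated (with-T base)
      repeated-with-T {i} {j} {x} p with coloured p
      ... | e , e∈ , ec with repeated e∈
      ...   | e′ , e′∈ , same , e′≢e with placed e∈ | placed e′∈
      ...     | i₁ , j₁ , P₁ | i₂ , j₂ , P₂ with i₁ F.≟ i
      ...       | no i₁≢i = i₁ , j₁ , placed∈ e∈ P₁ ec , i₁≢i
      ...       | yes refl = i₂ , j₂ , placed∈ e′∈ P₂ (trans same ec) , rows-differ e′∈ e∈ P₂ P₁ same e′≢e

    -- Each element may cost a cell, so Evans' bound can be missed by one. But repetitions of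
    -- elements become repetitions of cells, and for these `n` cells are allowed.
    all-repeated : Solution Es
    all-repeated = exchange-solution tr (repeated-completion _ (consistent-with-T (consistent-lower z) lower-cell⁻) repeated-with-T
      (ℕ.≤-trans (length-with-T (concatMap (lower-cell z) Es)) (ℕ.≤-trans (length-split≤ (lower-cell z) (demand z) (lower-demand≤1 z) Es) small)))

  module _ (small : length Es ≤ n) (no-rung : ¬ Any Rung Es) where
    private
      up : Element n → List (Cell (suc n) (suc n))
      up (cell i j c) = (inject₁ i , inject₁ j , c) ∷ []
      up (row _ _)    = []
      up (col _ _)    = []

      up≤1 : ∀ e → length (up e) ≤ 1
      up≤1 (cell _ _ _) = ℕ.≤-refl
      up≤1 (row _ _)    = z≤n
      up≤1 (col _ _)    = z≤n

      up⁻ : ∀ {i j c} → (i , j , c) ∈ concatMap up Es → ∃₂ λ i₀ j₀ → inject₁ i₀ ≡ i × inject₁ j₀ ≡ j × cell i₀ j₀ c ∈ Es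
      up⁻ p with ∈-select⁻ up Es p
      ... | cell i j c , e∈ , here refl = i , j , refl , refl , e∈

      consistent-up : Consistent (concatMap up Es)
      consistent-up = record { cell = cell′ ; row = row′ ; col = col′ }
        where
        cell′ : ∀ {i j c d} → (i , j , c) ∈ concatMap up Es → (i , j , d) ∈ concatMap up Es → c ≡ d
        cell′ p q with up⁻ p | up⁻ q
        ... | _ , _ , refl , refl , p | _ , _ , ei , ej , q
          with refl ← F.inject₁-injective ei with refl ← F.inject₁-injective ej = cell-unique p q
        row′ : ∀ {i j j′ c} → (i , j , c) ∈ concatMap up Es → (i , j′ , c) ∈ concatMap up Es → j ≡ j′
        row′ p q with up⁻ p | up⁻ q
        ... | _ , _ , refl , refl , p | _ , _ , ei , refl , q
          with refl ← F.inject₁-injective ei = cong inject₁ (cell-row p q)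
        col′ : ∀ {i i′ j c} → (i , j , c) ∈ concatMap up Es → (i′ , j , c) ∈ concatMap up Es → i ≡ i′
        col′ p q with up⁻ p | up⁻ q
        ... | _ , _ , refl , refl , p | _ , _ , refl , ej , q
          with refl ← F.inject₁-injective ej = cong inject₁ (cell-col p q)

      completion = evans (suc n) (concatMap up Es) consistent-up (s≤s (ℕ.≤-trans (length-select≤ up up≤1 Es) small))
      L = proj₁ completion
      module L = Proper (proj₁ (proj₂ completion))

    -- In a square of order `n + 1` the last column and the last row supply a colour missing at each
    -- vertex.
    cells-only : Solution Es
    cells-only = record
      { A = λ i j → L (inject₁ i) (inject₁ j) ; R = λ i → L (inject₁ i) (fromℕ n) ; C = λ j → L (fromℕ n) (inject₁ j)
      ; row = λ e → F.inject₁-injective (L.row e) ; col = λ e → F.inject₁-injective (L.col e)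
      ; A≢R = λ e → F.fromℕ≢inject₁ (sym (L.row e)) ; A≢C = λ e → F.fromℕ≢inject₁ (sym (L.col e)) } , satisfies
      where
      satisfies : ∀ {e} → e ∈ Es → Satisfies _ e
      satisfies {cell i j c} p = proj₂ (proj₂ completion) (∈-select⁺ up p (here refl))
      satisfies {row i c} p = contradiction (lose p tt) no-rung
      satisfies {col j c} p = contradiction (lose p tt) no-rung

-- Deleting a colour that occurs once.

transport : ∀ {m n} → (Fin n → Maybe (Fin m)) → (Fin n → Maybe (Fin m)) → (Fin (suc n) → Maybe (Fin (suc m))) →
            Element n → List (Element m)
transport fr fc fu (cell i j c) = map (λ t → cell (proj₁ t) (proj₁ (proj₂ t)) (proj₂ (proj₂ t))) (triple (fr i) (fc j) (fu c))
transport fr fc fu (row i c)    = map (λ t → row (proj₁ t) (proj₂ t)) (pair (fr i) (fu c))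
transport fr fc fu (col j c)    = map (λ t → col (proj₁ t) (proj₂ t)) (pair (fc j) (fu c))

module _ {m n} {fr fc : Fin n → Maybe (Fin m)} {fu : Fin (suc n) → Maybe (Fin (suc m))} where

  transport≤1 : ∀ e → length (transport fr fc fu e) ≤ 1
  transport≤1 (cell i j c) = ℕ.≤-trans (ℕ.≤-reflexive (length-map _ (triple (fr i) (fc j) (fu c)))) (triple≤1 (fr i) (fc j) (fu c))
  transport≤1 (row i c)    = ℕ.≤-trans (ℕ.≤-reflexive (length-map _ (pair (fr i) (fu c)))) (pair≤1 (fr i) (fu c))
  transport≤1 (col j c)    = ℕ.≤-trans (ℕ.≤-reflexive (length-map _ (pair (fc j) (fu c)))) (pair≤1 (fc j) (fu c))

  module _ {Es : List (Element n)} where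

    transport-cell⁻ : ∀ {x y d} → cell x y d ∈ concatMap (transport fr fc fu) Es →
                      ∃ λ i → ∃ λ j → ∃ λ c → cell i j c ∈ Es × fr i ≡ just x × fc j ≡ just y × fu c ≡ just d
    transport-cell⁻ p with ∈-select⁻ (transport fr fc fu) Es p
    ... | cell i j c , e∈ , q with ∈.∈-map⁻ _ q
    ...   | _ , r , refl = i , j , c , e∈ , triple⁻ {a = fr i} {fc j} {fu c} r
    transport-cell⁻ p | row i c , e∈ , q with ∈.∈-map⁻ _ q
    ... | _ , _ , ()
    transport-cell⁻ p | col j c , e∈ , q with ∈.∈-map⁻ _ q
    ... | _ , _ , ()

    transport-row⁻ : ∀ {x d} → row x d ∈ concatMap (transport fr fc fu) Es →
                     ∃₂ λ i c → row i c ∈ Es × fr i ≡ just x × fu c ≡ just d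
    transport-row⁻ p with ∈-select⁻ (transport fr fc fu) Es p
    ... | row i c , e∈ , q with ∈.∈-map⁻ _ q
    ...   | _ , r , refl = i , c , e∈ , pair⁻ {a = fr i} {fu c} r
    transport-row⁻ p | cell i j c , e∈ , q with ∈.∈-map⁻ _ q
    ... | _ , _ , ()
    transport-row⁻ p | col j c , e∈ , q with ∈.∈-map⁻ _ q
    ... | _ , _ , ()

    transport-col⁻ : ∀ {y d} → col y d ∈ concatMap (transport fr fc fu) Es →
                     ∃₂ λ j c → col j c ∈ Es × fc j ≡ just y × fu c ≡ just d
    transport-col⁻ p with ∈-select⁻ (transport fr fc fu) Es p
    ... | col j c , e∈ , q with ∈.∈-map⁻ _ q
    ...   | _ , r , refl = j , c , e∈ , pair⁻ {a = fc j} {fu c} r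
    transport-col⁻ p | cell i j c , e∈ , q with ∈.∈-map⁻ _ q
    ... | _ , _ , ()
    transport-col⁻ p | row i c , e∈ , q with ∈.∈-map⁻ _ q
    ... | _ , _ , ()

    transport-cell⁺ : ∀ {i j c x y d} → cell i j c ∈ Es → fr i ≡ just x → fc j ≡ just y → fu c ≡ just d →
                      cell x y d ∈ concatMap (transport fr fc fu) Es
    transport-cell⁺ p ei ej ec = ∈-select⁺ (transport fr fc fu) p (∈.∈-map⁺ _ (triple⁺ ei ej ec))

    transport-row⁺ : ∀ {i c x d} → row i c ∈ Es → fr i ≡ just x → fu c ≡ just d → row x d ∈ concatMap (transport fr fc fu) Es
    transport-row⁺ p ei ec = ∈-select⁺ (transport fr fc fu) p (∈.∈-map⁺ _ (pair⁺ ei ec))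

    transport-col⁺ : ∀ {j c y d} → col j c ∈ Es → fc j ≡ just y → fu c ≡ just d → col y d ∈ concatMap (transport fr fc fu) Es
    transport-col⁺ p ej ec = ∈-select⁺ (transport fr fc fu) p (∈.∈-map⁺ _ (pair⁺ ej ec))

    module _ (fr-inj : ∀ {x y} → fr x ≡ fr y → x ≡ y) (fc-inj : ∀ {x y} → fc x ≡ fc y → x ≡ y)
             (fu-inj : ∀ {x y} → fu x ≡ fu y → x ≡ y) (coherent : Coherent Es) where
      open Coherent coherent
      private
        Es′ = concatMap (transport fr fc fu) Es

        join : ∀ {A B : Set} {f : A → Maybe B} {x y : A} {z : B} → (f x ≡ f y → x ≡ y) → f x ≡ just z → f y ≡ just z → x ≡ y
        join inj p q = inj (trans p (sym q))

        meet : ∀ {A B : Set} {f : A → Maybe B} {x : A} {y z : B} → f x ≡ just y → f x ≡ just z → y ≡ z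
        meet p q = just-injective (trans (sym p) q)

      coherent-transport : Coherent Es′
      coherent-transport = record
        { row-unique = row-unique′ ; col-unique = col-unique′ ; row-cell = row-cell′ ; col-cell = col-cell′
        ; cell-unique = cell-unique′ ; cell-row = cell-row′ ; cell-col = cell-col′ }
        where
        row-unique′ : ∀ {i c d} → row i c ∈ Es′ → row i d ∈ Es′ → c ≡ d
        row-unique′ p q with transport-row⁻ p | transport-row⁻ q
        ... | _ , _ , p , ei , ec | _ , _ , q , ei′ , ec′
          with refl ← join {f = fr} fr-inj ei ei′ with refl ← row-unique p q = meet {f = fu} ec ec′
        col-unique′ : ∀ {j c d} → col j c ∈ Es′ → col j d ∈ Es′ → c ≡ d
        col-unique′ p q with transport-col⁻ p | transport-col⁻ q
        ... | _ , _ , p , ei , ec | _ , _ , q , ei′ , ec′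
          with refl ← join {f = fc} fc-inj ei ei′ with refl ← col-unique p q = meet {f = fu} ec ec′
        row-cell′ : ∀ {i j c} → row i c ∈ Es′ → cell i j c ∈ Es′ → ⊥
        row-cell′ p q with transport-row⁻ p | transport-cell⁻ q
        ... | _ , _ , p , ei , ec | _ , _ , _ , q , ei′ , _ , ec′
          with refl ← join {f = fr} fr-inj ei ei′ with refl ← join {f = fu} fu-inj ec ec′ = row-cell p q
        col-cell′ : ∀ {i j c} → col j c ∈ Es′ → cell i j c ∈ Es′ → ⊥
        col-cell′ p q with transport-col⁻ p | transport-cell⁻ q
        ... | _ , _ , p , ej , ec | _ , _ , _ , q , _ , ej′ , ec′
          with refl ← join {f = fc} fc-inj ej ej′ with refl ← join {f = fu} fu-inj ec ec′ = col-cell p q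
        cell-unique′ : ∀ {i j c d} → cell i j c ∈ Es′ → cell i j d ∈ Es′ → c ≡ d
        cell-unique′ p q with transport-cell⁻ p | transport-cell⁻ q
        ... | _ , _ , _ , p , ei , ej , ec | _ , _ , _ , q , ei′ , ej′ , ec′
          with refl ← join {f = fr} fr-inj ei ei′ with refl ← join {f = fc} fc-inj ej ej′
          with refl ← cell-unique p q = meet {f = fu} ec ec′
        cell-row′ : ∀ {i j j′ c} → cell i j c ∈ Es′ → cell i j′ c ∈ Es′ → j ≡ j′
        cell-row′ p q with transport-cell⁻ p | transport-cell⁻ q
        ... | _ , _ , _ , p , ei , ej , ec | _ , _ , _ , q , ei′ , ej′ , ec′
          with refl ← join {f = fr} fr-inj ei ei′ with refl ← join {f = fu} fu-inj ec ec′
          with refl ← cell-row p q = meet {f = fc} ej ej′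
        cell-col′ : ∀ {i i′ j c} → cell i j c ∈ Es′ → cell i′ j c ∈ Es′ → i ≡ i′
        cell-col′ p q with transport-cell⁻ p | transport-cell⁻ q
        ... | _ , _ , _ , p , ei , ej , ec | _ , _ , _ , q , ei′ , ej′ , ec′
          with refl ← join {f = fc} fc-inj ej ej′ with refl ← join {f = fu} fu-inj ec ec′
          with refl ← cell-col p q = meet {f = fr} ei ei′

opaque
  -- Each element meets at most one line and `e₂` meets none beyond those of `e₁`, so the elements
  -- meet at most `n - 1` lines.
  unused-line : ∀ {n} (h : Element n → List (Fin n)) → (∀ e → length (h e) ≤ 1) → ∀ {Es} → length Es ≤ n →
                ∀ {e₁ e₂} → e₁ ∈ Es → e₂ ∈ Es → e₁ ≢ e₂ → (∀ {x} → x ∈ h e₂ → x ∈ h e₁) →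
                ∃ λ x → ∀ {e} → e ∈ Es → x ∉ h e
  unused-line {n} h h≤1 {Es} small {e₁} {e₂} e₁∈ e₂∈ e₁≢e₂ covered = x , missed
    where
    h′ : Element n → List (Fin n)
    h′ e with e ≟ᴱ e₂
    ... | yes _ = []
    ... | no _  = h e
    h′≤1 : ∀ e → length (h′ e) ≤ 1
    h′≤1 e with e ≟ᴱ e₂
    ... | yes _ = z≤n
    ... | no _  = h≤1 e
    h′-e₂ : ∀ {e} → e ≡ e₂ → h′ e ≡ []
    h′-e₂ {e} eq with e ≟ᴱ e₂
    ... | yes _ = refl
    ... | no ne = contradiction eq ne
    h′-other : ∀ {e} → e ≢ e₂ → h′ e ≡ h e
    h′-other {e} ne with e ≟ᴱ e₂
    ... | yes eq = contradiction eq ne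
    ... | no _   = refl
    x-fresh : ∃ λ x → x ∉ concatMap h′ Es
    x-fresh = fresh (concatMap h′ Es) (ℕ.<-≤-trans (length-select< h′ h′≤1 e₂∈ (h′-e₂ refl)) small)
    x : Fin n
    x = proj₁ x-fresh
    missed-other : ∀ {e} → e ∈ Es → e ≢ e₂ → x ∉ h e
    missed-other e∈ ne x∈ = proj₂ x-fresh (∈-select⁺ h′ e∈ (subst (x ∈_) (sym (h′-other ne)) x∈))
    missed : ∀ {e} → e ∈ Es → x ∉ h e
    missed {e} e∈ with e ≟ᴱ e₂
    ... | yes refl = λ x∈ → missed-other e₁∈ e₁≢e₂ (covered x∈)
    ... | no ne    = missed-other e∈ ne

touches-≢ : ∀ {n} {e₁ e₂ : Element n} → Touches e₁ e₂ → e₁ ≢ e₂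
touches-≢ {e₁ = cell _ _ _} () refl

touches-rung : ∀ {n} {e₁ e₂ : Element n} → Touches e₁ e₂ → Rung e₂
touches-rung {e₁ = cell _ _ _} {row _ _} _ = tt
touches-rung {e₁ = cell _ _ _} {col _ _} _ = tt

touches-rows : ∀ {n} {e₁ e₂ : Element n} → Touches e₁ e₂ → ∀ {x} → x ∈ rows e₂ → x ∈ rows e₁
touches-rows {e₁ = cell _ _ _} {row _ _} refl p = p

touches-columns : ∀ {n} {e₁ e₂ : Element n} → Touches e₁ e₂ → ∀ {x} → x ∈ columns e₂ → x ∈ columns e₁
touches-columns {e₁ = cell _ _ _} {col _ _} refl p = p

positions : ∀ {n} → Element n → List (Fin n × Fin n)
positions (cell i j _) = (i , j) ∷ []
positions (row _ _)    = []
positions (col _ _)    = []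

positions≤1 : ∀ {n} (e : Element n) → length (positions e) ≤ 1
positions≤1 (cell _ _ _) = ℕ.≤-refl
positions≤1 (row _ _)    = z≤n
positions≤1 (col _ _)    = z≤n

-- The rung `e₂` meets only lines that its cell `e₁` meets already, which frees a row and a column
-- for deletion. After the deletion of the cell of colour `u` at most `m` elements are left, and two
-- of them, from `e₂` and `e₃`, are not cells. This gives the 2 that `arrange` requires.
module SingleCell {m} (smaller : ∀ (Es : List (Element m)) → Coherent Es → length Es ≤ m → Solution Es)
  {Es : List (Element (suc m))} (coherent : Coherent Es) (small : length Es ≤ suc m)
  {r c u} (e₀∈ : cell r c u ∈ Es) (single : ∀ {e} → e ∈ Es → colour e ≡ u → e ≡ cell r c u)
  {e₁ e₂ e₃} (e₁∈ : e₁ ∈ Es) (e₂∈ : e₂ ∈ Es) (e₃∈ : e₃ ∈ Es)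
  (touches : Touches e₁ e₂) (rung₃ : Rung e₃) (e₂≢e₃ : e₂ ≢ e₃) where
  open Coherent coherent

  private
    free-row = unused-line rows rows≤1 small e₁∈ e₂∈ (touches-≢ touches) (touches-rows touches)
    free-col = unused-line columns columns≤1 small e₁∈ e₂∈ (touches-≢ touches) (touches-columns touches)
    r₁ = proj₁ free-row
    c₁ = proj₁ free-col

    shrink-row : ∀ {e} → e ∈ Es → ∀ {i} → i ∈ rows e → ∃ λ x → shrink r₁ i ≡ just x
    shrink-row e∈ i∈ = shrink-just⁺ λ { refl → proj₂ free-row e∈ i∈ }

    shrink-col : ∀ {e} → e ∈ Es → ∀ {j} → j ∈ columns e → ∃ λ x → shrink c₁ j ≡ just x
    shrink-col e∈ j∈ = shrink-just⁺ λ { refl → proj₂ free-col e∈ j∈ }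

    rung-colour : ∀ {e} → e ∈ Es → Rung e → ∃ λ x → shrink u (colour e) ≡ just x
    rung-colour {e} e∈ isRung = shrink-just⁺ λ eq → subst Rung (single e∈ eq) isRung

    r′ = proj₁ (shrink-row e₀∈ (here refl))
    r′-spec = proj₂ (shrink-row e₀∈ (here refl))
    c′ = proj₁ (shrink-col e₀∈ (here refl))
    c′-spec = proj₂ (shrink-col e₀∈ (here refl))

    module _ (fr fc : Fin (suc m) → Maybe (Fin m)) where
      length-transport : length (concatMap (transport fr fc (shrink u)) Es) ≤ m
      length-transport = ℕ.≤-pred (ℕ.<-≤-trans (length-select< (transport fr fc (shrink u)) transport≤1 e₀∈
        (cong (map _) (triple-nothing {a = fr r} {fc c} (shrink-self u)))) small)

    -- A provisional image without permutations, needed to state what `arrange` has to move. The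
    -- induction hypothesis is applied to the image under `fr` and `fc`, which include `ρ` and `κ`.
    Es₀ = concatMap (transport (shrink r₁) (shrink c₁) (shrink u)) Es

    rung-images : ∀ {e e′} → e ∈ Es → e′ ∈ Es → Rung e → Rung e′ → e ≢ e′ →
                  ∃₂ λ x y → x ∈ Es₀ × y ∈ Es₀ × x ≢ y × positions x ≡ [] × positions y ≡ []
    rung-images {row i d} {row i′ d′} p q _ _ ne
      with x , ex ← shrink-row p (here refl) | y , ey ← rung-colour p tt
         | x′ , ex′ ← shrink-row q (here refl) | y′ , ey′ ← rung-colour q tt =
      row x y , row x′ y′ , transport-row⁺ p ex ey , transport-row⁺ q ex′ ey′ ,
      (λ { refl → ne (cong₂ row (shrink-injective (trans ex (sym ex′))) (shrink-injective (trans ey (sym ey′)))) }) , refl , refl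
    rung-images {col i d} {col i′ d′} p q _ _ ne
      with x , ex ← shrink-col p (here refl) | y , ey ← rung-colour p tt
         | x′ , ex′ ← shrink-col q (here refl) | y′ , ey′ ← rung-colour q tt =
      col x y , col x′ y′ , transport-col⁺ p ex ey , transport-col⁺ q ex′ ey′ ,
      (λ { refl → ne (cong₂ col (shrink-injective (trans ex (sym ex′))) (shrink-injective (trans ey (sym ey′)))) }) , refl , refl
    rung-images {row i d} {col i′ d′} p q _ _ ne
      with x , ex ← shrink-row p (here refl) | y , ey ← rung-colour p tt
         | x′ , ex′ ← shrink-col q (here refl) | y′ , ey′ ← rung-colour q tt =
      row x y , col x′ y′ , transport-row⁺ p ex ey , transport-col⁺ q ex′ ey′ , (λ ()) , refl , refl
    rung-images {col i d} {row i′ d′} p q _ _ ne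
      with x , ex ← shrink-col p (here refl) | y , ey ← rung-colour p tt
         | x′ , ex′ ← shrink-row q (here refl) | y′ , ey′ ← rung-colour q tt =
      col x y , row x′ y′ , transport-col⁺ p ex ey , transport-row⁺ q ex′ ey′ , (λ ()) , refl , refl

    pairs = concatMap positions Es₀

    few-pairs : 2 + length pairs ≤ m
    few-pairs with rung-images e₂∈ e₃∈ (touches-rung {e₁ = e₁} touches) rung₃ e₂≢e₃
    ... | x , y , x∈ , y∈ , x≢y , px , py =
      ℕ.≤-trans (length-select<< positions positions≤1 x∈ y∈ x≢y px py) (length-transport _ _)

    rc∉ : (r′ , c′) ∉ pairs
    rc∉ p with ∈-select⁻ positions Es₀ p
    ... | cell _ _ d , e∈ , here refl with transport-cell⁻ {Es = Es} e∈
    ...   | i , j , d′ , e∈ , ei , ej , ed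
      with refl ← shrink-injective (trans ei (sym r′-spec)) with refl ← shrink-injective (trans ej (sym c′-spec))
      with refl ← cell-unique e∈ e₀∈ = contradiction (trans (sym (shrink-self u)) ed) λ ()

    open Arrangement (arrange m pairs r′ c′ rc∉ few-pairs)

    fr fc : Fin (suc m) → Maybe (Fin m)
    fr i = Maybe.map ρ (shrink r₁ i)
    fc j = Maybe.map κ (shrink c₁ j)

    fr-inj : ∀ {x y} → fr x ≡ fr y → x ≡ y
    fr-inj eq = shrink-injective (map-injective ρ-inj eq)

    fc-inj : ∀ {x y} → fc x ≡ fc y → x ≡ y
    fc-inj eq = shrink-injective (map-injective κ-inj eq)

    IH = smaller (concatMap (transport fr fc (shrink u)) Es)
           (coherent-transport fr-inj fc-inj shrink-injective coherent) (length-transport fr fc)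

    module K = Corona (proj₁ IH)
    module S = Smetaniuk (smetaniuk (proj₁ IH) u)

    corona-S : Corona (Fin (suc m)) (Fin (suc m)) (Fin (2 + m))
    corona-S = record
      { A = λ i j → S.A (fr i) (fc j) ; R = λ i → S.R (fr i) ; C = λ j → S.C (fc j)
      ; row = λ e → fc-inj (S.row e) ; col = λ e → fr-inj (S.col e) ; A≢R = S.A≢R ; A≢C = S.A≢C }

    fr-just : ∀ {i x} → shrink r₁ i ≡ just x → fr i ≡ just (ρ x)
    fr-just = cong (Maybe.map ρ)

    fc-just : ∀ {j x} → shrink c₁ j ≡ just x → fc j ≡ just (κ x)
    fc-just = cong (Maybe.map κ)

    lift : ∀ {x y d} → shrink u d ≡ just y → x ≡ y → punchIn u x ≡ d
    lift ed refl = sym (shrink-just⁻ ed)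

    row-satisfied : ∀ {i d x y} → row i d ∈ Es → shrink r₁ i ≡ just x → shrink u d ≡ just y → S.R (fr i) ≡ d
    row-satisfied {x = x} p ex ed =
      trans (cong S.R (fr-just ex)) (trans (S.R-old (ρ x)) (lift ed (proj₂ IH (transport-row⁺ p (fr-just ex) ed))))

    col-satisfied : ∀ {j d x y} → col j d ∈ Es → shrink c₁ j ≡ just x → shrink u d ≡ just y → S.C (fc j) ≡ d
    col-satisfied {x = x} p ex ed =
      trans (cong S.C (fc-just ex)) (trans (S.C-old (κ x)) (lift ed (proj₂ IH (transport-col⁺ p (fc-just ex) ed))))

    u-satisfied : S.A (fr r) (fc c) ≡ u
    u-satisfied = trans (cong₂ S.A (fr-just r′-spec) (fc-just c′-spec)) (S.A-diag diag)

    cell-satisfied : ∀ {i j d x y z} → cell i j d ∈ Es → shrink r₁ i ≡ just x → shrink c₁ j ≡ just y → shrink u d ≡ just z →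
                     S.A (fr i) (fc j) ≡ d
    cell-satisfied p ex ey ed = trans (cong₂ S.A (fr-just ex) (fc-just ey))
      (trans (S.A-left (left (∈-select⁺ positions (transport-cell⁺ {Es = Es} p ex ey ed) (here refl))))
             (lift ed (proj₂ IH (transport-cell⁺ p (fr-just ex) (fc-just ey) ed))))

    u-only : ∀ {i j d} → cell i j d ∈ Es → d ≡ u → S.A (fr i) (fc j) ≡ d
    u-only p d≡u = trans (cong₂ (λ a b → S.A (fr a) (fc b)) (proj₁ (same (single p d≡u))) (proj₂ (same (single p d≡u))))
      (trans u-satisfied (sym d≡u))
      where
      same : ∀ {n} {i j i′ j′ : Fin n} {d d′} → cell i j d ≡ cell i′ j′ d′ → i ≡ i′ × j ≡ j′
      same refl = refl , refl

    satisfies : ∀ {e} → e ∈ Es → Satisfies corona-S e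
    satisfies {row i d} p = row-satisfied p (proj₂ (shrink-row p (here refl))) (proj₂ (rung-colour p tt))
    satisfies {col j d} p = col-satisfied p (proj₂ (shrink-col p (here refl))) (proj₂ (rung-colour p tt))
    satisfies {cell i j d} p = cases (shrink-cases u d)
      where
      cases : shrink u d ≡ nothing ⊎ (∃ λ z → shrink u d ≡ just z) → S.A (fr i) (fc j) ≡ d
      cases (inj₁ ed)       = u-only p (shrink-nothing⁻ ed)
      cases (inj₂ (_ , ed)) = cell-satisfied p (proj₂ (shrink-row p (here refl))) (proj₂ (shrink-col p (here refl))) ed

  solution : Solution Es
  solution = corona-S , satisfies

-- Induction on the order for one layer.

corona-solution-step : ∀ {m} → (∀ (Es : List (Element m)) → Coherent Es → length Es ≤ m → Solution Es) →
             ∀ (Es : List (Element (suc m))) → Coherent Es → length Es ≤ suc m → Solution Es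
corona-solution-step {m} smaller Es coherent small with Any.any? rung? Es
... | no no-rung = cells-only coherent small no-rung
... | yes some-rung with Any.any? (λ e → rung? e ×-dec ¬? (clash? (colour e) Es)) Es
...   | yes good = let e , e∈ , isRung , ¬clash = find good in harmless-rung coherent small e∈ isRung ¬clash
...   | no all-clash with Any.any? (λ e → ¬? (Any.any? (λ e′ → (colour e′ F.≟ colour e) ×-dec ¬? (e′ ≟ᴱ e)) Es)) Es
...     | no none = all-repeated coherent small {proj₁ z-fresh} (λ e∈ eq → proj₂ z-fresh (subst (_∈ map colour Es) eq (∈.∈-map⁺ colour e∈))) repeated
  where
  z-fresh = fresh (map colour Es) (s≤s (subst (_≤ suc m) (sym (length-map colour Es)) small))
  repeated : ∀ {e} → e ∈ Es → ∃ λ e′ → e′ ∈ Es × colour e′ ≡ colour e × e′ ≢ e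
  repeated {e} e∈ = find (decidable-stable (Any.any? (λ e′ → (colour e′ F.≟ colour e) ×-dec ¬? (e′ ≟ᴱ e)) Es)
    (λ once → none (lose e∈ once)))
...     | yes once = case (find once)
  where
  clashes : ∀ {e} → e ∈ Es → Rung e → Clash (colour e) Es
  clashes {e} e∈ isRung = decidable-stable (clash? (colour e) Es) λ ¬clash → all-clash (lose e∈ (isRung , ¬clash))
  -- `e₁` has the colour of `e₃`; if `e₂` were `e₃`, then this rung would meet a cell of its own
  -- colour. So a clash always yields a second rung.
  apart : ∀ {e₁ e₂ e₃} → e₁ ∈ Es → e₃ ∈ Es → colour e₁ ≡ colour e₃ → Touches e₁ e₂ → e₂ ≢ e₃
  apart {cell _ _ _} {row _ _} p q refl refl refl = Coherent.row-cell coherent q p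
  apart {cell _ _ _} {col _ _} p q refl refl refl = Coherent.col-cell coherent q p
  case : (∃ λ e → e ∈ Es × ¬ Any (λ e′ → colour e′ ≡ colour e × e′ ≢ e) Es) → Solution Es
  case (e@(cell r c u) , e∈ , unique) with find some-rung
  ... | e₃ , e₃∈ , rung₃ with find (clashes e₃∈ rung₃)
  ...   | e₁ , e₁∈ , same , touching with find touching
  ...     | e₂ , e₂∈ , touches = SingleCell.solution smaller coherent small e∈
              (λ {e′} p eq → decidable-stable (e′ ≟ᴱ e) λ ne → unique (lose p (eq , ne)))
              e₁∈ e₂∈ e₃∈ touches rung₃ (apart e₁∈ e₃∈ same touches)
  -- A rung whose colour clashes shares this colour with a cell, so a colour occurring once belongs
  -- to a cell.
  case (e@(row _ _) , e∈ , unique) with find (clashes e∈ tt)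
  ... | cell _ _ _ , e₁∈ , same , _ = contradiction (lose e₁∈ (same , λ ())) unique
  ... | row _ _ , _ , _ , touching = contradiction (proj₂ (proj₂ (find touching))) λ ()
  ... | col _ _ , _ , _ , touching = contradiction (proj₂ (proj₂ (find touching))) λ ()
  case (e@(col _ _) , e∈ , unique) with find (clashes e∈ tt)
  ... | cell _ _ _ , e₁∈ , same , _ = contradiction (lose e₁∈ (same , λ ())) unique
  ... | row _ _ , _ , _ , touching = contradiction (proj₂ (proj₂ (find touching))) λ ()
  ... | col _ _ , _ , _ , touching = contradiction (proj₂ (proj₂ (find touching))) λ ()

corona-solution : ∀ n (Es : List (Element n)) → Coherent Es → length Es ≤ n → Solution Es
corona-solution zero [] _ _ = record
  { A = λ () ; R = λ () ; C = λ () ; row = λ { {()} } ; col = λ { {()} } ; A≢R = λ { {()} } ; A≢C = λ { {()} } } , λ ()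
corona-solution (suc m) = corona-solution-step (corona-solution m)

-- The two layers

module _ {n : ℕ} {A : Fin 2 → Fin n → Fin n → Fin (suc n)} {R C : Fin n → Fin (suc n)}
         (rowA : ∀ l {i j j′} → A l i j ≡ A l i j′ → j ≡ j′) (colA : ∀ l {i i′ j} → A l i j ≡ A l i′ j → i ≡ i′)
         (A≢R : ∀ l {i j} → A l i j ≢ R i) (A≢C : ∀ l {i j} → A l i j ≢ C j) where

  assemble : Edge n → Fin (suc n)
  assemble (bip i j l)         = A l i j
  assemble (rung zero i)       = R i
  assemble (rung (suc zero) j) = C j

  assemble-proper : ProperColoring n (suc n) assemble
  assemble-proper _ _ (ne , _ , bip-left {l = l} , bip-left)   eq = ne (cong (λ j → bip _ j _) (rowA l eq))
  assemble-proper _ _ (ne , _ , bip-right {l = l} , bip-right) eq = ne (cong (λ i → bip i _ _) (colA l eq))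
  assemble-proper _ _ (ne , _ , bip-left , rung-0)  eq = A≢R zero eq
  assemble-proper _ _ (ne , _ , bip-left , rung-1)  eq = A≢R (suc zero) eq
  assemble-proper _ _ (ne , _ , bip-right , rung-0) eq = A≢C zero eq
  assemble-proper _ _ (ne , _ , bip-right , rung-1) eq = A≢C (suc zero) eq
  assemble-proper _ _ (ne , _ , rung-0 , bip-left)  eq = A≢R zero (sym eq)
  assemble-proper _ _ (ne , _ , rung-0 , bip-right) eq = A≢C zero (sym eq)
  assemble-proper _ _ (ne , _ , rung-1 , bip-left)  eq = A≢R (suc zero) (sym eq)
  assemble-proper _ _ (ne , _ , rung-1 , bip-right) eq = A≢C (suc zero) (sym eq)
  assemble-proper _ _ (ne , _ , rung-0 , rung-0) _ = ne refl
  assemble-proper _ _ (ne , _ , rung-1 , rung-1) _ = ne refl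

∈-allEdges : ∀ {n} (e : Edge n) → e ∈ allEdges n
∈-allEdges {n} (bip i j l) = ∈.∈-++⁺ˡ (∈-select⁺ _ (∈.∈-allFin i) (∈-select⁺ _ (∈.∈-allFin j) (∈.∈-map⁺ (bip i j) (∈.∈-allFin l))))
∈-allEdges {n} (rung s i)  = ∈.∈-++⁺ʳ (concatMap (λ i → concatMap (λ j → map (bip i j) (allFin 2)) (allFin n)) (allFin n))
  (∈-select⁺ (λ s → map (rung s) (allFin n)) (∈.∈-allFin s) (∈.∈-map⁺ (rung s) (∈.∈-allFin i)))

module _ {n : ℕ} (φ : Precoloring n (suc n)) (proper : ProperPrecoloring n (suc n) φ) (few : numColored φ ≤ n) where

  private
    Coloured : Set
    Coloured = Edge n × Fin (suc n)

    colouring : Edge n → List Coloured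
    colouring e = maybe′ (λ c → (e , c) ∷ []) [] (φ e)

    Φ : List Coloured
    Φ = concatMap colouring (allEdges n)

    length-colouring : ∀ es → length (concatMap colouring es) ≡ length (filter (λ e → T? (is-just (φ e))) es)
    length-colouring [] = refl
    length-colouring (e ∷ es) with φ e
    ... | just _  = cong suc (length-colouring es)
    ... | nothing = length-colouring es

    small : length Φ ≤ n
    small = subst (_≤ n) (sym (length-colouring (allEdges n))) few

    Φ⁺ : ∀ {e c} → φ e ≡ just c → (e , c) ∈ Φ
    Φ⁺ {e} {c} eq = ∈-select⁺ colouring (∈-allEdges e) (subst (λ m → (e , c) ∈ maybe′ (λ c → (e , c) ∷ []) [] m) (sym eq) (here refl))

    Φ⁻ : ∀ {e c} → (e , c) ∈ Φ → φ e ≡ just c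
    Φ⁻ p with ∈-select⁻ colouring (allEdges n) p
    ... | e , _ , q with φ e in eq
    Φ⁻ p | e , _ , here refl | just c = eq

    meet : ∀ {e e′ c} v → v ∈ₑ e → v ∈ₑ e′ → φ e ≡ just c → φ e′ ≡ just c → ¬ e ≢ e′
    meet v v∈ v∈′ p q ne = proper _ _ _ (ne , v , v∈ , v∈′) p q

    same-row : ∀ {i j j′ l c} → φ (bip i j l) ≡ just c → φ (bip i j′ l) ≡ just c → j ≡ j′
    same-row {i} {j} {j′} {l} p q = decidable-stable (j F.≟ j′) λ ne →
      meet (zero , i , l) bip-left bip-left p q λ { refl → ne refl }

    same-col : ∀ {i i′ j l c} → φ (bip i j l) ≡ just c → φ (bip i′ j l) ≡ just c → i ≡ i′
    same-col {i} {i′} {j} {l} p q = decidable-stable (i F.≟ i′) λ ne →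
      meet (suc zero , j , l) bip-right bip-right p q λ { refl → ne refl }

    rung-row : ∀ {i j l c} → φ (rung zero i) ≡ just c → φ (bip i j l) ≡ just c → ⊥
    rung-row {i} {l = zero}     p q = meet (zero , i , zero) rung-0 bip-left p q λ ()
    rung-row {i} {l = suc zero} p q = meet (zero , i , suc zero) rung-1 bip-left p q λ ()

    rung-col : ∀ {i j l c} → φ (rung (suc zero) j) ≡ just c → φ (bip i j l) ≡ just c → ⊥
    rung-col {j = j} {zero}     p q = meet (suc zero , j , zero) rung-0 bip-right p q λ ()
    rung-col {j = j} {suc zero} p q = meet (suc zero , j , suc zero) rung-1 bip-right p q λ ()

    same-colour : ∀ {e c d} → φ e ≡ just c → φ e ≡ just d → c ≡ d
    same-colour p q = just-injective (trans (sym p) q)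

    InLayer : Fin 2 → Coloured → Set
    InLayer l (bip _ _ l′ , _) = l′ ≡ l
    InLayer l (rung _ _ , _)   = ⊥

    inLayer? : ∀ l x → Dec (InLayer l x)
    inLayer? l (bip _ _ l′ , _) = l′ F.≟ l
    inLayer? l (rung _ _ , _)   = no λ ()

    element : Coloured → Element n
    element (bip i j _ , c)         = cell i j c
    element (rung zero i , c)       = row i c
    element (rung (suc zero) j , c) = col j c

    Es : List (Element n)
    Es = map element Φ

    Es-cell : ∀ {i j c} → cell i j c ∈ Es → ∃ λ l → φ (bip i j l) ≡ just c
    Es-cell p with ∈.∈-map⁻ element p
    ... | (bip i j l , c) , q , refl = l , Φ⁻ q
    ... | (rung zero _ , _) , _ , ()
    ... | (rung (suc zero) _ , _) , _ , ()

    Es-row : ∀ {i c} → row i c ∈ Es → φ (rung zero i) ≡ just c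
    Es-row p with ∈.∈-map⁻ element p
    ... | (rung zero _ , _) , q , refl = Φ⁻ q
    ... | (rung (suc zero) _ , _) , _ , ()

    Es-col : ∀ {j c} → col j c ∈ Es → φ (rung (suc zero) j) ≡ just c
    Es-col p with ∈.∈-map⁻ element p
    ... | (rung (suc zero) _ , _) , q , refl = Φ⁻ q
    ... | (rung zero _ , _) , _ , ()

    Extendable : Set
    Extendable = Σ (Edge n → Fin (suc n)) λ f → ProperColoring n (suc n) f × Extends f φ

    one-layer : ∀ l → (∀ {i j l′ c} → φ (bip i j l′) ≡ just c → l′ ≡ l) → Extendable
    one-layer l only = assemble (λ _ → K.row) (λ _ → K.col) (λ _ → K.A≢R) (λ _ → K.A≢C) ,
      assemble-proper (λ _ → K.row) (λ _ → K.col) (λ _ → K.A≢R) (λ _ → K.A≢C) , extends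
      where
      cell-φ : ∀ {i j c} → cell i j c ∈ Es → φ (bip i j l) ≡ just c
      cell-φ p with Es-cell p
      ... | l′ , e with refl ← only e = e
      solution = corona-solution n Es (record
        { row-unique = λ p q → same-colour (Es-row p) (Es-row q)
        ; col-unique = λ p q → same-colour (Es-col p) (Es-col q)
        ; row-cell = λ p q → rung-row (Es-row p) (cell-φ q)
        ; col-cell = λ p q → rung-col (Es-col p) (cell-φ q)
        ; cell-unique = λ p q → same-colour (cell-φ p) (cell-φ q)
        ; cell-row = λ p q → same-row (cell-φ p) (cell-φ q)
        ; cell-col = λ p q → same-col (cell-φ p) (cell-φ q) })
        (subst (_≤ n) (sym (length-map element Φ)) small)
      module K = Corona (proj₁ solution)
      extends : Extends _ φ
      extends (bip i j l)         c eq = proj₂ solution (∈.∈-map⁺ element (Φ⁺ eq))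
      extends (rung zero i)       c eq = proj₂ solution (∈.∈-map⁺ element (Φ⁺ eq))
      extends (rung (suc zero) j) c eq = proj₂ solution (∈.∈-map⁺ element (Φ⁺ eq))

    module TwoLayers (occupied : ∀ l → Any (InLayer l) Φ) where
      colours : List (Fin (suc n))
      colours = map proj₂ Φ

      z-fresh : ∃ λ z → z ∉ colours
      z-fresh = fresh colours (s≤s (subst (_≤ n) (sym (length-map proj₂ Φ)) small))

      z : Fin (suc n)
      z = proj₁ z-fresh

      unused : ∀ {e c} → φ e ≡ just c → c ≢ z
      unused p refl = proj₂ z-fresh (∈.∈-map⁺ proj₂ (Φ⁺ p))

      tr : Transversal z Es
      tr = transversal z Es (record
        { row-unique = λ p q → same-colour (Es-row p) (Es-row q)
        ; col-unique = λ p q → same-colour (Es-col p) (Es-col q)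
        -- A rung has an end in each layer, so it may be compared with a cell of either one.
        ; row-cell = λ p q → rung-row (Es-row p) (proj₂ (Es-cell q))
        ; col-cell = λ p q → rung-col (Es-col p) (proj₂ (Es-cell q))
        ; z-row = λ p _ → absurd p ; z-col = λ p _ → absurd p ; z-inrow = λ p _ → absurd p
        ; z-incol = λ p _ → absurd p ; z-only = λ p _ → absurd p })
        (subst (_≤ n) (sym (length-map element Φ)) small)
        where
        absurd : ∀ {i j} {B : Set} → cell i j z ∈ Es → B
        absurd p = contradiction refl (unused (proj₂ (Es-cell p)))

      open FromTransversal z tr

      lower-layer : Fin 2 → Coloured → List (Cell n n)
      lower-layer l x with inLayer? l x
      ... | yes _ = lower-cell z (element x)
      ... | no _  = []

      layer : Fin 2 → List (Cell n n)
      layer l = concatMap (lower-layer l) Φ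

      layer⁻ : ∀ {l i j x} → (i , j , x) ∈ layer l → φ (bip i j l) ≡ just (punchIn z x)
      layer⁻ {l} p with ∈-select⁻ (lower-layer l) Φ p
      ... | (bip i j l′ , c) , e∈ , q with l′ F.≟ l
      ...   | yes refl with triple⁻ {a = just i} {just j} q
      ...     | refl , refl , e = subst (λ t → φ (bip i j l) ≡ just t) (shrink-just⁻ e) (Φ⁻ e∈)

      layer⁺ : ∀ {l i j c x} → φ (bip i j l) ≡ just c → c ≡ punchIn z x → (i , j , x) ∈ layer l
      layer⁺ {l} {i} {j} {c} {x} p eq = ∈-select⁺ (lower-layer l) (Φ⁺ p) lowered
        where
        lowered : (i , j , x) ∈ lower-layer l (bip i j l , c)
        lowered with l F.≟ l
        ... | yes _ = triple⁺ refl refl (trans (cong (shrink z) eq) (shrink-punchIn z x))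
        ... | no ne = contradiction refl ne

      consistent : ∀ l → Consistent (layer l)
      consistent l = record
        { cell = λ p q → F.punchIn-injective z _ _ (same-colour (layer⁻ p) (layer⁻ q))
        ; row = λ p q → same-row (layer⁻ p) (layer⁻ q)
        ; col = λ p q → same-col (layer⁻ p) (layer⁻ q) }

      source : ∀ {l i j x} → (i , j , x) ∈ layer l → cell i j (punchIn z x) ∈ Es
      source p = ∈.∈-map⁺ element (Φ⁺ (layer⁻ p))

      weight≤1 : ∀ l x → length (lower-layer l x) + length (demand z (element x)) ≤ 1
      weight≤1 l x with inLayer? l x
      ... | yes _ = lower-demand≤1 z (element x)
      ... | no _  = ℕ.≤-trans (ℕ.m≤n+m _ (length (lower-cell z (element x)))) (lower-demand≤1 z (element x))

      other-layer : ∀ {l l′} x → l′ ≢ l → InLayer l′ x → x ∈ Φ → length (lower-layer l x) + length (demand z (element x)) ≡ 0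
      other-layer {l} (bip i j l′ , c) ne refl x∈ with l′ F.≟ l | demand? z (cell i j c)
      ... | yes eq | _     = contradiction eq ne
      ... | no _   | yes d = contradiction d (unused (Φ⁻ x∈))
      ... | no _   | no _  = refl

      otherLayer : ∀ l → ∃ λ (l′ : Fin 2) → l′ ≢ l
      otherLayer zero       = suc zero , λ ()
      otherLayer (suc zero) = zero , λ ()

      layer-small : ∀ l → length (with-T (layer l)) < n
      layer-small l = ℕ.≤-<-trans (length-with-T (layer l)) (ℕ.<-≤-trans
        (subst (λ d → length (layer l) + length d < length Φ) (sym (concatMap-map (demand z) element Φ)) bound) small)
        where
        bound : length (layer l) + length (concatMap (λ x → demand z (element x)) Φ) < length Φ
        bound with otherLayer l
        ... | l′ , ne with find (occupied l′)
        ...   | x , x∈ , inside = length-split< (lower-layer l) (λ x → demand z (element x)) (weight≤1 l) x∈ (other-layer x ne inside x∈)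

      module X (l : Fin 2) = Exchange {layer l} source
        (evans n (with-T (layer l)) (consistent-with-T (consistent l) source) (layer-small l))

      extension : Extendable
      extension = assemble rowA colA A≢R A≢C , assemble-proper rowA colA A≢R A≢C , extends
        where
        rowA : ∀ l {i j j′} → X.A l i j ≡ X.A l i j′ → j ≡ j′
        rowA l = Corona.row (X.corona l)
        colA : ∀ l {i i′ j} → X.A l i j ≡ X.A l i′ j → i ≡ i′
        colA l = Corona.col (X.corona l)
        A≢R : ∀ l {i j} → X.A l i j ≢ R i
        A≢R l = Corona.A≢R (X.corona l)
        A≢C : ∀ l {i j} → X.A l i j ≢ C j
        A≢C l = Corona.A≢C (X.corona l)
        extends : Extends _ φ
        extends (bip i j l) c eq with shrink-just⁺ (unused eq)
        ... | x , e = trans (X.A-base l (layer⁺ eq (shrink-just⁻ e))) (sym (shrink-just⁻ e))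
        extends (rung zero i)       c eq = R-Es (∈.∈-map⁺ element (Φ⁺ eq))
        extends (rung (suc zero) j) c eq = C-Es (∈.∈-map⁺ element (Φ⁺ eq))

  extend : Σ (Edge n → Fin (suc n)) λ f → ProperColoring n (suc n) f × Extends f φ
  extend with Any.any? (inLayer? zero) Φ | Any.any? (inLayer? (suc zero)) Φ
  ... | no none | _ = one-layer (suc zero) λ { {l′ = zero} p → contradiction (lose (Φ⁺ p) refl) none ; {l′ = suc zero} _ → refl }
  ... | yes _ | no none = one-layer zero λ { {l′ = suc zero} p → contradiction (lose (Φ⁺ p) refl) none ; {l′ = zero} _ → refl }
  ... | yes some₀ | yes some₁ = TwoLayers.extension λ { zero → some₀ ; (suc zero) → some₁ }

theorem2p5 : (n : ℕ) → n ≥ 2 → (φ : Precoloring n (suc n)) → ProperPrecoloring n (suc n) φ → numColored φ ≡ n → Σ (Edge n → Fin (suc n)) (λ f → ProperColoring n (suc n) f × Extends f φ)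
theorem2p5 n _ φ proper count = extend φ proper (ℕ.≤-reflexive count)
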